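{- For every odd positive integer $n$ and every $D > 1$, there is an instance of colorful $k$-center with $8n$ points, $k=n$, and $r=b=2n$, such that every solution has radius at least $D$, yet the polytope of LP1 with unit radius for this instance is not recognized as infeasible by $\Omega(n)$ rounds of the Sum-of-Squares hierarchy: there is a constant $c>0$ (independent of $n$ and $D$) such that for every $t \le cn$ the $t$-th SoS lifted polytope $SoS^t(K)$ of the LP1 polytope $K$ is nonempty. Consequently the integrality gap of LP1 with $8n$ points persists (is unbounded) up to $\Omega(n)$ rounds of Sum-of-Squares.
   Context: An instance of colorful $k$-center consists of a finite set $P$ of points with a metric $d$, a partition $P=R\cup B$ into red and blue points, and integers $k,r,b\ge0$; with $\mathcal{B}(j,\rho)=\{p\in P:d(j,p)\le\rho\}$, a solution of radius $\rho$ is $C\subseteq P$, $|C|\le k$, with $\bigcup_{c\in C}\mathcal{B}(c,\rho)$ containing at least $r$ red and $b$ blue points. LP1 (unit radius, $\mathcal{B}(j)=\mathcal{B}(j,1)$) is the polytope $K$ of vectors $(x,z)\in[0,1]^{P}\times[0,1]^P$ with $\sum_{i\in\mathcal{B}(j)}x_i\ge z_j$ for all $j\in P$, $\sum_{i\in P}x_i\le k$, $\sum_{j\in R}z_j\ge r$, $\sum_{j\in B}z_j\ge b$. Sum-of-Squares: let $V$ be the variable set, $K=\{v\in[0,1]^V: g_\ell(v)\ge0,\ \ell=1,\dots,m\}$ with linear $g_\ell$. $\mathcal{P}_t(V)$ denotes subsets of $V$ of size at most $t$. For $y\in\mathbb{R}^{\mathcal{P}(V)}$ and $g(v)=\sum_{I\subseteq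 V} a_I\prod_{i\in I}v_i$, $(g*y)_I=\sum_{J\subseteq V}a_J y_{I\cup J}$. For a collection $\mathcal{T}$ of subsets, $M_{\mathcal{T}}(y)$ is the matrix indexed by $\mathcal{T}$ with $(M_{\mathcal{T}}(y))_{I,J}=y_{I\cup J}$. The $t$-th SoS lifted polytope $SoS^t(K)$ is the set of $y\in[0,1]^{\mathcal{P}_{2t}(V)}$ with $y_\emptyset=1$, $M_{\mathcal{P}_t(V)}(y)\succeq0$, and $M_{\mathcal{P}_{t-1}(V)}(g_\ell*y)\succeq0$ for all $\ell$. -}

module Defs where

open import Data.Bool using (if_then_else_)
open import Data.Fin using (Fin; splitAt)
import Data.Fin.Properties as Fin
open import Data.Fin.Subset using (Subset; inside; outside; _∈_; _∪_; ∁; ∣_∣; ⁅_⁆; ⊥)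
open import Data.Fin.Subset.Properties using (_∈?_)
import Data.Integer as ℤ
open import Data.List using (List; []; _∷_; _++_; map; foldr; filter; tabulate; allFin)
open import Data.List.Relation.Unary.All using (All)
open import Data.Nat as ℕ using (ℕ; zero; suc)
import Data.Nat.Properties as ℕ
open import Data.Product using (Σ; ∃; _×_; _,_; proj₁; proj₂)
open import Data.Rational as ℚ using (ℚ; 0ℚ; 1ℚ; ½; Positive; positive)
import Data.Rational.Properties as ℚ
open import Data.Rational.Solver using (module +-*-Solver)
open import Data.Sum using ([_,_]′)
open import Data.Bool.Properties using () renaming (_≟_ to _≟ᵇ_)
open import Data.Vec using ([]; _∷_)
open import Data.Vec.Properties using (≡-dec)
open import Function using (_∘_; _⇔_)
open import Relation.Binary.PropositionalEquality using (_≡_; refl; sym; trans; cong; subst)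
open import Relation.Binary.Definitions using (DecidableEquality)
open import Relation.Nullary using (Dec; does; yes; no)

------------------------------------------------------------------------
-- Real numbers: Cauchy sequences of rationals, taken up to _≈ℝ_.
-- The operations are pointwise.

IsCauchy : (ℕ → ℚ) → Set
IsCauchy s = ∀ ε → 0ℚ ℚ.< ε →
  ∃ λ N → ∀ m n → N ℕ.≤ m → N ℕ.≤ n → ℚ.∣ s m ℚ.- s n ∣ ℚ.≤ ε

record ℝ : Set where
  constructor mkℝ
  field
    seq    : ℕ → ℚ
    cauchy : IsCauchy seq

open ℝ public

infix 4 _≈ℝ_ _≤ℝ_ _<ℝ_

_≈ℝ_ : ℝ → ℝ → Set
x ≈ℝ y = ∀ ε → 0ℚ ℚ.< ε →
  ∃ λ N → ∀ n → N ℕ.≤ n → ℚ.∣ seq x n ℚ.- seq y n ∣ ℚ.≤ ε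

_≤ℝ_ : ℝ → ℝ → Set
x ≤ℝ y = ∀ ε → 0ℚ ℚ.< ε →
  ∃ λ N → ∀ n → N ℕ.≤ n → seq x n ℚ.≤ seq y n ℚ.+ ε

_<ℝ_ : ℝ → ℝ → Set
x <ℝ y = ∃ λ ε → 0ℚ ℚ.< ε ×
  ∃ λ N → ∀ n → N ℕ.≤ n → seq x n ℚ.+ ε ℚ.≤ seq y n

private
  half-pos : ∀ ε → 0ℚ ℚ.< ε → 0ℚ ℚ.< ½ ℚ.* ε
  half-pos ε 0<ε = ℚ.<-respˡ-≡ (ℚ.*-zeroʳ ½) (ℚ.*-monoʳ-<-pos ½ 0<ε)

  half+half : ∀ ε → ½ ℚ.* ε ℚ.+ ½ ℚ.* ε ≡ ε
  half+half ε = trans (sym (ℚ.*-distribʳ-+ ε ½ ½)) (ℚ.*-identityˡ ε)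

  ∣p-p∣≡0 : ∀ p → ℚ.∣ p ℚ.- p ∣ ≡ 0ℚ
  ∣p-p∣≡0 p = cong ℚ.∣_∣ (ℚ.+-inverseʳ p)

  scale : ∀ B ε → 0ℚ ℚ.< B → 0ℚ ℚ.< ε → ∃ λ δ → 0ℚ ℚ.< δ × B ℚ.* δ ≡ ε
  scale B ε 0<B 0<ε = 1/B ℚ.* ε , 0<δ , B*δ≡ε
    where
    instance
      B-pos : Positive B
      B-pos = positive 0<B
      B-nz : ℚ.NonZero B
      B-nz = ℚ.pos⇒nonZero B
    1/B : ℚ
    1/B = ℚ.1/ B
    instance
      1/B-pos : Positive 1/B
      1/B-pos = ℚ.1/pos⇒pos B
    0<δ : 0ℚ ℚ.< 1/B ℚ.* ε
    0<δ = ℚ.<-respˡ-≡ (ℚ.*-zeroʳ 1/B) (ℚ.*-monoʳ-<-pos 1/B 0<ε)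
    B*δ≡ε : B ℚ.* (1/B ℚ.* ε) ≡ ε
    B*δ≡ε = trans (sym (ℚ.*-assoc B 1/B ε))
              (trans (cong (ℚ._* ε) (ℚ.*-inverseʳ B)) (ℚ.*-identityˡ ε))

  bounded : ∀ s → IsCauchy s →
            ∃ λ B → 0ℚ ℚ.< B × ∃ λ N → ∀ n → N ℕ.≤ n → ℚ.∣ s n ∣ ℚ.≤ B
  bounded s c = B , 0<B , N , bnd
    where
    0<1 : 0ℚ ℚ.< 1ℚ
    0<1 = ℚ.positive⁻¹ 1ℚ
    N : ℕ
    N = proj₁ (c 1ℚ 0<1)
    B : ℚ
    B = 1ℚ ℚ.+ ℚ.∣ s N ∣
    0<B : 0ℚ ℚ.< B
    0<B = ℚ.+-mono-<-≤ 0<1 (ℚ.0≤∣p∣ (s N))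
    split : ∀ p q → (p ℚ.- q) ℚ.+ q ≡ p
    split = solve 2 (λ p q → (p :- q) :+ q := p) refl
      where open +-*-Solver
    bnd : ∀ n → N ℕ.≤ n → ℚ.∣ s n ∣ ℚ.≤ B
    bnd n N≤n = begin
      ℚ.∣ s n ∣                          ≡⟨ cong ℚ.∣_∣ (split (s n) (s N)) ⟨
      ℚ.∣ (s n ℚ.- s N) ℚ.+ s N ∣        ≤⟨ ℚ.∣p+q∣≤∣p∣+∣q∣ (s n ℚ.- s N) (s N) ⟩
      ℚ.∣ s n ℚ.- s N ∣ ℚ.+ ℚ.∣ s N ∣    ≤⟨ ℚ.+-monoˡ-≤ ℚ.∣ s N ∣ (proj₂ (c 1ℚ 0<1) n N N≤n ℕ.≤-refl) ⟩
      B                                  ∎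
      where open ℚ.≤-Reasoning

  *-bound : ∀ {p q B δ} → 0ℚ ℚ.< B → ℚ.∣ p ∣ ℚ.≤ B → ℚ.∣ q ∣ ℚ.≤ δ → ℚ.∣ p ℚ.* q ∣ ℚ.≤ B ℚ.* δ
  *-bound {p} {q} {B} {δ} 0<B p≤B q≤δ = begin
      ℚ.∣ p ℚ.* q ∣            ≡⟨ ℚ.∣p*q∣≡∣p∣*∣q∣ p q ⟩
      ℚ.∣ p ∣ ℚ.* ℚ.∣ q ∣      ≤⟨ ℚ.*-monoʳ-≤-nonNeg ℚ.∣ q ∣ {{ℚ.∣-∣-nonNeg q}} p≤B ⟩
      B ℚ.* ℚ.∣ q ∣            ≤⟨ ℚ.*-monoˡ-≤-nonNeg B {{ℚ.pos⇒nonNeg B {{positive 0<B}}}} q≤δ ⟩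
      B ℚ.* δ                  ∎
      where open ℚ.≤-Reasoning

abstract
  const-cauchy : ∀ q → IsCauchy (λ _ → q)
  const-cauchy q ε 0<ε = 0 , λ _ _ _ _ → subst (ℚ._≤ ε) (sym (∣p-p∣≡0 q)) (ℚ.<⇒≤ 0<ε)

  neg-cauchy : ∀ s → IsCauchy s → IsCauchy (λ n → ℚ.- s n)
  neg-cauchy s c ε 0<ε = proj₁ (c ε 0<ε) , λ m n N≤m N≤n →
    subst (ℚ._≤ ε) (eq (s m) (s n)) (proj₂ (c ε 0<ε) m n N≤m N≤n)
    where
    flip-neg : ∀ p q → ℚ.- (p ℚ.- q) ≡ ℚ.- p ℚ.- ℚ.- q
    flip-neg = solve 2 (λ p q → :- (p :- q) := :- p :- :- q) refl
      where open +-*-Solver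
    eq : ∀ p q → ℚ.∣ p ℚ.- q ∣ ≡ ℚ.∣ ℚ.- p ℚ.- ℚ.- q ∣
    eq p q = trans (sym (ℚ.∣-p∣≡∣p∣ (p ℚ.- q))) (cong ℚ.∣_∣ (flip-neg p q))

  +-cauchy : ∀ s u → IsCauchy s → IsCauchy u → IsCauchy (λ n → s n ℚ.+ u n)
  +-cauchy s u c d ε 0<ε = N ℕ.⊔ M , close
    where
    η : ℚ
    η = ½ ℚ.* ε
    N M : ℕ
    N = proj₁ (c η (half-pos ε 0<ε))
    M = proj₁ (d η (half-pos ε 0<ε))
    rearrange : ∀ a b a′ b′ → (a ℚ.+ b) ℚ.- (a′ ℚ.+ b′) ≡ (a ℚ.- a′) ℚ.+ (b ℚ.- b′)
    rearrange = solve 4 (λ a b a′ b′ → (a :+ b) :- (a′ :+ b′) := (a :- a′) :+ (b :- b′)) refl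
      where open +-*-Solver
    close : ∀ m n → N ℕ.⊔ M ℕ.≤ m → N ℕ.⊔ M ℕ.≤ n →
            ℚ.∣ (s m ℚ.+ u m) ℚ.- (s n ℚ.+ u n) ∣ ℚ.≤ ε
    close m n ≤m ≤n = begin
      ℚ.∣ (s m ℚ.+ u m) ℚ.- (s n ℚ.+ u n) ∣          ≡⟨ cong ℚ.∣_∣ (rearrange (s m) (u m) (s n) (u n)) ⟩
      ℚ.∣ (s m ℚ.- s n) ℚ.+ (u m ℚ.- u n) ∣          ≤⟨ ℚ.∣p+q∣≤∣p∣+∣q∣ (s m ℚ.- s n) (u m ℚ.- u n) ⟩
      ℚ.∣ s m ℚ.- s n ∣ ℚ.+ ℚ.∣ u m ℚ.- u n ∣        ≤⟨ ℚ.+-mono-≤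
          (proj₂ (c η (half-pos ε 0<ε)) m n (ℕ.m⊔n≤o⇒m≤o N M ≤m) (ℕ.m⊔n≤o⇒m≤o N M ≤n))
          (proj₂ (d η (half-pos ε 0<ε)) m n (ℕ.m⊔n≤o⇒n≤o N M ≤m) (ℕ.m⊔n≤o⇒n≤o N M ≤n)) ⟩
      η ℚ.+ η                                        ≡⟨ half+half ε ⟩
      ε                                              ∎
      where open ℚ.≤-Reasoning

  *-cauchy : ∀ s u → IsCauchy s → IsCauchy u → IsCauchy (λ n → s n ℚ.* u n)
  *-cauchy s u c d ε 0<ε = (N₁ ℕ.⊔ N₂) ℕ.⊔ (M₁ ℕ.⊔ M₂) , close
    where
    η : ℚ
    η = ½ ℚ.* ε
    B₁ B₂ δ₁ δ₂ : ℚ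
    0<B₁ : 0ℚ ℚ.< B₁
    0<B₂ : 0ℚ ℚ.< B₂
    B₁ = proj₁ (bounded s c)
    B₂ = proj₁ (bounded u d)
    0<B₁ = proj₁ (proj₂ (bounded s c))
    0<B₂ = proj₁ (proj₂ (bounded u d))
    sc₁ : ∃ λ δ → 0ℚ ℚ.< δ × B₁ ℚ.* δ ≡ η
    sc₁ = scale B₁ η 0<B₁ (half-pos ε 0<ε)
    sc₂ : ∃ λ δ → 0ℚ ℚ.< δ × B₂ ℚ.* δ ≡ η
    sc₂ = scale B₂ η 0<B₂ (half-pos ε 0<ε)
    δ₁ = proj₁ sc₁
    δ₂ = proj₁ sc₂
    N₁ N₂ M₁ M₂ : ℕ
    N₁ = proj₁ (proj₂ (proj₂ (bounded s c)))
    N₂ = proj₁ (proj₂ (proj₂ (bounded u d)))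
    M₁ = proj₁ (d δ₁ (proj₁ (proj₂ sc₁)))
    M₂ = proj₁ (c δ₂ (proj₁ (proj₂ sc₂)))
    rearrange : ∀ a b a′ b′ → a ℚ.* b ℚ.- a′ ℚ.* b′ ≡ a ℚ.* (b ℚ.- b′) ℚ.+ b′ ℚ.* (a ℚ.- a′)
    rearrange = solve 4 (λ a b a′ b′ → a :* b :- a′ :* b′ := a :* (b :- b′) :+ b′ :* (a :- a′)) refl
      where open +-*-Solver
    module _ {k : ℕ} (h : (N₁ ℕ.⊔ N₂) ℕ.⊔ (M₁ ℕ.⊔ M₂) ℕ.≤ k) where
      hN : N₁ ℕ.⊔ N₂ ℕ.≤ k
      hN = ℕ.m⊔n≤o⇒m≤o (N₁ ℕ.⊔ N₂) (M₁ ℕ.⊔ M₂) h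
      hM : M₁ ℕ.⊔ M₂ ℕ.≤ k
      hM = ℕ.m⊔n≤o⇒n≤o (N₁ ℕ.⊔ N₂) (M₁ ℕ.⊔ M₂) h
    close : ∀ m n → (N₁ ℕ.⊔ N₂) ℕ.⊔ (M₁ ℕ.⊔ M₂) ℕ.≤ m → (N₁ ℕ.⊔ N₂) ℕ.⊔ (M₁ ℕ.⊔ M₂) ℕ.≤ n →
            ℚ.∣ s m ℚ.* u m ℚ.- s n ℚ.* u n ∣ ℚ.≤ ε
    close m n ≤m ≤n = begin
      ℚ.∣ s m ℚ.* u m ℚ.- s n ℚ.* u n ∣
        ≡⟨ cong ℚ.∣_∣ (rearrange (s m) (u m) (s n) (u n)) ⟩
      ℚ.∣ s m ℚ.* (u m ℚ.- u n) ℚ.+ u n ℚ.* (s m ℚ.- s n) ∣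
        ≤⟨ ℚ.∣p+q∣≤∣p∣+∣q∣ (s m ℚ.* (u m ℚ.- u n)) (u n ℚ.* (s m ℚ.- s n)) ⟩
      ℚ.∣ s m ℚ.* (u m ℚ.- u n) ∣ ℚ.+ ℚ.∣ u n ℚ.* (s m ℚ.- s n) ∣
        ≤⟨ ℚ.+-mono-≤
             (*-bound {s m} {u m ℚ.- u n} 0<B₁
               (proj₂ (proj₂ (proj₂ (bounded s c))) m (ℕ.m⊔n≤o⇒m≤o N₁ N₂ (hN ≤m)))
               (proj₂ (d δ₁ (proj₁ (proj₂ sc₁))) m n (ℕ.m⊔n≤o⇒m≤o M₁ M₂ (hM ≤m)) (ℕ.m⊔n≤o⇒m≤o M₁ M₂ (hM ≤n))))
             (*-bound {u n} {s m ℚ.- s n} 0<B₂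
               (proj₂ (proj₂ (proj₂ (bounded u d))) n (ℕ.m⊔n≤o⇒n≤o N₁ N₂ (hN ≤n)))
               (proj₂ (c δ₂ (proj₁ (proj₂ sc₂))) m n (ℕ.m⊔n≤o⇒n≤o M₁ M₂ (hM ≤m)) (ℕ.m⊔n≤o⇒n≤o M₁ M₂ (hM ≤n)))) ⟩
      B₁ ℚ.* δ₁ ℚ.+ B₂ ℚ.* δ₂
        ≡⟨ cong (ℚ._+ B₂ ℚ.* δ₂) (proj₂ (proj₂ sc₁)) ⟩
      η ℚ.+ B₂ ℚ.* δ₂
        ≡⟨ cong (η ℚ.+_) (proj₂ (proj₂ sc₂)) ⟩
      η ℚ.+ η
        ≡⟨ half+half ε ⟩
      ε ∎
      where open ℚ.≤-Reasoning

infixl 6 _+ℝ_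
infixl 7 _*ℝ_
infix  8 -ℝ_

_+ℝ_ : ℝ → ℝ → ℝ
x +ℝ y = mkℝ (λ n → seq x n ℚ.+ seq y n) (+-cauchy (seq x) (seq y) (cauchy x) (cauchy y))

_*ℝ_ : ℝ → ℝ → ℝ
x *ℝ y = mkℝ (λ n → seq x n ℚ.* seq y n) (*-cauchy (seq x) (seq y) (cauchy x) (cauchy y))

-ℝ_ : ℝ → ℝ
-ℝ x = mkℝ (λ n → ℚ.- seq x n) (neg-cauchy (seq x) (cauchy x))

fromℚ : ℚ → ℝ
fromℚ q = mkℝ (λ _ → q) (const-cauchy q)

fromℕ : ℕ → ℝ
fromℕ n = fromℚ (ℤ.+ n ℚ./ 1)

0ℝ 1ℝ : ℝ
0ℝ = fromℚ 0ℚ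
1ℝ = fromℚ 1ℚ

sumOver : ∀ {A : Set} → List A → (A → ℝ) → ℝ
sumOver xs f = foldr _+ℝ_ 0ℝ (map f xs)

𝟙[_] : ∀ {A : Set} → Dec A → ℝ
𝟙[ A? ] = if does A? then 1ℝ else 0ℝ

------------------------------------------------------------------------
-- Colorful k-center

record Metric (N : ℕ) : Set where
  field
    d          : Fin N → Fin N → ℝ
    d-nonneg   : ∀ p q → 0ℝ ≤ℝ d p q
    d-definite : ∀ p q → (d p q ≈ℝ 0ℝ) ⇔ (p ≡ q)
    d-sym      : ∀ p q → d p q ≈ℝ d q p
    d-triangle : ∀ p q s → d p s ≤ℝ d p q +ℝ d q s

-- The point set is P = Fin N.  The parameters k, r, b are the bound on the
-- number of centers and the red and blue coverage requirements.
record Instance (N k r b : ℕ) : Set where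
  field
    metric : Metric N
    R      : Subset N

  open Metric metric public

  B : Subset N
  B = ∁ R

  Ball : Fin N → ℝ → Fin N → Set
  Ball j ρ p = d j p ≤ℝ ρ

  -- Needed to write the coefficients of the unit-radius LP; _≤ℝ_ is not
  -- constructively decidable.  Classically this field is no restriction.
  field
    unitBall? : ∀ j p → Dec (Ball j 1ℝ p)

  Covered : Subset N → ℝ → Fin N → Set
  Covered C ρ p = ∃ λ c → c ∈ C × Ball c ρ p

  -- At least m points of X satisfy Q: some m-element (or larger) set of
  -- points of X does.
  AtLeast : ℕ → Subset N → (Fin N → Set) → Set
  AtLeast m X Q = Σ (Subset N) λ S → m ℕ.≤ ∣ S ∣ × (∀ p → p ∈ S → p ∈ X × Q p)

  IsSolution : ℝ → Subset N → Set
  IsSolution ρ C =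
    ∣ C ∣ ℕ.≤ k × AtLeast r R (Covered C ρ) × AtLeast b B (Covered C ρ)

  EverySolutionHasRadius≥ : ℝ → Set
  EverySolutionHasRadius≥ D = ∀ ρ C → IsSolution ρ C → D ≤ℝ ρ

------------------------------------------------------------------------
-- Sum-of-Squares hierarchy over the variables Fin V

-- v ↦ constant + Σᵢ coeff i · vᵢ
record Affine (V : ℕ) : Set where
  constructor affine
  field
    constant : ℝ
    coeff    : Fin V → ℝ

-- K ↦ { v ∈ [0,1]^V ∣ g(v) ≥ 0 for all g in the list }
Polytope : ℕ → Set
Polytope V = List (Affine V)

_≟ˢ_ : ∀ {V} → DecidableEquality (Subset V)
_≟ˢ_ = ≡-dec _≟ᵇ_

allSubsets : ∀ V → List (Subset V)
allSubsets zero    = [] ∷ []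
allSubsets (suc V) = map (outside ∷_) (allSubsets V) ++ map (inside ∷_) (allSubsets V)

subsets≤ : ∀ {V} → ℕ → List (Subset V)
subsets≤ {V} t = filter (λ S → ∣ S ∣ ℕ.≤? t) (allSubsets V)

subsets< : ∀ {V} → ℕ → List (Subset V)
subsets< {V} t = filter (λ S → ∣ S ∣ ℕ.<? t) (allSubsets V)

-- A multilinear polynomial Σ_I a_I ∏_{i∈I} vᵢ, as its coefficients I ↦ a_I.
Poly : ℕ → Set
Poly V = Subset V → ℝ

toPoly : ∀ {V} → Affine V → Poly V
toPoly {V} (affine c a) I =
  𝟙[ I ≟ˢ ⊥ ] *ℝ c +ℝ sumOver (allFin V) (λ i → 𝟙[ I ≟ˢ ⁅ i ⁆ ] *ℝ a i)

_⋆_ : ∀ {V} → Poly V → (Subset V → ℝ) → (Subset V → ℝ)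
_⋆_ {V} a y I = sumOver (allSubsets V) λ J → a J *ℝ y (I ∪ J)

-- The matrix M restricted to the index list T is positive semidefinite.
PSD : ∀ {A : Set} → List A → (A → A → ℝ) → Set
PSD {A} T M =
  All (λ I → All (λ J → M I J ≈ℝ M J I) T) T ×
  (∀ (w : A → ℝ) → 0ℝ ≤ℝ sumOver T λ I → sumOver T λ J → w I *ℝ M I J *ℝ w J)

MomentMatrix : ∀ {V} → (Subset V → ℝ) → (Subset V → Subset V → ℝ)
MomentMatrix y I J = y (I ∪ J)

𝒫 : ℕ → ℕ → Set
𝒫 s V = Σ (Subset V) λ S → ∣ S ∣ ℕ.≤ s

-- Extension by 0 to all of 𝒫(V).  Only the entries of size at most s matter
-- below: the other ones are not used in the moment matrix and are multiplied
-- by zero coefficients in g ⋆ y.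
extend : ∀ {V} s → (𝒫 s V → ℝ) → (Subset V → ℝ)
extend s y S with ∣ S ∣ ℕ.≤? s
... | yes S≤s = y (S , S≤s)
... | no  _   = 0ℝ

-- y ∈ SoSᵗ(K).  Here subsets< t is 𝒫_{t-1}(V), which is empty for t = 0.
SoS : ∀ {V} (t : ℕ) → Polytope V → (𝒫 (2 ℕ.* t) V → ℝ) → Set
SoS {V} t K y =
  (∀ I → 0ℝ ≤ℝ y I × y I ≤ℝ 1ℝ) ×
  (ŷ ⊥ ≈ℝ 1ℝ) ×
  PSD (subsets≤ t) (MomentMatrix ŷ) ×
  All (λ g → PSD (subsets< t) (MomentMatrix (toPoly g ⋆ ŷ))) K
  where
  ŷ : Subset V → ℝ
  ŷ = extend (2 ℕ.* t) y

SoSNonempty : ∀ {V} → ℕ → Polytope V → Set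
SoSNonempty t K = ∃ λ y → SoS t K y

------------------------------------------------------------------------
-- LP1 with unit radius.  The first N variables are the xᵢ, the last N the zⱼ.

module _ {N k r b : ℕ} (I : Instance N k r b) where
  open Instance I

  -- (x , z) ↦ c + Σᵢ α i · xᵢ + Σⱼ β j · zⱼ
  xz : ℝ → (Fin N → ℝ) → (Fin N → ℝ) → Affine (N ℕ.+ N)
  xz c α β = affine c ([ α , β ]′ ∘ splitAt N)

  coverage : Fin N → Affine (N ℕ.+ N)
  coverage j = xz 0ℝ (λ i → 𝟙[ unitBall? j i ]) (λ i → -ℝ 𝟙[ i Fin.≟ j ])

  centers red blue : Affine (N ℕ.+ N)
  centers = xz (fromℕ k) (λ _ → -ℝ 1ℝ) (λ _ → 0ℝ)
  red     = xz (-ℝ fromℕ r) (λ _ → 0ℝ) (λ j → 𝟙[ j ∈? R ])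
  blue    = xz (-ℝ fromℕ b) (λ _ → 0ℝ) (λ j → 𝟙[ j ∈? B ])

  LP1 : Polytope (N ℕ.+ N)
  LP1 = centers ∷ red ∷ blue ∷ tabulate coverage

------------------------------------------------------------------------

-- Some solvable N-point instance is feasible for t rounds of SoS on LP1 at
-- radius 1, while its optimal radius is at least D.
IntegralityGap≥ : (N t : ℕ) → ℝ → Set
IntegralityGap≥ N t D =
  ∃ λ k → ∃ λ r → ∃ λ b → Σ (Instance N k r b) λ I →
    let open Instance I in
    (∃ λ ρ → ∃ λ C → IsSolution ρ C) ×
    EverySolutionHasRadius≥ D ×
    SoSNonempty t (LP1 I)

UnboundedIntegralityGap : (N t : ℕ) → Set
UnboundedIntegralityGap N t = ∀ D → IntegralityGap≥ N t D

{-# OPTIONS --safe #-}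
module Submission where

-- The n gadgets of the instance consist of two far-apart clusters A_i (3 red, 1 blue) and B_i (1 red,
-- 3 blue).  With radius below D a center serves one cluster only, and n centers reach 2n red and 2n blue
-- points only by serving exactly n/2 of the A_i and n/2 of the B_i, which is impossible for odd n.
-- Sum-of-Squares does not see this: substitute a bit x_i for the choice of A_i over B_i and use the moments
-- of a uniformly random x with ∣x∣ = n/2, extrapolated to odd n (the knapsack pseudo-distribution).
-- Every constraint of LP1 becomes a multiple of 2∣x∣ − n, so only 𝔼[p²] ≥ 0 remains.
-- For this, write the top-degree part of p as h + U r, where U multiplies each monomial by the sum of the
-- absent variables and h is harmonic, i.e. the sum of its partial derivatives vanishes.  Modulo
-- Σ x_i = n/2 the term U r has smaller degree; h is orthogonal to all polynomials of smaller degree, and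
-- 𝔼[h²] is a nonnegative multiple of the sum of the squared coefficients of h.

open import Defs
open import Algebra.Bundles using (CommutativeMonoid; Ring)
import Algebra.Properties.CommutativeMonoid.Sum
import Algebra.Properties.Semiring.Sum
open import Data.Bool using (Bool; true; false; if_then_else_; not)
import Data.Bool.Properties as Bool
open import Data.Empty using (⊥-elim)
open import Data.Fin using (Fin; zero; suc; fromℕ<; _↑ˡ_; _↑ʳ_; splitAt; combine; remQuot)
open import Data.Fin.Patterns using (0F; 1F; 2F; 3F; 4F; 5F; 6F; 7F)
import Data.Fin.Properties as Fin
open import Data.Fin.Subset using (Subset; inside; outside; _∈_; _∪_; _∩_; ∁; ∣_∣; ⊥; ⁅_⁆)
open import Data.Fin.Subset.Properties using (_∈?_; x∈⁅x⁆; ∣⁅x⁆∣≡1; ∣⊥∣≡0; ∪-comm; ∪-idem; ∣p∣≤n; ∣p∩q∣≤∣p∣)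
import Data.Integer as ℤ
import Data.Integer.Properties as ℤ
open import Data.List as List using (List; []; _∷_; _++_; map; foldr; upTo; allFin)
open import Data.List.Properties using (map-∘; map-upTo; map-applyUpTo; map-cong-local; map-tabulate)
open import Data.List.Relation.Unary.All as All using (All; []; _∷_)
open import Data.List.Relation.Unary.All.Properties using (all-filter; tabulate⁺)
open import Data.Nat as ℕ using (ℕ; zero; suc; _*_)
open import Data.Nat.Divisibility using (_∣_; divides; _∣0)
import Data.Nat.Properties as ℕ
import Data.Nat.Solver
open import Data.Product using (Σ; ∃; _×_; _,_; proj₁; proj₂)
import Data.Product.Properties as Product
open import Data.Rational as ℚ hiding (∣_∣; _≟_; _*_)
open import Data.Rational using () renaming (_*_ to _·_)
open import Data.Rational.Properties hiding (_≟_)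
open import Data.Rational.Solver using (module +-*-Solver)
import Data.Rational.Unnormalised as ℚᵘ
import Data.Rational.Unnormalised.Properties as ℚᵘ
open import Data.Sum using (_⊎_; inj₁; inj₂; [_,_]′)
open import Data.Vec as Vec using ([]; _∷_; lookup)
open import Data.Vec.Properties using (lookup∘tabulate; lookup-map; []=⇒lookup; lookup⇒[]=; ∷-injectiveʳ)
open import Function using (_∘_; id; case_of_; mk⇔)
open import Level using (0ℓ)
open import Relation.Binary.Definitions using (tri<; tri≈; tri>)
open import Relation.Binary.PropositionalEquality
open import Relation.Nullary using (Dec; yes; no; does; ¬_)
open import Relation.Nullary.Decidable using (map′; decidable-stable)
open +-*-Solver using (solve; con; _:=_; _:+_; _:*_; _:-_; :-_)

-- Rational numbers

-- For odd n no bit string has weight n/2, so 𝔼 is not an average and 𝔼[p²] ≥ 0 is not automatic.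
-- What survives is the formula (κ)_a (κ)_b / (n)_{a+b}, with κ = n/2 and falling factorials, for
-- the chance that a given bits are 1 and b others are 0. The multiple in 𝔼[h²] for h of degree t is
-- its value at a = b = t.
--
-- The harmonic part exists because the down operator `D` (the sum of the partial derivatives) and
-- `U` satisfy DU - UD = n - 2j on degree j. For 2j < n this lets DU r = s be solved for every s of
-- degree j, in particular for the image under `D` of the top-degree part.
--
-- The constant 1/4 comes from the bounds 0 ≤ y_S ≤ 1, where ∣S∣ goes up to 2t: they are obtained as
-- 𝔼 of squares of polynomials of degree 2t, and squares in degree d are controlled for 2d ≤ n. The
-- distance bound enters only the metric: for every value above 1 the unit balls are the clusters,
-- so the polytope stays the same.

ι : ℕ → ℚ
ι n = (ℤ.+ n) / 1

toℚᵘ-ι : ∀ n → toℚᵘ (ι n) ℚᵘ.≃ ℚᵘ.mkℚᵘ (ℤ.+ n) 0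
toℚᵘ-ι n = toℚᵘ-fromℚᵘ (ℚᵘ.mkℚᵘ (ℤ.+ n) 0)

ι-+ : ∀ m n → ι (m ℕ.+ n) ≡ ι m + ι n
ι-+ m n = toℚᵘ-injective (begin
  toℚᵘ (ι (m ℕ.+ n))                          ≈⟨ toℚᵘ-ι (m ℕ.+ n) ⟩
  ℚᵘ.mkℚᵘ (ℤ.+ (m ℕ.+ n)) 0                   ≈⟨ ℚᵘ.*≡* (cong (ℤ._* ℤ.1ℤ) (sym (cong₂ ℤ._+_ (ℤ.*-identityʳ (ℤ.+ m)) (ℤ.*-identityʳ (ℤ.+ n))))) ⟩
  ℚᵘ.mkℚᵘ (ℤ.+ m) 0 ℚᵘ.+ ℚᵘ.mkℚᵘ (ℤ.+ n) 0    ≈⟨ ℚᵘ.+-cong (toℚᵘ-ι m) (toℚᵘ-ι n) ⟨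
  toℚᵘ (ι m) ℚᵘ.+ toℚᵘ (ι n)                  ≈⟨ toℚᵘ-homo-+ (ι m) (ι n) ⟨
  toℚᵘ (ι m + ι n)                            ∎)
  where open ℚᵘ.≃-Reasoning

ι-suc : ∀ n → ι (suc n) ≡ 1ℚ + ι n
ι-suc = ι-+ 1

0≤ι : ∀ n → 0ℚ ≤ ι n
0≤ι n = nonNegative⁻¹ (ι n) {{normalize-nonNeg n 1}}

0<ι : ∀ n → 0ℚ < ι (suc n)
0<ι n = positive⁻¹ (ι (suc n)) {{normalize-pos (suc n) 1}}

ι-mono-≤ : ∀ {m n} → m ℕ.≤ n → ι m ≤ ι n
ι-mono-≤ {m} {n} m≤n = begin
  ι m                    ≡⟨ +-identityʳ (ι m) ⟨
  ι m + 0ℚ               ≤⟨ +-monoʳ-≤ (ι m) (0≤ι (n ℕ.∸ m)) ⟩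
  ι m + ι (n ℕ.∸ m)      ≡⟨ ι-+ m (n ℕ.∸ m) ⟨
  ι (m ℕ.+ (n ℕ.∸ m))    ≡⟨ cong ι (ℕ.m+[n∸m]≡n m≤n) ⟩
  ι n                    ∎
  where open ≤-Reasoning

p≤q⇒0≤q-p : ∀ {p q} → p ≤ q → 0ℚ ≤ q - p
p≤q⇒0≤q-p {p} {q} p≤q = subst (_≤ q - p) (+-inverseʳ p) (+-monoˡ-≤ (- p) p≤q)

0≤p+q : ∀ {p q} → 0ℚ ≤ p → 0ℚ ≤ q → 0ℚ ≤ p + q
0≤p+q = +-mono-≤

p≤p+q : ∀ p {q} → 0ℚ ≤ q → p ≤ p + q
p≤p+q p {q} 0≤q = subst (_≤ p + q) (+-identityʳ p) (+-monoʳ-≤ p 0≤q)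

p≤q+p : ∀ p {q} → 0ℚ ≤ q → p ≤ q + p
p≤q+p p {q} 0≤q = subst (_≤ q + p) (+-identityˡ p) (+-monoˡ-≤ p 0≤q)

0≤p*q : ∀ {p q} → 0ℚ ≤ p → 0ℚ ≤ q → 0ℚ ≤ p · q
0≤p*q {p} {q} 0≤p 0≤q =
  nonNegative⁻¹ (p · q) {{nonNeg*nonNeg⇒nonNeg p {{nonNegative 0≤p}} q {{nonNegative 0≤q}}}}

0≤p*p : ∀ p → 0ℚ ≤ p · p
0≤p*p p with ≤-total 0ℚ p
... | inj₁ 0≤p = 0≤p*q 0≤p 0≤p
... | inj₂ p≤0 = subst (0ℚ ≤_) (solve 1 (λ p → (:- p) :* (:- p) := p :* p) refl p)
                   (0≤p*q (neg-antimono-≤ p≤0) (neg-antimono-≤ p≤0))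

0<½ : 0ℚ < ½
0<½ = positive⁻¹ ½

½<1 : ½ < 1ℚ
½<1 = subst₂ _<_ (+-identityˡ ½) refl (+-monoˡ-< ½ 0<½)

inverse : ∀ {c} → 0ℚ < c → ∃ λ i → i · c ≡ 1ℚ
inverse {c} 0<c = (1/ c) {{c≢0}} , *-inverseˡ c {{c≢0}}
  where
  c≢0 : NonZero c
  c≢0 = pos⇒nonZero c {{positive 0<c}}

*-cancelˡ-ι : ∀ n {p q} → ι (suc n) · p ≡ ι (suc n) · q → p ≡ q
*-cancelˡ-ι n {p} {q} eq = begin
  p                    ≡⟨ *-identityˡ p ⟨
  1ℚ · p               ≡⟨ cong (_· p) i*c≡1 ⟨
  i · ι (suc n) · p    ≡⟨ *-assoc i (ι (suc n)) p ⟩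
  i · (ι (suc n) · p)  ≡⟨ cong (i ·_) eq ⟩
  i · (ι (suc n) · q)  ≡⟨ *-assoc i (ι (suc n)) q ⟨
  i · ι (suc n) · q    ≡⟨ cong (_· q) i*c≡1 ⟩
  1ℚ · q               ≡⟨ *-identityˡ q ⟩
  q                    ∎
  where
  open ≡-Reasoning
  i = proj₁ (inverse (0<ι n))
  i*c≡1 = proj₂ (inverse (0<ι n))

ind : ∀ {A : Set} → Dec A → ℚ
ind A? = if does A? then 1ℚ else 0ℚ

ind-cong : ∀ {A B : Set} (A? : Dec A) (B? : Dec B) → (A → B) → (B → A) → ind A? ≡ ind B?
ind-cong (yes a) (yes b) f g = refl
ind-cong (yes a) (no ¬b) f g = ⊥-elim (¬b (f a))
ind-cong (no ¬a) (yes b) f g = ⊥-elim (¬a (g b))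
ind-cong (no ¬a) (no ¬b) f g = refl

ind-yes : ∀ {A : Set} (A? : Dec A) → A → ind A? ≡ 1ℚ
ind-yes (yes _) _ = refl
ind-yes (no ¬a) a = ⊥-elim (¬a a)

ind-no : ∀ {A : Set} (A? : Dec A) → ¬ A → ind A? ≡ 0ℚ
ind-no (yes a) ¬a = ⊥-elim (¬a a)
ind-no (no _)  _  = refl

-- Finite sums

∑ : ∀ {A : Set} → List A → (A → ℚ) → ℚ
∑ xs f = foldr _+_ 0ℚ (map f xs)

module _ {A : Set} where

  ∑-congᴬ : ∀ {xs : List A} {f g : A → ℚ} → All (λ x → f x ≡ g x) xs → ∑ xs f ≡ ∑ xs g
  ∑-congᴬ = cong (foldr _+_ 0ℚ) ∘ map-cong-local

  ∑-cong : ∀ (xs : List A) {f g : A → ℚ} → (∀ x → f x ≡ g x) → ∑ xs f ≡ ∑ xs g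
  ∑-cong []       f≡g = refl
  ∑-cong (x ∷ xs) f≡g = cong₂ _+_ (f≡g x) (∑-cong xs f≡g)

  ∑-+ : ∀ (xs : List A) (f g : A → ℚ) → ∑ xs (λ x → f x + g x) ≡ ∑ xs f + ∑ xs g
  ∑-+ []       f g = refl
  ∑-+ (x ∷ xs) f g = trans (cong (f x + g x +_) (∑-+ xs f g))
    (solve 4 (λ a b c d → (a :+ b) :+ (c :+ d) := (a :+ c) :+ (b :+ d)) refl (f x) (g x) (∑ xs f) (∑ xs g))

  ∑-*ˡ : ∀ (xs : List A) c (f : A → ℚ) → ∑ xs (λ x → c · f x) ≡ c · ∑ xs f
  ∑-*ˡ []       c f = sym (*-zeroʳ c)
  ∑-*ˡ (x ∷ xs) c f = trans (cong (c · f x +_) (∑-*ˡ xs c f)) (sym (*-distribˡ-+ c (f x) (∑ xs f)))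

  ∑-*ʳ : ∀ (xs : List A) c (f : A → ℚ) → ∑ xs (λ x → f x · c) ≡ ∑ xs f · c
  ∑-*ʳ xs c f = trans (∑-cong xs (λ x → *-comm (f x) c)) (trans (∑-*ˡ xs c f) (*-comm c (∑ xs f)))

  ∑-linear : ∀ (xs : List A) a b (f g : A → ℚ) →
             ∑ xs (λ x → a · f x + b · g x) ≡ a · ∑ xs f + b · ∑ xs g
  ∑-linear xs a b f g = trans (∑-+ xs (λ x → a · f x) (λ x → b · g x)) (cong₂ _+_ (∑-*ˡ xs a f) (∑-*ˡ xs b g))

  ∑-zero : ∀ (xs : List A) {f : A → ℚ} → (∀ x → f x ≡ 0ℚ) → ∑ xs f ≡ 0ℚ
  ∑-zero []       f≡0 = refl
  ∑-zero (x ∷ xs) f≡0 = cong₂ _+_ (f≡0 x) (∑-zero xs f≡0)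

  0≤∑ : ∀ (xs : List A) {f : A → ℚ} → (∀ x → 0ℚ ≤ f x) → 0ℚ ≤ ∑ xs f
  0≤∑ []       0≤f = ≤-refl
  0≤∑ (x ∷ xs) 0≤f = 0≤p+q (0≤f x) (0≤∑ xs 0≤f)

  ∑-++ : ∀ (xs ys : List A) (f : A → ℚ) → ∑ (xs ++ ys) f ≡ ∑ xs f + ∑ ys f
  ∑-++ []       ys f = sym (+-identityˡ (∑ ys f))
  ∑-++ (x ∷ xs) ys f = trans (cong (f x +_) (∑-++ xs ys f)) (sym (+-assoc (f x) (∑ xs f) (∑ ys f)))

  ∑-map : ∀ {B : Set} (h : A → B) (xs : List A) (f : B → ℚ) → ∑ (map h xs) f ≡ ∑ xs (f ∘ h)
  ∑-map h xs f = cong (foldr _+_ 0ℚ) (sym (map-∘ xs))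

∑-swap : ∀ {A B : Set} (xs : List A) (ys : List B) (f : A → B → ℚ) →
         ∑ xs (λ x → ∑ ys (f x)) ≡ ∑ ys (λ y → ∑ xs (λ x → f x y))
∑-swap []       ys f = sym (∑-zero ys (λ _ → refl))
∑-swap (x ∷ xs) ys f = trans (cong (∑ ys (f x) +_) (∑-swap xs ys f))
                             (sym (∑-+ ys (f x) (λ y → ∑ xs (λ x → f x y))))

∑-upTo-suc : ∀ N (f : ℕ → ℚ) → ∑ (upTo (suc N)) f ≡ f 0 + ∑ (upTo N) (f ∘ suc)
∑-upTo-suc N f = cong (λ l → f 0 + foldr _+_ 0ℚ l) (trans (map-applyUpTo suc f N) (sym (map-upTo (f ∘ suc) N)))

∑ˢ : ∀ {n} → (Subset n → ℚ) → ℚ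
∑ˢ {n} = ∑ (allSubsets n)

lo hi : ∀ {n} {A : Set} → (Subset (suc n) → A) → Subset n → A
lo p I = p (outside ∷ I)
hi p I = p (inside ∷ I)

∑ˢ-suc : ∀ {n} (f : Subset (suc n) → ℚ) → ∑ˢ f ≡ ∑ˢ (lo f) + ∑ˢ (hi f)
∑ˢ-suc {n} f = trans (∑-++ (map (outside ∷_) (allSubsets n)) (map (inside ∷_) (allSubsets n)) f)
  (cong₂ _+_ (∑-map (outside ∷_) (allSubsets n) f) (∑-map (inside ∷_) (allSubsets n) f))

∑ˢ-δ : ∀ {n} (A : Subset n) (f : Subset n → ℚ) → ∑ˢ (λ I → ind (I ≟ˢ A) · f I) ≡ f A
∑ˢ-δ [] f = trans (+-identityʳ (1ℚ · f [])) (*-identityˡ (f []))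
∑ˢ-δ {suc n} (outside ∷ A) f = begin
  ∑ˢ (λ I → ind (I ≟ˢ (outside ∷ A)) · f I)      ≡⟨ ∑ˢ-suc (λ I → ind (I ≟ˢ (outside ∷ A)) · f I) ⟩
  _                                              ≡⟨ cong₂ _+_
    (∑-cong (allSubsets n) (λ I → cong (_· lo f I) (ind-cong ((outside ∷ I) ≟ˢ (outside ∷ A)) (I ≟ˢ A) ∷-injectiveʳ (cong (outside ∷_)))))
    (∑-zero (allSubsets n) (λ I → trans (cong (_· hi f I) (ind-no ((inside ∷ I) ≟ˢ (outside ∷ A)) (λ ()))) (*-zeroˡ (hi f I)))) ⟩
  ∑ˢ (λ I → ind (I ≟ˢ A) · lo f I) + 0ℚ          ≡⟨ +-identityʳ _ ⟩
  ∑ˢ (λ I → ind (I ≟ˢ A) · lo f I)               ≡⟨ ∑ˢ-δ A (lo f) ⟩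
  f (outside ∷ A)                                ∎
  where open ≡-Reasoning
∑ˢ-δ {suc n} (inside ∷ A) f = begin
  ∑ˢ (λ I → ind (I ≟ˢ (inside ∷ A)) · f I)       ≡⟨ ∑ˢ-suc (λ I → ind (I ≟ˢ (inside ∷ A)) · f I) ⟩
  _                                              ≡⟨ cong₂ _+_
    (∑-zero (allSubsets n) (λ I → trans (cong (_· lo f I) (ind-no ((outside ∷ I) ≟ˢ (inside ∷ A)) (λ ()))) (*-zeroˡ (lo f I))))
    (∑-cong (allSubsets n) (λ I → cong (_· hi f I) (ind-cong ((inside ∷ I) ≟ˢ (inside ∷ A)) (I ≟ˢ A) ∷-injectiveʳ (cong (inside ∷_))))) ⟩
  0ℚ + ∑ˢ (λ I → ind (I ≟ˢ A) · hi f I)          ≡⟨ +-identityˡ _ ⟩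
  ∑ˢ (λ I → ind (I ≟ˢ A) · hi f I)               ≡⟨ ∑ˢ-δ A (hi f) ⟩
  f (inside ∷ A)                                 ∎
  where open ≡-Reasoning

-- The down and up operators on multilinear polynomials

-- p stands for the polynomial Σ_I p I · ∏_{i∈I} x_i.
Coeffs : ℕ → Set
Coeffs n = Subset n → ℚ

⟨_,_⟩ : ∀ {n} → Coeffs n → Coeffs n → ℚ
⟨ p , q ⟩ = ∑ˢ (λ I → p I · q I)

D U : ∀ {n} → Coeffs n → Coeffs n
D p []            = 0ℚ
D p (outside ∷ I) = D (lo p) I + hi p I
D p (inside ∷ I)  = D (hi p) I
U p []            = 0ℚ
U p (outside ∷ I) = U (lo p) I
U p (inside ∷ I)  = U (hi p) I + lo p I

D-cong : ∀ {n} {p q : Coeffs n} → (∀ I → p I ≡ q I) → ∀ I → D p I ≡ D q I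
D-cong p≡q []            = refl
D-cong p≡q (outside ∷ I) = cong₂ _+_ (D-cong (λ J → p≡q (outside ∷ J)) I) (p≡q (inside ∷ I))
D-cong p≡q (inside ∷ I)  = D-cong (λ J → p≡q (inside ∷ J)) I

U-cong : ∀ {n} {p q : Coeffs n} → (∀ I → p I ≡ q I) → ∀ I → U p I ≡ U q I
U-cong p≡q []            = refl
U-cong p≡q (outside ∷ I) = U-cong (λ J → p≡q (outside ∷ J)) I
U-cong p≡q (inside ∷ I)  = cong₂ _+_ (U-cong (λ J → p≡q (inside ∷ J)) I) (p≡q (outside ∷ I))

linear-interchange : ∀ a b x x′ z z′ → (a · x + b · z) + (a · x′ + b · z′) ≡ a · (x + x′) + b · (z + z′)
linear-interchange = solve 6 (λ a b x x′ z z′ →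
  (a :* x :+ b :* z) :+ (a :* x′ :+ b :* z′) := a :* (x :+ x′) :+ b :* (z :+ z′)) refl

D-linear : ∀ {n} a b (p q : Coeffs n) I → D (λ J → a · p J + b · q J) I ≡ a · D p I + b · D q I
D-linear a b p q []            = sym (cong₂ _+_ (*-zeroʳ a) (*-zeroʳ b))
D-linear a b p q (outside ∷ I) = trans (cong (_+ (a · hi p I + b · hi q I)) (D-linear a b (lo p) (lo q) I))
  (linear-interchange a b (D (lo p) I) (hi p I) (D (lo q) I) (hi q I))
D-linear a b p q (inside ∷ I)  = D-linear a b (hi p) (hi q) I

U-linear : ∀ {n} a b (p q : Coeffs n) I → U (λ J → a · p J + b · q J) I ≡ a · U p I + b · U q I
U-linear a b p q []            = sym (cong₂ _+_ (*-zeroʳ a) (*-zeroʳ b))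
U-linear a b p q (outside ∷ I) = U-linear a b (lo p) (lo q) I
U-linear a b p q (inside ∷ I)  = trans (cong (_+ (a · lo p I + b · lo q I)) (U-linear a b (hi p) (hi q) I))
  (linear-interchange a b (U (hi p) I) (lo p I) (U (hi q) I) (lo q I))

unit-combination : ∀ x z → 1ℚ · x + 1ℚ · z ≡ x + z
unit-combination x z = cong₂ _+_ (*-identityˡ x) (*-identityˡ z)

D-+ : ∀ {n} (p q : Coeffs n) I → D (λ J → p J + q J) I ≡ D p I + D q I
D-+ p q I = trans (D-cong (λ J → sym (unit-combination (p J) (q J))) I)
  (trans (D-linear 1ℚ 1ℚ p q I) (unit-combination (D p I) (D q I)))

U-+ : ∀ {n} (p q : Coeffs n) I → U (λ J → p J + q J) I ≡ U p I + U q I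
U-+ p q I = trans (U-cong (λ J → sym (unit-combination (p J) (q J))) I)
  (trans (U-linear 1ℚ 1ℚ p q I) (unit-combination (U p I) (U q I)))

D-vanish : ∀ {n m} {p : Coeffs n} → (∀ J → ∣ J ∣ ≡ suc m → p J ≡ 0ℚ) → ∀ I → ∣ I ∣ ≡ m → D p I ≡ 0ℚ
D-vanish p≡0 []            eq   = refl
D-vanish p≡0 (outside ∷ I) eq   =
  cong₂ _+_ (D-vanish (λ J → p≡0 (outside ∷ J)) I eq) (p≡0 (inside ∷ I) (cong suc eq))
D-vanish p≡0 (inside ∷ I)  refl = D-vanish (λ J e → p≡0 (inside ∷ J) (cong suc e)) I refl

U-vanish : ∀ {n m} {p : Coeffs n} → (∀ J → suc ∣ J ∣ ≡ m → p J ≡ 0ℚ) → ∀ I → ∣ I ∣ ≡ m → U p I ≡ 0ℚ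
U-vanish p≡0 []            eq   = refl
U-vanish p≡0 (outside ∷ I) eq   = U-vanish (λ J → p≡0 (outside ∷ J)) I eq
U-vanish p≡0 (inside ∷ I)  refl =
  cong₂ _+_ (U-vanish (λ J e → p≡0 (inside ∷ J) (cong suc e)) I refl) (p≡0 (outside ∷ I) refl)

-- [D , U] = n − 2∣I∣, with the negative term moved to the left.
commutator : ∀ {n} (p : Coeffs n) I →
             D (U p) I + (ι ∣ I ∣ + ι ∣ I ∣) · p I ≡ U (D p) I + ι n · p I
commutator p [] = refl
commutator {suc n} p (outside ∷ I) = begin
  (D (U p₀) I + (U p₁ I + p₀ I)) + k · p₀ I
    ≡⟨ solve 4 (λ a b c d → (a :+ (b :+ c)) :+ d := (a :+ d) :+ b :+ c) refl (D (U p₀) I) (U p₁ I) (p₀ I) (k · p₀ I) ⟩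
  (D (U p₀) I + k · p₀ I) + U p₁ I + p₀ I
    ≡⟨ cong (λ x → x + U p₁ I + p₀ I) (commutator p₀ I) ⟩
  (U (D p₀) I + ι n · p₀ I) + U p₁ I + p₀ I
    ≡⟨ solve 4 (λ a m c d → (a :+ m :* c) :+ d :+ c := (a :+ d) :+ (con 1ℚ :+ m) :* c) refl (U (D p₀) I) (ι n) (p₀ I) (U p₁ I) ⟩
  (U (D p₀) I + U p₁ I) + (1ℚ + ι n) · p₀ I
    ≡⟨ cong₂ (λ x m → x + m · p₀ I) (sym (U-+ (D p₀) p₁ I)) (sym (ι-suc n)) ⟩
  U (λ J → D p₀ J + p₁ J) I + ι (suc n) · p₀ I ∎
  where
  open ≡-Reasoning
  p₀ = lo p
  p₁ = hi p
  k = ι ∣ I ∣ + ι ∣ I ∣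
commutator {suc n} p (inside ∷ I) = begin
  D (λ J → U p₁ J + p₀ J) I + (ι (suc ∣ I ∣) + ι (suc ∣ I ∣)) · p₁ I
    ≡⟨ cong₂ (λ x m → x + (m + m) · p₁ I) (D-+ (U p₁) p₀ I) (ι-suc ∣ I ∣) ⟩
  (D (U p₁) I + D p₀ I) + ((1ℚ + ι ∣ I ∣) + (1ℚ + ι ∣ I ∣)) · p₁ I
    ≡⟨ solve 4 (λ a d k c → (a :+ d) :+ ((con 1ℚ :+ k) :+ (con 1ℚ :+ k)) :* c
                := (a :+ (k :+ k) :* c) :+ d :+ c :+ c) refl (D (U p₁) I) (D p₀ I) (ι ∣ I ∣) (p₁ I) ⟩
  (D (U p₁) I + (ι ∣ I ∣ + ι ∣ I ∣) · p₁ I) + D p₀ I + p₁ I + p₁ I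
    ≡⟨ cong (λ x → x + D p₀ I + p₁ I + p₁ I) (commutator p₁ I) ⟩
  (U (D p₁) I + ι n · p₁ I) + D p₀ I + p₁ I + p₁ I
    ≡⟨ solve 4 (λ a m c d → (a :+ m :* c) :+ d :+ c :+ c
                := (a :+ (d :+ c)) :+ (con 1ℚ :+ m) :* c) refl (U (D p₁) I) (ι n) (p₁ I) (D p₀ I) ⟩
  (U (D p₁) I + (D p₀ I + p₁ I)) + (1ℚ + ι n) · p₁ I
    ≡⟨ cong (λ m → (U (D p₁) I + (D p₀ I + p₁ I)) + m · p₁ I) (ι-suc n) ⟨
  (U (D p₁) I + (D p₀ I + p₁ I)) + ι (suc n) · p₁ I ∎
  where
  open ≡-Reasoning
  p₀ = lo p
  p₁ = hi p

-- Each pair of sets differing by one added element contributes once to either side. Thus a harmonic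
-- polynomial is orthogonal to the whole image of `U`.
adjoint : ∀ {n} (p q : Coeffs n) → ⟨ U p , q ⟩ ≡ ⟨ p , D q ⟩
adjoint {zero} p q = cong (_+ 0ℚ) (trans (*-zeroˡ (q [])) (sym (*-zeroʳ (p []))))
adjoint {suc n} p q = begin
  ⟨ U p , q ⟩
    ≡⟨ ∑ˢ-suc (λ I → U p I · q I) ⟩
  ⟨ U p₀ , q₀ ⟩ + ∑ˢ (λ I → (U p₁ I + p₀ I) · q₁ I)
    ≡⟨ cong (⟨ U p₀ , q₀ ⟩ +_) (trans (∑-cong (allSubsets n) (λ I → *-distribʳ-+ (q₁ I) (U p₁ I) (p₀ I)))
                                      (∑-+ (allSubsets n) (λ I → U p₁ I · q₁ I) (λ I → p₀ I · q₁ I))) ⟩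
  ⟨ U p₀ , q₀ ⟩ + (⟨ U p₁ , q₁ ⟩ + ⟨ p₀ , q₁ ⟩)
    ≡⟨ cong₂ (λ a b → a + (b + ⟨ p₀ , q₁ ⟩)) (adjoint p₀ q₀) (adjoint p₁ q₁) ⟩
  ⟨ p₀ , D q₀ ⟩ + (⟨ p₁ , D q₁ ⟩ + ⟨ p₀ , q₁ ⟩)
    ≡⟨ solve 3 (λ a b c → a :+ (b :+ c) := (a :+ c) :+ b) refl ⟨ p₀ , D q₀ ⟩ ⟨ p₁ , D q₁ ⟩ ⟨ p₀ , q₁ ⟩ ⟩
  (⟨ p₀ , D q₀ ⟩ + ⟨ p₀ , q₁ ⟩) + ⟨ p₁ , D q₁ ⟩
    ≡⟨ cong (_+ ⟨ p₁ , D q₁ ⟩) (trans (∑-cong (allSubsets n) (λ I → *-distribˡ-+ (p₀ I) (D q₀ I) (q₁ I)))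
                                      (∑-+ (allSubsets n) (λ I → p₀ I · D q₀ I) (λ I → p₀ I · q₁ I))) ⟨
  ∑ˢ (λ I → p₀ I · (D q₀ I + q₁ I)) + ⟨ p₁ , D q₁ ⟩
    ≡⟨ ∑ˢ-suc (λ I → p I · D q I) ⟨
  ⟨ p , D q ⟩ ∎
  where
  open ≡-Reasoning
  p₀ = lo p
  p₁ = hi p
  q₀ = lo q
  q₁ = hi q

-- The harmonic decomposition

Hom Deg≤ : ∀ {n} → ℕ → Coeffs n → Set
Hom  t p = ∀ I → ∣ I ∣ ≢ t → p I ≡ 0ℚ
Deg≤ t p = ∀ I → t ℕ.< ∣ I ∣ → p I ≡ 0ℚ

Hom-D : ∀ {n j} {p : Coeffs n} → Hom (suc j) p → Hom j (D p)
Hom-D hom I I≢j = D-vanish (λ J e → hom J (λ e′ → I≢j (ℕ.suc-injective (trans (sym e) e′)))) I refl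

Hom-U : ∀ {n j} {p : Coeffs n} → Hom j p → Hom (suc j) (U p)
Hom-U hom I I≢j = U-vanish (λ J e → hom J (λ e′ → I≢j (trans (sym e) (cong suc e′)))) I refl

Hom-linear : ∀ {n j} a b {p q : Coeffs n} → Hom j p → Hom j q → Hom j (λ I → a · p I + b · q I)
Hom-linear a b hp hq I I≢j = trans (cong₂ (λ x z → a · x + b · z) (hp I I≢j) (hq I I≢j))
                                   (cong₂ _+_ (*-zeroʳ a) (*-zeroʳ b))

Hom-level : ∀ {n j} {p : Coeffs n} → Hom j p → (f : ℕ → ℚ) → ∀ I → f ∣ I ∣ · p I ≡ f j · p I
Hom-level {j = j} {p} hom f I = case ∣ I ∣ ℕ.≟ j of λ where
  (yes e)  → cong (λ m → f m · p I) e
  (no I≢j) → trans (cong (f ∣ I ∣ ·_) (hom I I≢j))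
                 (trans (*-zeroʳ (f ∣ I ∣)) (sym (trans (cong (f j ·_) (hom I I≢j)) (*-zeroʳ (f j)))))

-- UD + c and DU + c (c > 0, resp. c ≥ 0) are inverted level by level: the solution of (UD + c) r = s is
-- r = c⁻¹ (s − U r′) with (DU + c) r′ = D s, and on level j the operators DU and UD differ by n − 2j.
solve-UD : ∀ {n} j c → 0ℚ < c → j ℕ.+ j ℕ.< n → (s : Coeffs n) → Hom j s →
           ∃ λ r → Hom j r × ∀ I → U (D r) I + c · r I ≡ s I
solve-DU : ∀ {n} j c → 0ℚ ≤ c → j ℕ.+ j ℕ.< n → (s : Coeffs n) → Hom j s →
           ∃ λ r → Hom j r × ∀ I → D (U r) I + c · r I ≡ s I

solve-UD zero c 0<c 2j<n s hom = r , hom-r , eq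
  where
  i = proj₁ (inverse 0<c)
  r = λ I → i · s I
  hom-r : Hom 0 r
  hom-r I I≢0 = trans (cong (i ·_) (hom I I≢0)) (*-zeroʳ i)
  Dr≡0 : ∀ I → D r I ≡ 0ℚ
  Dr≡0 I = D-vanish (λ J e → hom-r J (λ e′ → ℕ.0≢1+n (trans (sym e′) e))) I refl
  eq : ∀ I → U (D r) I + c · r I ≡ s I
  eq I = begin
    U (D r) I + c · (i · s I)  ≡⟨ cong (_+ c · (i · s I)) (U-vanish (λ J _ → Dr≡0 J) I refl) ⟩
    0ℚ + c · (i · s I)         ≡⟨ solve 3 (λ c i s → con 0ℚ :+ c :* (i :* s) := (i :* c) :* s) refl c i (s I) ⟩
    i · c · s I                ≡⟨ cong (_· s I) (proj₂ (inverse 0<c)) ⟩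
    1ℚ · s I                   ≡⟨ *-identityˡ (s I) ⟩
    s I                        ∎
    where open ≡-Reasoning
solve-UD (suc j) c 0<c 2j<n s hom = r , Hom-linear i (- i) hom (Hom-U (proj₁ (proj₂ sol))) , eq
  where
  open ≡-Reasoning
  sol = solve-DU j c (<⇒≤ 0<c) (ℕ.<-trans (ℕ.+-mono-< (ℕ.n<1+n j) (ℕ.n<1+n j)) 2j<n) (D s) (Hom-D hom)
  i : ℚ
  i = proj₁ (inverse 0<c)
  r′ r : Coeffs _
  r′ = proj₁ sol
  r I = i · s I + (- i) · U r′ I
  -- This closes the recursion: `r` was defined from `r′`, and applying `D` to it gives `r′` back,
  -- so the unknown U (D r) is the known U r′.
  Dr≡r′ : ∀ I → D r I ≡ r′ I
  Dr≡r′ I = begin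
    D r I                            ≡⟨ D-linear i (- i) s (U r′) I ⟩
    i · D s I + (- i) · D (U r′) I   ≡⟨ cong (λ x → i · x + (- i) · D (U r′) I) (proj₂ (proj₂ sol) I) ⟨
    i · (D (U r′) I + c · r′ I) + (- i) · D (U r′) I
      ≡⟨ solve 4 (λ i x c r → i :* (x :+ c :* r) :+ (:- i) :* x := (i :* c) :* r) refl i (D (U r′) I) c (r′ I) ⟩
    i · c · r′ I                     ≡⟨ cong (_· r′ I) (proj₂ (inverse 0<c)) ⟩
    1ℚ · r′ I                        ≡⟨ *-identityˡ (r′ I) ⟩
    r′ I                             ∎
  eq : ∀ I → U (D r) I + c · r I ≡ s I
  eq I = begin
    U (D r) I + c · r I              ≡⟨ cong (_+ c · r I) (U-cong Dr≡r′ I) ⟩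
    U r′ I + c · (i · s I + (- i) · U r′ I)
      ≡⟨ solve 4 (λ u c i s → u :+ c :* (i :* s :+ (:- i) :* u) := u :+ (i :* c) :* (s :- u)) refl (U r′ I) c i (s I) ⟩
    U r′ I + i · c · (s I - U r′ I)  ≡⟨ cong (λ x → U r′ I + x · (s I - U r′ I)) (proj₂ (inverse 0<c)) ⟩
    U r′ I + 1ℚ · (s I - U r′ I)     ≡⟨ solve 2 (λ u s → u :+ con 1ℚ :* (s :- u) := s) refl (U r′ I) (s I) ⟩
    s I                              ∎

solve-DU {n} j c 0≤c 2j<n s hom = r , proj₁ (proj₂ sol) , eq
  where
  open ≡-Reasoning
  k d : ℕ
  k = j ℕ.+ j
  d = n ℕ.∸ suc k
  n-k≡1+d : ι n - ι k ≡ ι (suc d)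
  n-k≡1+d = begin
    ι n - ι k                ≡⟨ cong (λ m → ι m - ι k) (trans (ℕ.+-suc k d) (ℕ.m+[n∸m]≡n 2j<n)) ⟨
    ι (k ℕ.+ suc d) - ι k    ≡⟨ cong (_- ι k) (ι-+ k (suc d)) ⟩
    ι k + ι (suc d) - ι k    ≡⟨ solve 2 (λ a b → a :+ b :- a := b) refl (ι k) (ι (suc d)) ⟩
    ι (suc d)                ∎
  -- The shift n - 2j produced by the commutator is at least 1, so even c = 0 becomes an invertible
  -- constant.
  0<c′ : 0ℚ < c + (ι n - ι k)
  0<c′ = subst (λ x → 0ℚ < c + x) (sym n-k≡1+d) (+-mono-≤-< 0≤c (0<ι d))
  sol = solve-UD j (c + (ι n - ι k)) 0<c′ 2j<n s hom
  r = proj₁ sol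
  eq : ∀ I → D (U r) I + c · r I ≡ s I
  eq I = begin
    D (U r) I + c · r I
      ≡⟨ solve 4 (λ a k r c → a :+ c :* r := (a :+ k :* r) :+ (c :* r :- k :* r)) refl (D (U r) I) (ι ∣ I ∣ + ι ∣ I ∣) (r I) c ⟩
    (D (U r) I + (ι ∣ I ∣ + ι ∣ I ∣) · r I) + (c · r I - (ι ∣ I ∣ + ι ∣ I ∣) · r I)
      ≡⟨ cong₂ (λ x z → x + (c · r I - z)) (commutator r I) (Hom-level (proj₁ (proj₂ sol)) (λ m → ι m + ι m) I) ⟩
    (U (D r) I + ι n · r I) + (c · r I - (ι j + ι j) · r I)
      ≡⟨ cong (λ x → (U (D r) I + ι n · r I) + (c · r I - x · r I)) (ι-+ j j) ⟨
    (U (D r) I + ι n · r I) + (c · r I - ι k · r I)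
      ≡⟨ solve 5 (λ a n r c k → (a :+ n :* r) :+ (c :* r :- k :* r) := a :+ (c :+ (n :- k)) :* r) refl (U (D r) I) (ι n) (r I) c (ι k) ⟩
    U (D r) I + (c + (ι n - ι k)) · r I
      ≡⟨ proj₂ (proj₂ sol) I ⟩
    s I ∎

Harmonic : ∀ {n} → ℕ → Coeffs n → Set
Harmonic t h = Hom t h × ∀ I → D h I ≡ 0ℚ

-- Solving D (U r) = D p in degree j makes the remainder h = p - U r harmonic. The coefficients 1
-- and -1 are kept explicit so that `h` is literally a linear combination.
harmonic-decomposition : ∀ {n} j → j ℕ.+ j ℕ.< n → (p : Coeffs n) → Hom (suc j) p →
  ∃ λ h → ∃ λ r → Harmonic (suc j) h × Hom j r × ∀ I → p I ≡ h I + U r I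
harmonic-decomposition j 2j<n p hom =
  h , r , (Hom-linear 1ℚ (- 1ℚ) hom (Hom-U (proj₁ (proj₂ sol))) , Dh≡0) , proj₁ (proj₂ sol) , p≡h+Ur
  where
  open ≡-Reasoning
  sol = solve-DU j 0ℚ ≤-refl 2j<n (D p) (Hom-D hom)
  r h : Coeffs _
  r = proj₁ sol
  h I = 1ℚ · p I + (- 1ℚ) · U r I
  p≡h+Ur : ∀ I → p I ≡ h I + U r I
  p≡h+Ur I = solve 2 (λ p u → p := con 1ℚ :* p :+ (con (- 1ℚ)) :* u :+ u) refl (p I) (U r I)
  Dh≡0 : ∀ I → D h I ≡ 0ℚ
  Dh≡0 I = begin
    D h I                                             ≡⟨ D-linear 1ℚ (- 1ℚ) p (U r) I ⟩
    1ℚ · D p I + (- 1ℚ) · D (U r) I                   ≡⟨ cong (λ x → 1ℚ · x + (- 1ℚ) · D (U r) I) (proj₂ (proj₂ sol) I) ⟨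
    1ℚ · (D (U r) I + 0ℚ · r I) + (- 1ℚ) · D (U r) I  ≡⟨ solve 2 (λ x r → con 1ℚ :* (x :+ con 0ℚ :* r) :+ con (- 1ℚ) :* x := con 0ℚ) refl (D (U r) I) (r I) ⟩
    0ℚ                                                ∎

-- Finite differences

-- The backward sign is the one of inclusion-exclusion: applied to moments, each difference asks for
-- one more bit to be 0.
∇ : ℕ → (ℕ → ℚ) → ℕ → ℚ
∇ zero    u i = u i
∇ (suc t) u i = ∇ t u i - ∇ t u (suc i)

∇-shift : ∀ t u i → ∇ t (u ∘ suc) i ≡ ∇ t u (suc i)
∇-shift zero    u i = refl
∇-shift (suc t) u i = cong₂ _-_ (∇-shift t u i) (∇-shift t u (suc i))

-- (−1)ⁱ · (t choose i)
signedBinomial : ℕ → ℕ → ℚ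
signedBinomial t       zero    = 1ℚ
signedBinomial zero    (suc i) = 0ℚ
signedBinomial (suc t) (suc i) = signedBinomial t (suc i) - signedBinomial t i

-- The coefficients vanish beyond t, so every cutoff above t gives the same sum; this freedom is
-- used to choose a cutoff that also covers all set sizes.
∑-signedBinomial : ∀ t N u → t ℕ.< N → ∑ (upTo N) (λ i → signedBinomial t i · u i) ≡ ∇ t u 0
∑-signedBinomial zero (suc N) u _ = begin
  ∑ (upTo (suc N)) (λ i → signedBinomial 0 i · u i)    ≡⟨ ∑-upTo-suc N (λ i → signedBinomial 0 i · u i) ⟩
  1ℚ · u 0 + ∑ (upTo N) (λ i → 0ℚ · u (suc i))         ≡⟨ cong (1ℚ · u 0 +_) (∑-zero (upTo N) (λ i → *-zeroˡ (u (suc i)))) ⟩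
  1ℚ · u 0 + 0ℚ                                        ≡⟨ solve 1 (λ x → con 1ℚ :* x :+ con 0ℚ := x) refl (u 0) ⟩
  u 0                                                  ∎
  where open ≡-Reasoning
∑-signedBinomial (suc t) (suc N) u (ℕ.s≤s t<N) = begin
  ∑ (upTo (suc N)) (λ i → signedBinomial (suc t) i · u i)
    ≡⟨ ∑-upTo-suc N (λ i → signedBinomial (suc t) i · u i) ⟩
  1ℚ · u 0 + ∑ (upTo N) (λ i → (b (suc i) - b i) · u (suc i))
    ≡⟨ cong (1ℚ · u 0 +_) (trans
         (∑-cong (upTo N) (λ i → solve 3 (λ x z u → (x :- z) :* u := con 1ℚ :* (x :* u) :+ con (- 1ℚ) :* (z :* u)) refl (b (suc i)) (b i) (u (suc i))))
         (∑-linear (upTo N) 1ℚ (- 1ℚ) (λ i → b (suc i) · u (suc i)) (λ i → b i · u (suc i)))) ⟩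
  1ℚ · u 0 + (1ℚ · S + (- 1ℚ) · T)
    ≡⟨ solve 3 (λ u s t → con 1ℚ :* u :+ (con 1ℚ :* s :+ con (- 1ℚ) :* t) := (con 1ℚ :* u :+ s) :- t) refl (u 0) S T ⟩
  (1ℚ · u 0 + S) - T
    ≡⟨ cong₂ _-_ (sym (∑-upTo-suc N (λ i → b i · u i))) (∑-signedBinomial t N (u ∘ suc) t<N) ⟩
  ∑ (upTo (suc N)) (λ i → b i · u i) - ∇ t (u ∘ suc) 0
    ≡⟨ cong₂ _-_ (∑-signedBinomial t (suc N) u (ℕ.m<n⇒m<1+n t<N)) (∇-shift t u 0) ⟩
  ∇ t u 0 - ∇ t u 1 ∎
  where
  open ≡-Reasoning
  b = signedBinomial t
  S = ∑ (upTo N) (λ i → b (suc i) · u (suc i))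
  T = ∑ (upTo N) (λ i → b i · u (suc i))

-- The first-order recurrence that harmonicity imposes on the sums `σ` below. It is proved together
-- with the absorption identity, since the Pascal step of each one uses the other.
signedBinomial-ratio : ∀ t i → ι (suc i) · signedBinomial t (suc i) ≡ (ι i - ι t) · signedBinomial t i
signedBinomial-absorb : ∀ t i → (ι (suc t) - ι i) · signedBinomial (suc t) i ≡ ι (suc t) · signedBinomial t i

signedBinomial-ratio zero    zero    = refl
signedBinomial-ratio zero    (suc i) = trans (*-zeroʳ (ι (suc (suc i)))) (sym (*-zeroʳ (ι (suc i) - ι 0)))
signedBinomial-ratio (suc t) i = begin
  ι (suc i) · (b (suc i) - b i)
    ≡⟨ solve 3 (λ m x z → m :* (x :- z) := m :* x :- m :* z) refl (ι (suc i)) (b (suc i)) (b i) ⟩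
  ι (suc i) · b (suc i) - ι (suc i) · b i
    ≡⟨ cong₂ (λ x m → x - m · b i) (signedBinomial-ratio t i) (ι-suc i) ⟩
  (ι i - ι t) · b i - (1ℚ + ι i) · b i
    ≡⟨ solve 3 (λ i t b → (i :- t) :* b :- (con 1ℚ :+ i) :* b := :- ((con 1ℚ :+ t) :* b)) refl (ι i) (ι t) (b i) ⟩
  - ((1ℚ + ι t) · b i)
    ≡⟨ cong (λ m → - (m · b i)) (ι-suc t) ⟨
  - (ι (suc t) · b i)
    ≡⟨ cong -_ (signedBinomial-absorb t i) ⟨
  - ((ι (suc t) - ι i) · signedBinomial (suc t) i)
    ≡⟨ solve 3 (λ t i b → :- ((t :- i) :* b) := (i :- t) :* b) refl (ι (suc t)) (ι i) (signedBinomial (suc t) i) ⟩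
  (ι i - ι (suc t)) · signedBinomial (suc t) i ∎
  where
  open ≡-Reasoning
  b = signedBinomial t

signedBinomial-absorb t zero    = cong (_· 1ℚ) (+-identityʳ (ι (suc t)))
signedBinomial-absorb t (suc i) = begin
  (ι (suc t) - ι (suc i)) · (b (suc i) - b i)
    ≡⟨ cong₂ (λ m k → (m - k) · (b (suc i) - b i)) (ι-suc t) (ι-suc i) ⟩
  ((1ℚ + ι t) - (1ℚ + ι i)) · (b (suc i) - b i)
    ≡⟨ solve 4 (λ t i x z → ((con 1ℚ :+ t) :- (con 1ℚ :+ i)) :* (x :- z) := (t :- i) :* x :+ (i :- t) :* z) refl (ι t) (ι i) (b (suc i)) (b i) ⟩
  (ι t - ι i) · b (suc i) + (ι i - ι t) · b i
    ≡⟨ cong ((ι t - ι i) · b (suc i) +_) (signedBinomial-ratio t i) ⟨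
  (ι t - ι i) · b (suc i) + ι (suc i) · b (suc i)
    ≡⟨ cong (λ m → (ι t - ι i) · b (suc i) + m · b (suc i)) (ι-suc i) ⟩
  (ι t - ι i) · b (suc i) + (1ℚ + ι i) · b (suc i)
    ≡⟨ solve 3 (λ t i x → (t :- i) :* x :+ (con 1ℚ :+ i) :* x := (con 1ℚ :+ t) :* x) refl (ι t) (ι i) (b (suc i)) ⟩
  (1ℚ + ι t) · b (suc i)
    ≡⟨ cong (_· b (suc i)) (ι-suc t) ⟨
  ι (suc t) · b (suc i) ∎
  where
  open ≡-Reasoning
  b = signedBinomial t

-- Harmonic polynomials against functions of ∣ I ∖ J ∣

∣_∖_∣ : ∀ {n} → Subset n → Subset n → ℕ
∣ I ∖ J ∣ = ∣ I ∩ ∁ J ∣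

∣I∪J∣≡∣J∣+∣I∖J∣ : ∀ {n} (I J : Subset n) → ∣ I ∪ J ∣ ≡ ∣ J ∣ ℕ.+ ∣ I ∖ J ∣
∣I∪J∣≡∣J∣+∣I∖J∣ []            []            = refl
∣I∪J∣≡∣J∣+∣I∖J∣ (outside ∷ I) (outside ∷ J) = ∣I∪J∣≡∣J∣+∣I∖J∣ I J
∣I∪J∣≡∣J∣+∣I∖J∣ (outside ∷ I) (inside ∷ J)  = cong suc (∣I∪J∣≡∣J∣+∣I∖J∣ I J)
∣I∪J∣≡∣J∣+∣I∖J∣ (inside ∷ I)  (outside ∷ J) = trans (cong suc (∣I∪J∣≡∣J∣+∣I∖J∣ I J)) (sym (ℕ.+-suc ∣ J ∣ ∣ I ∖ J ∣))
∣I∪J∣≡∣J∣+∣I∖J∣ (inside ∷ I)  (inside ∷ J)  = cong suc (∣I∪J∣≡∣J∣+∣I∖J∣ I J)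

∣I∖J∣≡0⇒∣I∣≤∣J∣ : ∀ {n} (I J : Subset n) → ∣ I ∖ J ∣ ≡ 0 → ∣ I ∣ ℕ.≤ ∣ J ∣
∣I∖J∣≡0⇒∣I∣≤∣J∣ []            []            e = ℕ.z≤n
∣I∖J∣≡0⇒∣I∣≤∣J∣ (outside ∷ I) (outside ∷ J) e = ∣I∖J∣≡0⇒∣I∣≤∣J∣ I J e
∣I∖J∣≡0⇒∣I∣≤∣J∣ (outside ∷ I) (inside ∷ J)  e = ℕ.m≤n⇒m≤1+n (∣I∖J∣≡0⇒∣I∣≤∣J∣ I J e)
∣I∖J∣≡0⇒∣I∣≤∣J∣ (inside ∷ I)  (inside ∷ J)  e = ℕ.s≤s (∣I∖J∣≡0⇒∣I∣≤∣J∣ I J e)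

∣I∖J∣≡0⇒I≡J : ∀ {n} (I J : Subset n) → ∣ I ∖ J ∣ ≡ 0 → ∣ I ∣ ≡ ∣ J ∣ → I ≡ J
∣I∖J∣≡0⇒I≡J []            []            e f = refl
∣I∖J∣≡0⇒I≡J (outside ∷ I) (outside ∷ J) e f = cong (outside ∷_) (∣I∖J∣≡0⇒I≡J I J e f)
∣I∖J∣≡0⇒I≡J (outside ∷ I) (inside ∷ J)  e f =
  ⊥-elim (ℕ.1+n≰n (subst (ℕ._≤ ∣ J ∣) f (∣I∖J∣≡0⇒∣I∣≤∣J∣ I J e)))
∣I∖J∣≡0⇒I≡J (inside ∷ I)  (inside ∷ J)  e f = cong (inside ∷_) (∣I∖J∣≡0⇒I≡J I J e (ℕ.suc-injective f))

∣I∖I∣≡0 : ∀ {n} (I : Subset n) → ∣ I ∖ I ∣ ≡ 0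
∣I∖I∣≡0 []            = refl
∣I∖I∣≡0 (outside ∷ I) = ∣I∖I∣≡0 I
∣I∖I∣≡0 (inside ∷ I)  = ∣I∖I∣≡0 I

-- Removing an element of `I` lowers the count of elements outside `J` exactly when the element
-- itself lies outside `J`; the others leave it unchanged. The subtraction is moved to the left, and
-- the value of `pred` at 0 is harmless because its factor is 0.
U-∖ : ∀ {n} (J : Subset n) (g : ℕ → ℚ) (I : Subset n) →
      U (λ I → g ∣ I ∖ J ∣) I + ι ∣ I ∖ J ∣ · g ∣ I ∖ J ∣ ≡ ι ∣ I ∖ J ∣ · g (ℕ.pred ∣ I ∖ J ∣) + ι ∣ I ∣ · g ∣ I ∖ J ∣
U-∖ []            g []            = solve 1 (λ x → con 0ℚ :+ con 0ℚ :* x := con 0ℚ :* x :+ con 0ℚ :* x) refl (g 0)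
U-∖ (outside ∷ J) g (outside ∷ I) = U-∖ J g I
U-∖ (inside ∷ J)  g (outside ∷ I) = U-∖ J g I
U-∖ (inside ∷ J)  g (inside ∷ I)  = begin
  (u + g a) + ι a · g a                        ≡⟨ solve 3 (λ u g a → (u :+ g) :+ a :* g := (u :+ a :* g) :+ g) refl u (g a) (ι a) ⟩
  (u + ι a · g a) + g a                        ≡⟨ cong (_+ g a) (U-∖ J g I) ⟩
  (ι a · g (ℕ.pred a) + ι ∣ I ∣ · g a) + g a   ≡⟨ solve 3 (λ x m g → (x :+ m :* g) :+ g := x :+ (con 1ℚ :+ m) :* g) refl (ι a · g (ℕ.pred a)) (ι ∣ I ∣) (g a) ⟩
  ι a · g (ℕ.pred a) + (1ℚ + ι ∣ I ∣) · g a    ≡⟨ cong (λ m → ι a · g (ℕ.pred a) + m · g a) (ι-suc ∣ I ∣) ⟨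
  ι a · g (ℕ.pred a) + ι (suc ∣ I ∣) · g a     ∎
  where
  open ≡-Reasoning
  a = ∣ I ∖ J ∣
  u = U (λ I → g ∣ I ∖ J ∣) I
U-∖ (outside ∷ J) g (inside ∷ I)  = begin
  (u + g a) + ι (suc a) · g (suc a)
    ≡⟨ cong (λ m → (u + g a) + m · g (suc a)) (ι-suc a) ⟩
  (u + g a) + (1ℚ + ι a) · g (suc a)
    ≡⟨ solve 4 (λ u g a h → (u :+ g) :+ (con 1ℚ :+ a) :* h := (u :+ a :* h) :+ g :+ h) refl u (g a) (ι a) (g (suc a)) ⟩
  (u + ι a · g (suc a)) + g a + g (suc a)
    ≡⟨ cong (λ x → x + g a + g (suc a)) (U-∖ J (g ∘ suc) I) ⟩
  (ι a · g (suc (ℕ.pred a)) + ι ∣ I ∣ · g (suc a)) + g a + g (suc a)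
    ≡⟨ cong (λ x → (x + ι ∣ I ∣ · g (suc a)) + g a + g (suc a)) (drop-pred a) ⟩
  (ι a · g a + ι ∣ I ∣ · g (suc a)) + g a + g (suc a)
    ≡⟨ solve 4 (λ a g m h → (a :* g :+ m :* h) :+ g :+ h := (con 1ℚ :+ a) :* g :+ (con 1ℚ :+ m) :* h) refl (ι a) (g a) (ι ∣ I ∣) (g (suc a)) ⟩
  (1ℚ + ι a) · g a + (1ℚ + ι ∣ I ∣) · g (suc a)
    ≡⟨ cong₂ (λ m k → m · g a + k · g (suc a)) (ι-suc a) (ι-suc ∣ I ∣) ⟨
  ι (suc a) · g a + ι (suc ∣ I ∣) · g (suc a) ∎
  where
  open ≡-Reasoning
  a = ∣ I ∖ J ∣
  u = U (λ I → g (suc ∣ I ∖ J ∣)) I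
  drop-pred : ∀ a → ι a · g (suc (ℕ.pred a)) ≡ ι a · g a
  drop-pred zero    = trans (*-zeroˡ (g 1)) (sym (*-zeroˡ (g 0)))
  drop-pred (suc a) = refl

δ : ℕ → ℕ → ℚ
δ i a = ind (a ℕ.≟ i)

δ-support : ∀ i a (f : ℕ → ℚ) → f a · δ i a ≡ f i · δ i a
δ-support i a f = case a ℕ.≟ i of λ where
    (yes a≡i) → cong (λ m → f m · δ i a) a≡i
    (no a≢i)  → trans (vanish a≢i (f a)) (sym (vanish a≢i (f i)))
  where
  vanish : a ≢ i → ∀ c → c · δ i a ≡ 0ℚ
  vanish a≢i c = trans (cong (c ·_) (ind-no (a ℕ.≟ i) a≢i)) (*-zeroʳ c)

δ-pred : ∀ i a → ι a · δ i (ℕ.pred a) ≡ ι (suc i) · δ (suc i) a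
δ-pred i zero    = trans (*-zeroˡ (δ i 0)) (sym (*-zeroʳ (ι (suc i))))
δ-pred i (suc a) = trans (δ-support i a (ι ∘ suc))
  (cong (ι (suc i) ·_) (ind-cong (a ℕ.≟ i) (suc a ℕ.≟ suc i) (cong suc) ℕ.suc-injective))

∑-δ : ∀ N (u : ℕ → ℚ) a → a ℕ.< N → ∑ (upTo N) (λ i → δ i a · u i) ≡ u a
∑-δ (suc N) u zero    _           = begin
  ∑ (upTo (suc N)) (λ i → δ i 0 · u i)         ≡⟨ ∑-upTo-suc N (λ i → δ i 0 · u i) ⟩
  1ℚ · u 0 + ∑ (upTo N) (λ i → 0ℚ · u (suc i)) ≡⟨ cong (1ℚ · u 0 +_) (∑-zero (upTo N) (λ i → *-zeroˡ (u (suc i)))) ⟩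
  1ℚ · u 0 + 0ℚ                                ≡⟨ solve 1 (λ x → con 1ℚ :* x :+ con 0ℚ := x) refl (u 0) ⟩
  u 0                                          ∎
  where open ≡-Reasoning
∑-δ (suc N) u (suc a) (ℕ.s≤s a<N) = begin
  ∑ (upTo (suc N)) (λ i → δ i (suc a) · u i)                   ≡⟨ ∑-upTo-suc N (λ i → δ i (suc a) · u i) ⟩
  0ℚ · u 0 + ∑ (upTo N) (λ i → δ (suc i) (suc a) · u (suc i))  ≡⟨ cong₂ _+_ (*-zeroˡ (u 0)) (∑-cong (upTo N) (λ i →
    cong (_· u (suc i)) (ind-cong (suc a ℕ.≟ suc i) (a ℕ.≟ i) ℕ.suc-injective (cong suc)))) ⟩
  0ℚ + ∑ (upTo N) (λ i → δ i a · u (suc i))                    ≡⟨ +-identityˡ _ ⟩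
  ∑ (upTo N) (λ i → δ i a · u (suc i))                         ≡⟨ ∑-δ N (u ∘ suc) a a<N ⟩
  u (suc a)                                                    ∎
  where open ≡-Reasoning

module _ {n t} {h : Coeffs n} (harm : Harmonic t h) (J : Subset n) where

  private
    σ : ℕ → ℚ
    σ i = ∑ˢ (λ I → h I · δ i ∣ I ∖ J ∣)

    pointwise : ∀ i I → h I · U (λ I → δ i ∣ I ∖ J ∣) I
              ≡ ι (suc i) · (h I · δ (suc i) ∣ I ∖ J ∣) + (ι t - ι i) · (h I · δ i ∣ I ∖ J ∣)
    pointwise i I = begin
      h I · u
        ≡⟨ solve 4 (λ h u a d → h :* u := h :* ((u :+ a :* d) :- a :* d)) refl (h I) u (ι a) (δ i a) ⟩
      h I · ((u + ι a · δ i a) - ι a · δ i a)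
        ≡⟨ cong₂ (λ x z → h I · (x - z)) (U-∖ J (δ i) I) (δ-support i a ι) ⟩
      h I · ((ι a · δ i (ℕ.pred a) + ι ∣ I ∣ · δ i a) - ι i · δ i a)
        ≡⟨ cong (λ x → h I · ((x + ι ∣ I ∣ · δ i a) - ι i · δ i a)) (δ-pred i a) ⟩
      h I · ((ι (suc i) · δ (suc i) a + ι ∣ I ∣ · δ i a) - ι i · δ i a)
        ≡⟨ solve 6 (λ h s e m d i → h :* ((s :* e :+ m :* d) :- i :* d) := s :* (h :* e) :+ ((m :* h) :* d :- i :* (h :* d)))
             refl (h I) (ι (suc i)) (δ (suc i) a) (ι ∣ I ∣) (δ i a) (ι i) ⟩
      ι (suc i) · (h I · δ (suc i) a) + ((ι ∣ I ∣ · h I) · δ i a - ι i · (h I · δ i a))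
        ≡⟨ cong (λ x → ι (suc i) · (h I · δ (suc i) a) + (x · δ i a - ι i · (h I · δ i a))) (Hom-level (proj₁ harm) ι I) ⟩
      ι (suc i) · (h I · δ (suc i) a) + ((ι t · h I) · δ i a - ι i · (h I · δ i a))
        ≡⟨ solve 5 (λ x t h d i → x :+ ((t :* h) :* d :- i :* (h :* d)) := x :+ (t :- i) :* (h :* d))
             refl (ι (suc i) · (h I · δ (suc i) a)) (ι t) (h I) (δ i a) (ι i) ⟩
      ι (suc i) · (h I · δ (suc i) a) + (ι t - ι i) · (h I · δ i a) ∎
      where
      open ≡-Reasoning
      a = ∣ I ∖ J ∣
      u = U (λ I → δ i ∣ I ∖ J ∣) I

    -- Pairing Dh = 0 with the indicator of ∣ I ∖ J ∣ = i.
    σ-ratio : ∀ i → ι (suc i) · σ (suc i) ≡ (ι i - ι t) · σ i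
    σ-ratio i = begin
      ι (suc i) · σ (suc i)
        ≡⟨ solve 4 (λ x t i s → x := (x :+ (t :- i) :* s) :+ (i :- t) :* s) refl (ι (suc i) · σ (suc i)) (ι t) (ι i) (σ i) ⟩
      (ι (suc i) · σ (suc i) + (ι t - ι i) · σ i) + (ι i - ι t) · σ i
        ≡⟨ cong (_+ (ι i - ι t) · σ i) (begin
             ι (suc i) · σ (suc i) + (ι t - ι i) · σ i
               ≡⟨ ∑-linear (allSubsets n) (ι (suc i)) (ι t - ι i) (λ I → h I · δ (suc i) ∣ I ∖ J ∣) (λ I → h I · δ i ∣ I ∖ J ∣) ⟨
             ∑ˢ (λ I → ι (suc i) · (h I · δ (suc i) ∣ I ∖ J ∣) + (ι t - ι i) · (h I · δ i ∣ I ∖ J ∣))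
               ≡⟨ ∑-cong (allSubsets n) (λ I → trans (*-comm (U w I) (h I)) (pointwise i I)) ⟨
             ⟨ U w , h ⟩
               ≡⟨ adjoint w h ⟩
             ⟨ w , D h ⟩
               ≡⟨ ∑-zero (allSubsets n) (λ I → trans (cong (w I ·_) (proj₂ harm I)) (*-zeroʳ (w I))) ⟩
             0ℚ ∎) ⟩
      0ℚ + (ι i - ι t) · σ i
        ≡⟨ +-identityˡ _ ⟩
      (ι i - ι t) · σ i ∎
      where
      open ≡-Reasoning
      w : Coeffs n
      w I = δ i ∣ I ∖ J ∣

    -- Two solutions of the same first-order recurrence are proportional, so all that `h` shows to
    -- `J` is the single number σ 0, the sum of its coefficients over subsets of `J`.
    σ-signedBinomial : ∀ i → σ i ≡ σ 0 · signedBinomial t i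
    σ-signedBinomial zero    = sym (*-identityʳ (σ 0))
    σ-signedBinomial (suc i) = *-cancelˡ-ι i (begin
      ι (suc i) · σ (suc i)                            ≡⟨ σ-ratio i ⟩
      (ι i - ι t) · σ i                                ≡⟨ cong ((ι i - ι t) ·_) (σ-signedBinomial i) ⟩
      (ι i - ι t) · (σ 0 · signedBinomial t i)         ≡⟨ solve 3 (λ c s b → c :* (s :* b) := s :* (c :* b)) refl (ι i - ι t) (σ 0) (signedBinomial t i) ⟩
      σ 0 · ((ι i - ι t) · signedBinomial t i)         ≡⟨ cong (σ 0 ·_) (signedBinomial-ratio t i) ⟨
      σ 0 · (ι (suc i) · signedBinomial t (suc i))     ≡⟨ solve 3 (λ s c b → s :* (c :* b) := c :* (s :* b)) refl (σ 0) (ι (suc i)) (signedBinomial t (suc i)) ⟩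
      ι (suc i) · (σ 0 · signedBinomial t (suc i))     ∎)
      where open ≡-Reasoning

    pairing : ∀ (u : ℕ → ℚ) → ∑ˢ (λ I → h I · u ∣ I ∖ J ∣) ≡ σ 0 · ∇ t u 0
    pairing u = begin
      ∑ˢ (λ I → h I · u ∣ I ∖ J ∣)
        ≡⟨ ∑-cong (allSubsets n) (λ I → begin
             h I · u ∣ I ∖ J ∣
               ≡⟨ cong (h I ·_) (∑-δ N u ∣ I ∖ J ∣ (ℕ.s≤s (ℕ.m≤n⇒m≤o+n t (∣p∣≤n (I ∩ ∁ J))))) ⟨
             h I · ∑ (upTo N) (λ i → δ i ∣ I ∖ J ∣ · u i)
               ≡⟨ ∑-*ˡ (upTo N) (h I) (λ i → δ i ∣ I ∖ J ∣ · u i) ⟨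
             ∑ (upTo N) (λ i → h I · (δ i ∣ I ∖ J ∣ · u i))
               ≡⟨ ∑-cong (upTo N) (λ i → sym (*-assoc (h I) (δ i ∣ I ∖ J ∣) (u i))) ⟩
             ∑ (upTo N) (λ i → h I · δ i ∣ I ∖ J ∣ · u i) ∎) ⟩
      ∑ˢ (λ I → ∑ (upTo N) (λ i → h I · δ i ∣ I ∖ J ∣ · u i))
        ≡⟨ ∑-swap (allSubsets n) (upTo N) (λ I i → h I · δ i ∣ I ∖ J ∣ · u i) ⟩
      ∑ (upTo N) (λ i → ∑ˢ (λ I → h I · δ i ∣ I ∖ J ∣ · u i))
        ≡⟨ ∑-cong (upTo N) (λ i → trans (∑-*ʳ (allSubsets n) (u i) (λ I → h I · δ i ∣ I ∖ J ∣))
             (trans (cong (_· u i) (σ-signedBinomial i)) (*-assoc (σ 0) (signedBinomial t i) (u i)))) ⟩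
      ∑ (upTo N) (λ i → σ 0 · (signedBinomial t i · u i))
        ≡⟨ ∑-*ˡ (upTo N) (σ 0) (λ i → signedBinomial t i · u i) ⟩
      σ 0 · ∑ (upTo N) (λ i → signedBinomial t i · u i)
        ≡⟨ cong (σ 0 ·_) (∑-signedBinomial t N u (ℕ.s≤s (ℕ.m≤m+n t n))) ⟩
      σ 0 · ∇ t u 0 ∎
      where
      open ≡-Reasoning
      -- Large enough both for all sizes of sets, which are at most n, and for the t + 1 nonzero
      -- binomial coefficients.
      N = suc (t ℕ.+ n)

    -- Only subsets of `J` contribute, and these are too small for the support of `h`. For ∣J∣ = t
    -- the set `J` itself is the one that remains.
    σ0-low : ∣ J ∣ ℕ.< t → σ 0 ≡ 0ℚ
    σ0-low J<t = ∑-zero (allSubsets n) term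
      where
      term : ∀ I → h I · δ 0 ∣ I ∖ J ∣ ≡ 0ℚ
      term I = case ∣ I ∖ J ∣ ℕ.≟ 0 of λ where
        (no ne) → trans (cong (h I ·_) (ind-no (∣ I ∖ J ∣ ℕ.≟ 0) ne)) (*-zeroʳ (h I))
        (yes e) → trans (cong (_· δ 0 ∣ I ∖ J ∣) (proj₁ harm I (ℕ.<⇒≢ (ℕ.≤-<-trans (∣I∖J∣≡0⇒∣I∣≤∣J∣ I J e) J<t))))
                          (*-zeroˡ (δ 0 ∣ I ∖ J ∣))

    σ0-top : ∣ J ∣ ≡ t → σ 0 ≡ h J
    σ0-top J≡t = trans (∑-cong (allSubsets n) term) (∑ˢ-δ J h)
      where
      term : ∀ I → h I · δ 0 ∣ I ∖ J ∣ ≡ ind (I ≟ˢ J) · h I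
      term I = case ∣ I ∣ ℕ.≟ t of λ where
        (no I≢t)  → trans (trans (cong (_· δ 0 ∣ I ∖ J ∣) (proj₁ harm I I≢t)) (*-zeroˡ (δ 0 ∣ I ∖ J ∣)))
                        (sym (trans (cong (ind (I ≟ˢ J) ·_) (proj₁ harm I I≢t)) (*-zeroʳ (ind (I ≟ˢ J)))))
        (yes I≡t) → trans (*-comm (h I) (δ 0 ∣ I ∖ J ∣)) (cong (_· h I) (ind-cong (∣ I ∖ J ∣ ℕ.≟ 0) (I ≟ˢ J)
                        (λ e → ∣I∖J∣≡0⇒I≡J I J e (trans I≡t (sym J≡t))) (λ { refl → ∣I∖I∣≡0 I })))

    row : ∀ (y : ℕ → ℚ) → ∑ˢ (λ I → h I · y ∣ I ∪ J ∣) ≡ σ 0 · ∇ t (λ a → y (∣ J ∣ ℕ.+ a)) 0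
    row y = trans (∑-cong (allSubsets n) (λ I → cong (λ m → h I · y m) (∣I∪J∣≡∣J∣+∣I∖J∣ I J)))
                  (pairing (λ a → y (∣ J ∣ ℕ.+ a)))

  harmonic-row-low : ∀ y → ∣ J ∣ ℕ.< t → ∑ˢ (λ I → h I · y ∣ I ∪ J ∣) ≡ 0ℚ
  harmonic-row-low y J<t = trans (row y) (trans (cong (_· d) (σ0-low J<t)) (*-zeroˡ d))
    where d = ∇ t (λ a → y (∣ J ∣ ℕ.+ a)) 0

  harmonic-row-top : ∀ y → ∣ J ∣ ≡ t → ∑ˢ (λ I → h I · y ∣ I ∪ J ∣) ≡ h J · ∇ t (λ a → y (t ℕ.+ a)) 0
  harmonic-row-top y J≡t = trans (row y) (cong₂ (λ s m → s · ∇ t (λ a → y (m ℕ.+ a)) 0) (σ0-top J≡t) J≡t)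

-- The moment form

-- The pseudo-expectation of the product pq: squares of bits are the bits themselves, so the
-- monomials of `I` and `J` multiply to that of I ∪ J, whose moment depends only on its size.
B : ∀ {n} → (ℕ → ℚ) → Coeffs n → Coeffs n → ℚ
B y p q = ∑ˢ (λ J → q J · ∑ˢ (λ I → p I · y ∣ I ∪ J ∣))

B-linearʳ : ∀ {n} y (p : Coeffs n) a b (q r : Coeffs n) →
            B y p (λ I → a · q I + b · r I) ≡ a · B y p q + b · B y p r
B-linearʳ {n} y p a b q r = trans
  (∑-cong (allSubsets n) (λ J → solve 5 (λ a q b r s → (a :* q :+ b :* r) :* s := a :* (q :* s) :+ b :* (r :* s)) refl a (q J) b (r J) (s J)))
  (∑-linear (allSubsets n) a b (λ J → q J · s J) (λ J → r J · s J))
  where s = λ J → ∑ˢ (λ I → p I · y ∣ I ∪ J ∣)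

B-congʳ : ∀ {n} y (p : Coeffs n) {q r : Coeffs n} → (∀ I → q I ≡ r I) → B y p q ≡ B y p r
B-congʳ {n} y p q≡r = ∑-cong (allSubsets n) (λ J → cong (_· ∑ˢ (λ I → p I · y ∣ I ∪ J ∣)) (q≡r J))

B-+ʳ : ∀ {n} y (p q r : Coeffs n) → B y p (λ I → q I + r I) ≡ B y p q + B y p r
B-+ʳ y p q r = trans (B-congʳ y p (λ I → sym (unit-combination (q I) (r I))))
  (trans (B-linearʳ y p 1ℚ 1ℚ q r) (unit-combination (B y p q) (B y p r)))

B-sym : ∀ {n} y (p q : Coeffs n) → B y p q ≡ B y q p
B-sym {n} y p q = begin
  ∑ˢ (λ J → q J · ∑ˢ (λ I → p I · y ∣ I ∪ J ∣))     ≡⟨ ∑-cong (allSubsets n) (λ J → sym (∑-*ˡ (allSubsets n) (q J) (λ I → p I · y ∣ I ∪ J ∣))) ⟩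
  ∑ˢ (λ J → ∑ˢ (λ I → q J · (p I · y ∣ I ∪ J ∣)))   ≡⟨ ∑-swap (allSubsets n) (allSubsets n) (λ J I → q J · (p I · y ∣ I ∪ J ∣)) ⟩
  ∑ˢ (λ I → ∑ˢ (λ J → q J · (p I · y ∣ I ∪ J ∣)))   ≡⟨ ∑-cong (allSubsets n) (λ I → trans
    (∑-cong (allSubsets n) (λ J → trans (solve 3 (λ q p y → q :* (p :* y) := p :* (q :* y)) refl (q J) (p I) (y ∣ I ∪ J ∣))
                                        (cong (λ K → p I · (q J · y ∣ K ∣)) (∪-comm I J))))
    (∑-*ˡ (allSubsets n) (p I) (λ J → q J · y ∣ J ∪ I ∣))) ⟩
  ∑ˢ (λ I → p I · ∑ˢ (λ J → q J · y ∣ J ∪ I ∣))     ∎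
  where open ≡-Reasoning

B-+ˡ : ∀ {n} y (p q r : Coeffs n) → B y (λ I → p I + q I) r ≡ B y p r + B y q r
B-+ˡ y p q r = trans (B-sym y (λ I → p I + q I) r) (trans (B-+ʳ y r p q) (cong₂ _+_ (B-sym y r p) (B-sym y r q)))

-- One formula for two uses: for q of smaller degree the inner product is 0, which is orthogonality,
-- and for q = h it is a sum of squares, so only the sign of the difference of `y` matters.
B-harmonic : ∀ {n t} y {h q : Coeffs n} → Harmonic t h → Deg≤ t q →
             B y h q ≡ ∇ t (λ a → y (t ℕ.+ a)) 0 · ⟨ q , h ⟩
B-harmonic {n} {t} y {h} {q} harm deg = trans (∑-cong (allSubsets n) term)
                                              (∑-*ˡ (allSubsets n) c (λ J → q J · h J))
  where
  c = ∇ t (λ a → y (t ℕ.+ a)) 0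
  s : Subset n → ℚ
  s J = ∑ˢ (λ I → h I · y ∣ I ∪ J ∣)
  term : ∀ J → q J · s J ≡ c · (q J · h J)
  term J = case ℕ.<-cmp ∣ J ∣ t of λ where
    (tri< J<t J≢t _) → trans (cong (q J ·_) (harmonic-row-low harm J y J<t)) (trans (*-zeroʳ (q J)) (sym
                           (trans (cong (λ x → c · (q J · x)) (proj₁ harm J J≢t)) (trans (cong (c ·_) (*-zeroʳ (q J))) (*-zeroʳ c)))))
    (tri≈ _ J≡t _)   → trans (cong (q J ·_) (harmonic-row-top harm J y J≡t))
                           (solve 3 (λ q h c → q :* (h :* c) := c :* (q :* h)) refl (q J) (h J) c)
    (tri> _ _ t<J)   → trans (cong (_· s J) (deg J t<J)) (trans (*-zeroˡ (s J)) (sym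
                           (trans (cong (λ x → c · (x · h J)) (deg J t<J)) (trans (cong (c ·_) (*-zeroˡ (h J))) (*-zeroʳ c)))))

-- Of the elements that can be added to `I`, those already in `J` leave the union unchanged, and
-- there are ∣I ∪ J∣ - ∣I∣ of them; the remaining n - ∣I ∪ J∣ enlarge it by one.
D-∪ : ∀ {n} (J : Subset n) (y : ℕ → ℚ) (I : Subset n) →
      D (λ I → y ∣ I ∪ J ∣) I + ι ∣ I ∣ · y ∣ I ∪ J ∣
      ≡ ι ∣ I ∪ J ∣ · y ∣ I ∪ J ∣ + (ι n - ι ∣ I ∪ J ∣) · y (suc ∣ I ∪ J ∣)
D-∪ [] y [] = solve 2 (λ a b → con 0ℚ :+ con 0ℚ :* a := con 0ℚ :* a :+ (con 0ℚ :- con 0ℚ) :* b) refl (y 0) (y 1)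
D-∪ {suc n} (outside ∷ J) y (outside ∷ I) = begin
  (d + y (suc m)) + ι ∣ I ∣ · y m                         ≡⟨ solve 3 (λ d z i → (d :+ z) :+ i := (d :+ i) :+ z) refl d (y (suc m)) (ι ∣ I ∣ · y m) ⟩
  (d + ι ∣ I ∣ · y m) + y (suc m)                         ≡⟨ cong (_+ y (suc m)) (D-∪ J y I) ⟩
  (ι m · y m + (ι n - ι m) · y (suc m)) + y (suc m)       ≡⟨ solve 4 (λ x n m z → (x :+ (n :- m) :* z) :+ z := x :+ ((con 1ℚ :+ n) :- m) :* z) refl (ι m · y m) (ι n) (ι m) (y (suc m)) ⟩
  ι m · y m + ((1ℚ + ι n) - ι m) · y (suc m)              ≡⟨ cong (λ k → ι m · y m + (k - ι m) · y (suc m)) (ι-suc n) ⟨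
  ι m · y m + (ι (suc n) - ι m) · y (suc m)               ∎
  where
  open ≡-Reasoning
  m = ∣ I ∪ J ∣
  d = D (λ I → y ∣ I ∪ J ∣) I
D-∪ {suc n} (inside ∷ J) y (outside ∷ I) = begin
  (d + y (suc m)) + ι ∣ I ∣ · y (suc m)                             ≡⟨ solve 3 (λ d z i → (d :+ z) :+ i := (d :+ i) :+ z) refl d (y (suc m)) (ι ∣ I ∣ · y (suc m)) ⟩
  (d + ι ∣ I ∣ · y (suc m)) + y (suc m)                             ≡⟨ cong (_+ y (suc m)) (D-∪ J (y ∘ suc) I) ⟩
  (ι m · y (suc m) + (ι n - ι m) · y (suc (suc m))) + y (suc m)     ≡⟨ solve 4 (λ m z n w → (m :* z :+ (n :- m) :* w) :+ z := (con 1ℚ :+ m) :* z :+ ((con 1ℚ :+ n) :- (con 1ℚ :+ m)) :* w) refl (ι m) (y (suc m)) (ι n) (y (suc (suc m))) ⟩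
  (1ℚ + ι m) · y (suc m) + ((1ℚ + ι n) - (1ℚ + ι m)) · y (suc (suc m)) ≡⟨ cong₂ (λ k l → k · y (suc m) + (l - k) · y (suc (suc m))) (ι-suc m) (ι-suc n) ⟨
  ι (suc m) · y (suc m) + (ι (suc n) - ι (suc m)) · y (suc (suc m)) ∎
  where
  open ≡-Reasoning
  m = ∣ I ∪ J ∣
  d = D (λ I → y (suc ∣ I ∪ J ∣)) I
D-∪ {suc n} (j ∷ J) y (inside ∷ I) = begin
  d + ι (suc ∣ I ∣) · y (suc m)                                     ≡⟨ cong (λ k → d + k · y (suc m)) (ι-suc ∣ I ∣) ⟩
  d + (1ℚ + ι ∣ I ∣) · y (suc m)                                    ≡⟨ solve 3 (λ d i z → d :+ (con 1ℚ :+ i) :* z := (d :+ i :* z) :+ z) refl d (ι ∣ I ∣) (y (suc m)) ⟩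
  (d + ι ∣ I ∣ · y (suc m)) + y (suc m)                             ≡⟨ cong (_+ y (suc m)) (D-∪ J (y ∘ suc) I) ⟩
  (ι m · y (suc m) + (ι n - ι m) · y (suc (suc m))) + y (suc m)     ≡⟨ solve 4 (λ m z n w → (m :* z :+ (n :- m) :* w) :+ z := (con 1ℚ :+ m) :* z :+ ((con 1ℚ :+ n) :- (con 1ℚ :+ m)) :* w) refl (ι m) (y (suc m)) (ι n) (y (suc (suc m))) ⟩
  (1ℚ + ι m) · y (suc m) + ((1ℚ + ι n) - (1ℚ + ι m)) · y (suc (suc m)) ≡⟨ cong₂ (λ k l → k · y (suc m) + (l - k) · y (suc (suc m))) (ι-suc m) (ι-suc n) ⟨
  ι (suc m) · y (suc m) + (ι (suc n) - ι (suc m)) · y (suc (suc m)) ∎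
  where
  open ≡-Reasoning
  m = ∣ I ∪ J ∣
  d = D (λ I → y (suc ∣ I ∪ J ∣)) I

∣I∪J∣≤∣I∣+∣J∣ : ∀ {n} (I J : Subset n) → ∣ I ∪ J ∣ ℕ.≤ ∣ I ∣ ℕ.+ ∣ J ∣
∣I∪J∣≤∣I∣+∣J∣ I J = subst₂ ℕ._≤_ (sym (∣I∪J∣≡∣J∣+∣I∖J∣ I J)) (ℕ.+-comm ∣ J ∣ ∣ I ∣)
                            (ℕ.+-monoʳ-≤ ∣ J ∣ (∣p∩q∣≤∣p∣ I (∁ J)))

-- Multiplication by x₁ + … + xₙ.
X : ∀ {n} → Coeffs n → Coeffs n
X p I = U p I + ι ∣ I ∣ · p I

-- `y-step` says that x₁ + ... + xₙ - κ has pseudo-expectation 0 against every monomial of degree m: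
-- multiplying by the sum gives m copies of the monomial and n - m monomials of degree m + 1.
-- `y-diff` is the sign of the scalar by which the form acts on harmonic polynomials of degree t.
module Positivity {n M : ℕ} (M≤n : M ℕ.≤ n) (κ : ℚ) (y : ℕ → ℚ)
  (y-step : ∀ m → m ℕ.< M → (ι n - ι m) · y (suc m) ≡ (κ - ι m) · y m)
  (y-diff : ∀ t → t ℕ.+ t ℕ.≤ M → 0ℚ ≤ ∇ t (λ a → y (t ℕ.+ a)) 0)
  where

  -- In each row, `adjoint` moves `U` onto the moments, where `D-∪` and `y-step` evaluate it. The
  -- strict bound leaves room for the one degree that `X` adds.
  B-X : ∀ {a b} → a ℕ.+ b ℕ.< M → {p q : Coeffs n} → Deg≤ a p → Deg≤ b q → B y p (X q) ≡ κ · B y p q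
  B-X {a} {b} a+b<M {p} {q} degp degq = begin
    B y p (X q)                ≡⟨ B-sym y p (X q) ⟩
    B y (X q) p                ≡⟨ ∑-cong (allSubsets n) outer ⟩
    ∑ˢ (λ J → κ · (p J · ∑ˢ (λ I → q I · y ∣ I ∪ J ∣)))
                               ≡⟨ ∑-*ˡ (allSubsets n) κ (λ J → p J · ∑ˢ (λ I → q I · y ∣ I ∪ J ∣)) ⟩
    κ · B y q p                ≡⟨ cong (κ ·_) (B-sym y q p) ⟩
    κ · B y p q                ∎
    where
    open ≡-Reasoning
    inner : ∀ J → ∣ J ∣ ℕ.≤ a → ∀ I →
            q I · D (λ I → y ∣ I ∪ J ∣) I + ι ∣ I ∣ · q I · y ∣ I ∪ J ∣ ≡ κ · (q I · y ∣ I ∪ J ∣)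
    inner J J≤a I = case ∣ I ∣ ℕ.≤? b of λ where
        (no I≰b) → trans (cong (λ x → x · d + ι ∣ I ∣ · x · y m) (degq I (ℕ.≰⇒> I≰b)))
          (trans (solve 4 (λ d i y k → con 0ℚ :* d :+ i :* con 0ℚ :* y := k :* (con 0ℚ :* y)) refl d (ι ∣ I ∣) (y m) κ)
                 (sym (cong (λ x → κ · (x · y m)) (degq I (ℕ.≰⇒> I≰b)))))
        (yes I≤b) → begin
          q I · d + ι ∣ I ∣ · q I · y m                  ≡⟨ solve 4 (λ q d i y → q :* d :+ i :* q :* y := q :* (d :+ i :* y)) refl (q I) d (ι ∣ I ∣) (y m) ⟩
          q I · (d + ι ∣ I ∣ · y m)                      ≡⟨ cong (q I ·_) (D-∪ J y I) ⟩
          q I · (ι m · y m + (ι n - ι m) · y (suc m))    ≡⟨ cong (λ x → q I · (ι m · y m + x)) (y-step m (m<M I≤b)) ⟩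
          q I · (ι m · y m + (κ - ι m) · y m)            ≡⟨ solve 4 (λ q m y k → q :* (m :* y :+ (k :- m) :* y) := k :* (q :* y)) refl (q I) (ι m) (y m) κ ⟩
          κ · (q I · y m)                                ∎
      where
      m : ℕ
      m = ∣ I ∪ J ∣
      d : ℚ
      d = D (λ I → y ∣ I ∪ J ∣) I
      m<M : ∣ I ∣ ℕ.≤ b → m ℕ.< M
      m<M I≤b = ℕ.≤-<-trans (ℕ.≤-trans (∣I∪J∣≤∣I∣+∣J∣ I J) (subst (∣ I ∣ ℕ.+ ∣ J ∣ ℕ.≤_) (ℕ.+-comm b a) (ℕ.+-mono-≤ I≤b J≤a))) a+b<M
    row : ∀ J → ∣ J ∣ ℕ.≤ a → ∑ˢ (λ I → X q I · y ∣ I ∪ J ∣) ≡ κ · ∑ˢ (λ I → q I · y ∣ I ∪ J ∣)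
    row J J≤a = begin
      ∑ˢ (λ I → X q I · v I)                                      ≡⟨ ∑-cong (allSubsets n) (λ I → *-distribʳ-+ (v I) (U q I) (ι ∣ I ∣ · q I)) ⟩
      ∑ˢ (λ I → U q I · v I + ι ∣ I ∣ · q I · v I)                ≡⟨ ∑-+ (allSubsets n) (λ I → U q I · v I) (λ I → ι ∣ I ∣ · q I · v I) ⟩
      ⟨ U q , v ⟩ + ∑ˢ (λ I → ι ∣ I ∣ · q I · v I)                ≡⟨ cong (_+ ∑ˢ (λ I → ι ∣ I ∣ · q I · v I)) (adjoint q v) ⟩
      ⟨ q , D v ⟩ + ∑ˢ (λ I → ι ∣ I ∣ · q I · v I)                ≡⟨ ∑-+ (allSubsets n) (λ I → q I · D v I) (λ I → ι ∣ I ∣ · q I · v I) ⟨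
      ∑ˢ (λ I → q I · D v I + ι ∣ I ∣ · q I · v I)                ≡⟨ ∑-cong (allSubsets n) (inner J J≤a) ⟩
      ∑ˢ (λ I → κ · (q I · v I))                                  ≡⟨ ∑-*ˡ (allSubsets n) κ (λ I → q I · v I) ⟩
      κ · ∑ˢ (λ I → q I · v I)                                    ∎
      where
      v : Coeffs n
      v I = y ∣ I ∪ J ∣
    outer : ∀ J → p J · ∑ˢ (λ I → X q I · y ∣ I ∪ J ∣) ≡ κ · (p J · ∑ˢ (λ I → q I · y ∣ I ∪ J ∣))
    outer J = case ∣ J ∣ ℕ.≤? a of λ where
        (yes J≤a) → trans (cong (p J ·_) (row J J≤a)) (solve 3 (λ p k s → p :* (k :* s) := k :* (p :* s)) refl (p J) κ r)
        (no J≰a)  → trans (cong (_· s) (degp J (ℕ.≰⇒> J≰a)))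
          (trans (solve 3 (λ s k r → con 0ℚ :* s := k :* (con 0ℚ :* r)) refl s κ r)
                 (sym (cong (λ x → κ · (x · r)) (degp J (ℕ.≰⇒> J≰a)))))
      where
      s r : ℚ
      s = ∑ˢ (λ I → X q I · y ∣ I ∪ J ∣)
      r = ∑ˢ (λ I → q I · y ∣ I ∪ J ∣)

  Hom⇒Deg≤ : ∀ {j} {p : Coeffs n} → Hom j p → Deg≤ j p
  Hom⇒Deg≤ hom I j<I = hom I (λ e → ℕ.<⇒≢ j<I (sym e))

  -- In degree j, `U` differs from multiplication by the sum of the variables only by the scalar j.
  -- This is what trades the top-degree term U r for a multiple of `r`.
  B-U : ∀ {a j} → a ℕ.+ j ℕ.< M → {p q : Coeffs n} → Deg≤ a p → Hom j q → B y p (U q) ≡ (κ - ι j) · B y p q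
  B-U {a} {j} a+j<M {p} {q} degp homq = begin
    B y p (U q)                                 ≡⟨ B-congʳ y p (λ I → begin
      U q I                                       ≡⟨ solve 3 (λ u i q → u := con 1ℚ :* (u :+ i :* q) :+ (:- con 1ℚ) :* (i :* q)) refl (U q I) (ι ∣ I ∣) (q I) ⟩
      1ℚ · X q I + (- 1ℚ) · (ι ∣ I ∣ · q I)       ≡⟨ cong (λ x → 1ℚ · X q I + (- 1ℚ) · x) (Hom-level homq ι I) ⟩
      1ℚ · X q I + (- 1ℚ) · (ι j · q I)           ≡⟨ solve 3 (λ x j q → con 1ℚ :* x :+ (:- con 1ℚ) :* (j :* q) := con 1ℚ :* x :+ (:- j) :* q) refl (X q I) (ι j) (q I) ⟩
      1ℚ · X q I + (- ι j) · q I                  ∎) ⟩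
    B y p (λ I → 1ℚ · X q I + (- ι j) · q I)    ≡⟨ B-linearʳ y p 1ℚ (- ι j) (X q) q ⟩
    1ℚ · B y p (X q) + (- ι j) · B y p q        ≡⟨ cong (λ x → 1ℚ · x + (- ι j) · B y p q) (B-X a+j<M degp (Hom⇒Deg≤ homq)) ⟩
    1ℚ · (κ · B y p q) + (- ι j) · B y p q      ≡⟨ solve 3 (λ k b j → con 1ℚ :* (k :* b) :+ (:- j) :* b := (k :- j) :* b) refl κ (B y p q) (ι j) ⟩
    (κ - ι j) · B y p q                         ∎
    where open ≡-Reasoning

  B-harmonic-nonneg : ∀ {t} → t ℕ.+ t ℕ.≤ M → {h : Coeffs n} → Harmonic t h → 0ℚ ≤ B y h h
  B-harmonic-nonneg {t} 2t≤M {h} harm = subst (0ℚ ≤_) (sym (B-harmonic y harm (Hom⇒Deg≤ (proj₁ harm))))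
    (0≤p*q (y-diff t 2t≤M) (0≤∑ (allSubsets n) (λ I → 0≤p*p (h I))))

  B-harmonic-orthogonal : ∀ {j} {h q : Coeffs n} → Harmonic (suc j) h → Deg≤ j q → B y h q ≡ 0ℚ
  B-harmonic-orthogonal {j} {h} {q} harm deg = trans
    (B-harmonic y harm (λ I 1+j<I → deg I (ℕ.<-trans (ℕ.n<1+n j) 1+j<I)))
    (trans (cong (c ·_) (∑-zero (allSubsets n) term)) (*-zeroʳ c))
    where
    c = ∇ (suc j) (λ a → y (suc j ℕ.+ a)) 0
    term : ∀ I → q I · h I ≡ 0ℚ
    term I = case ∣ I ∣ ℕ.≟ suc j of λ where
      (yes e) → trans (cong (_· h I) (deg I (ℕ.≤-reflexive (sym e)))) (*-zeroˡ (h I))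
      (no ne) → trans (cong (q I ·_) (proj₁ harm I ne)) (*-zeroʳ (q I))

  -- Induction on the degree. Modulo x₁ + ... + xₙ = κ, `p` equals h + s with `h` harmonic of degree
  -- T and `s` of smaller degree; the cross terms vanish and the form splits. The replacement is
  -- made in one argument at a time, with symmetry in between.
  B-nonneg : ∀ T → T ℕ.+ T ℕ.≤ M → (p : Coeffs n) → Deg≤ T p → 0ℚ ≤ B y p p
  B-nonneg zero    2T≤M p deg = B-harmonic-nonneg 2T≤M (hom , Dp≡0)
    where
    hom : Hom 0 p
    hom I I≢0 = deg I (ℕ.n≢0⇒n>0 I≢0)
    Dp≡0 : ∀ I → D p I ≡ 0ℚ
    Dp≡0 I = D-vanish (λ J e → hom J (λ e′ → ℕ.0≢1+n (trans (sym e′) e))) I refl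
  B-nonneg (suc j) 2T≤M p deg = subst (0ℚ ≤_) (sym Bpp≡)
    (0≤p+q (B-harmonic-nonneg 2T≤M harm) (B-nonneg j (ℕ.≤-trans (ℕ.+-mono-≤ (ℕ.n≤1+n j) (ℕ.n≤1+n j)) 2T≤M) s deg-s))
    where
    open ≡-Reasoning
    T = suc j
    top low : Coeffs n
    top I = ind (∣ I ∣ ℕ.≟ T) · p I
    low I = (1ℚ - ind (∣ I ∣ ℕ.≟ T)) · p I
    hom-top : Hom T top
    hom-top I I≢T = trans (cong (_· p I) (ind-no (∣ I ∣ ℕ.≟ T) I≢T)) (*-zeroˡ (p I))
    deg-low : Deg≤ j low
    deg-low I j<I = case ∣ I ∣ ℕ.≟ T of λ where
      (yes e) → trans (cong (λ x → (1ℚ - x) · p I) (ind-yes (∣ I ∣ ℕ.≟ T) e)) (*-zeroˡ (p I))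
      (no ne) → trans (cong ((1ℚ - ind (∣ I ∣ ℕ.≟ T)) ·_) (deg I (ℕ.≤∧≢⇒< j<I (λ e → ne (sym e))))) (*-zeroʳ (1ℚ - ind (∣ I ∣ ℕ.≟ T)))
    2j<n : j ℕ.+ j ℕ.< n
    2j<n = ℕ.<-≤-trans (ℕ.+-mono-< (ℕ.n<1+n j) (ℕ.n<1+n j)) (ℕ.≤-trans 2T≤M M≤n)
    dec = harmonic-decomposition j 2j<n top hom-top
    h r s p̃ : Coeffs n
    h = proj₁ dec
    r = proj₁ (proj₂ dec)
    -- The lower part of `p` together with what U r becomes under the form.
    s I = 1ℚ · low I + (κ - ι j) · r I
    p̃ I = h I + s I
    harm : Harmonic T h
    harm = proj₁ (proj₂ (proj₂ dec))
    hom-r : Hom j r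
    hom-r = proj₁ (proj₂ (proj₂ (proj₂ dec)))
    deg-s : Deg≤ j s
    deg-s I j<I = trans (cong₂ (λ x z → 1ℚ · x + (κ - ι j) · z) (deg-low I j<I) (Hom⇒Deg≤ hom-r I j<I))
                        (trans (+-identityˡ ((κ - ι j) · 0ℚ)) (*-zeroʳ (κ - ι j)))
    deg-p̃ : Deg≤ T p̃
    deg-p̃ I T<I = cong₂ _+_ (Hom⇒Deg≤ (proj₁ harm) I T<I) (deg-s I (ℕ.<-trans (ℕ.n<1+n j) T<I))
    p≡ : ∀ I → p I ≡ h I + (U r I + low I)
    p≡ I = begin
      p I                          ≡⟨ solve 2 (λ p i → p := i :* p :+ (con 1ℚ :- i) :* p) refl (p I) (ind (∣ I ∣ ℕ.≟ T)) ⟩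
      top I + low I                ≡⟨ cong (_+ low I) (proj₂ (proj₂ (proj₂ (proj₂ dec))) I) ⟩
      h I + U r I + low I          ≡⟨ +-assoc (h I) (U r I) (low I) ⟩
      h I + (U r I + low I)        ∎
    reduce : ∀ (f : Coeffs n) → Deg≤ T f → B y f p ≡ B y f p̃
    reduce f degf = begin
      B y f p                                         ≡⟨ B-congʳ y f p≡ ⟩
      B y f (λ I → h I + (U r I + low I))             ≡⟨ B-+ʳ y f h (λ I → U r I + low I) ⟩
      B y f h + B y f (λ I → U r I + low I)           ≡⟨ cong (B y f h +_) (B-+ʳ y f (U r) low) ⟩
      B y f h + (B y f (U r) + B y f low)             ≡⟨ cong (λ x → B y f h + (x + B y f low)) (B-U T+j<M degf hom-r) ⟩
      B y f h + ((κ - ι j) · B y f r + B y f low)     ≡⟨ cong (B y f h +_) (solve 2 (λ x l → x :+ l := con 1ℚ :* l :+ x) refl ((κ - ι j) · B y f r) (B y f low)) ⟩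
      B y f h + (1ℚ · B y f low + (κ - ι j) · B y f r) ≡⟨ cong (B y f h +_) (B-linearʳ y f 1ℚ (κ - ι j) low r) ⟨
      B y f h + B y f s                               ≡⟨ B-+ʳ y f h s ⟨
      B y f p̃                                         ∎
      where
      -- Pairing U r with degree T meets moments up to T + j + 1 = 2T, which is just within the
      -- range M.
      T+j<M : T ℕ.+ j ℕ.< M
      T+j<M = ℕ.<-≤-trans (ℕ.+-monoʳ-< T (ℕ.n<1+n j)) 2T≤M
    Bhs≡0 : B y h s ≡ 0ℚ
    Bhs≡0 = B-harmonic-orthogonal harm deg-s
    Bpp≡ : B y p p ≡ B y h h + B y s s
    Bpp≡ = begin
      B y p p                                   ≡⟨ reduce p deg ⟩
      B y p p̃                                   ≡⟨ B-sym y p p̃ ⟩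
      B y p̃ p                                   ≡⟨ reduce p̃ deg-p̃ ⟩
      B y p̃ p̃                                   ≡⟨ B-+ʳ y p̃ h s ⟩
      B y p̃ h + B y p̃ s                         ≡⟨ cong₂ _+_ (B-+ˡ y h s h) (B-+ˡ y h s s) ⟩
      (B y h h + B y s h) + (B y h s + B y s s) ≡⟨ cong₂ (λ x z → (B y h h + x) + (z + B y s s)) (trans (B-sym y s h) Bhs≡0) Bhs≡0 ⟩
      (B y h h + 0ℚ) + (0ℚ + B y s s)           ≡⟨ cong₂ _+_ (+-identityʳ (B y h h)) (+-identityˡ (B y s s)) ⟩
      B y h h + B y s s                         ∎

-- The moments of a uniformly random bit string of length n and weight n/2, extrapolated to odd n

inverse-nonneg : ∀ {c} (0<c : 0ℚ < c) → 0ℚ ≤ proj₁ (inverse 0<c)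
inverse-nonneg {c} 0<c = <⇒≤ (positive⁻¹ _ {{1/pos⇒pos c {{positive 0<c}}}})

module Moments (n : ℕ) where

  κ : ℚ
  κ = ½ · ι n

  falling : ℕ → ℚ
  falling zero    = 1ℚ
  falling (suc a) = falling a · (κ - ι a)

  -- 1 / (n − m) for m < n, and 1 for m ≥ n.
  recip : ℕ → ℚ
  recip m = proj₁ (inverse (0<ι (n ℕ.∸ suc m)))

  recipFalling : ℕ → ℚ
  recipFalling zero    = 1ℚ
  recipFalling (suc m) = recipFalling m · recip m

  -- The pseudo-probability that a given bits are 1 and b further given bits are 0.
  μ : ℕ → ℕ → ℚ
  μ a b = falling a · falling b · recipFalling (a ℕ.+ b)

  moment : ℕ → ℚ
  moment a = μ a 0

  recip-inverse : ∀ m → m ℕ.< n → recip m · (ι n - ι m) ≡ 1ℚ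
  recip-inverse m m<n = trans (cong (recip m ·_) eq) (proj₂ (inverse (0<ι (n ℕ.∸ suc m))))
    where
    open ≡-Reasoning
    d = n ℕ.∸ suc m
    eq : ι n - ι m ≡ ι (suc d)
    eq = begin
      ι n - ι m                ≡⟨ cong (λ k → ι k - ι m) (trans (ℕ.+-suc m d) (ℕ.m+[n∸m]≡n m<n)) ⟨
      ι (m ℕ.+ suc d) - ι m    ≡⟨ cong (_- ι m) (ι-+ m (suc d)) ⟩
      ι m + ι (suc d) - ι m    ≡⟨ solve 2 (λ a b → a :+ b :- a := b) refl (ι m) (ι (suc d)) ⟩
      ι (suc d)                ∎

  κ+κ≡n : κ + κ ≡ ι n
  κ+κ≡n = solve 1 (λ n → con ½ :* n :+ con ½ :* n := n) refl (ι n)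

  -- Total probability over one further bit. The weights of the two outcomes are κ - a and κ - b,
  -- and they add up to n - (a + b) because 2κ = n.
  μ-split : ∀ a b → a ℕ.+ b ℕ.< n → μ a b ≡ μ (suc a) b + μ a (suc b)
  μ-split a b a+b<n = sym (begin
    (fa · (κ - ι a)) · fb · (g · c) + fa · (fb · (κ - ι b)) · recipFalling (a ℕ.+ suc b)
      ≡⟨ cong (λ m → (fa · (κ - ι a)) · fb · (g · c) + fa · (fb · (κ - ι b)) · recipFalling m) (ℕ.+-suc a b) ⟩
    (fa · (κ - ι a)) · fb · (g · c) + fa · (fb · (κ - ι b)) · (g · c)
      ≡⟨ solve 7 (λ fa fb g c k a b → (fa :* (k :- a)) :* fb :* (g :* c) :+ fa :* (fb :* (k :- b)) :* (g :* c)
                   := (fa :* fb :* g) :* (c :* ((k :+ k) :- (a :+ b)))) refl fa fb g c κ (ι a) (ι b) ⟩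
    (fa · fb · g) · (c · ((κ + κ) - (ι a + ι b)))
      ≡⟨ cong₂ (λ x z → (fa · fb · g) · (c · (x - z))) κ+κ≡n (sym (ι-+ a b)) ⟩
    (fa · fb · g) · (c · (ι n - ι (a ℕ.+ b)))
      ≡⟨ cong ((fa · fb · g) ·_) (recip-inverse (a ℕ.+ b) a+b<n) ⟩
    (fa · fb · g) · 1ℚ
      ≡⟨ *-identityʳ (fa · fb · g) ⟩
    fa · fb · g ∎)
    where
    open ≡-Reasoning
    fa = falling a
    fb = falling b
    g = recipFalling (a ℕ.+ b)
    c = recip (a ℕ.+ b)

  moment-step : ∀ m → m ℕ.< n → (ι n - ι m) · moment (suc m) ≡ (κ - ι m) · moment m
  moment-step m m<n = subst (λ k → (ι n - ι m) · (falling (suc m) · 1ℚ · recipFalling (suc k)) ≡ (κ - ι m) · (falling m · 1ℚ · recipFalling k))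
    (sym (ℕ.+-identityʳ m)) (begin
    (ι n - ι m) · (falling m · (κ - ι m) · 1ℚ · (recipFalling m · recip m))
      ≡⟨ solve 5 (λ d f k g c → d :* (f :* k :* con 1ℚ :* (g :* c)) := (c :* d) :* (k :* (f :* con 1ℚ :* g))) refl (ι n - ι m) (falling m) (κ - ι m) (recipFalling m) (recip m) ⟩
    (recip m · (ι n - ι m)) · ((κ - ι m) · (falling m · 1ℚ · recipFalling m))
      ≡⟨ cong (_· ((κ - ι m) · (falling m · 1ℚ · recipFalling m))) (recip-inverse m m<n) ⟩
    1ℚ · ((κ - ι m) · (falling m · 1ℚ · recipFalling m))
      ≡⟨ *-identityˡ _ ⟩
    (κ - ι m) · (falling m · 1ℚ · recipFalling m) ∎)
    where open ≡-Reasoning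

  -- Inclusion-exclusion over the bits required to be 0, one difference for each; `μ-split` is the
  -- single step.
  ∇-moment : ∀ t b i → t ℕ.+ i ℕ.+ b ℕ.≤ n → ∇ b (λ a → moment (t ℕ.+ a)) i ≡ μ (t ℕ.+ i) b
  ∇-moment t zero    i _  = refl
  ∇-moment t (suc b) i le = begin
    ∇ b u i - ∇ b u (suc i)                         ≡⟨ cong₂ _-_ (∇-moment t b i (ℕ.<⇒≤ lt)) (∇-moment t b (suc i) (subst (λ k → k ℕ.+ b ℕ.≤ n) (sym (ℕ.+-suc t i)) lt)) ⟩
    μ (t ℕ.+ i) b - μ (t ℕ.+ suc i) b               ≡⟨ cong₂ (λ x k → x - μ k b) (μ-split (t ℕ.+ i) b lt) (ℕ.+-suc t i) ⟩
    (μ (suc (t ℕ.+ i)) b + μ (t ℕ.+ i) (suc b)) - μ (suc (t ℕ.+ i)) b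
                                                    ≡⟨ solve 2 (λ x z → (x :+ z) :- x := z) refl (μ (suc (t ℕ.+ i)) b) (μ (t ℕ.+ i) (suc b)) ⟩
    μ (t ℕ.+ i) (suc b)                             ∎
    where
    open ≡-Reasoning
    u = λ a → moment (t ℕ.+ a)
    lt : t ℕ.+ i ℕ.+ b ℕ.< n
    lt = subst (ℕ._≤ n) (ℕ.+-suc (t ℕ.+ i) b) le

  0≤recipFalling : ∀ m → 0ℚ ≤ recipFalling m
  0≤recipFalling zero    = nonNegative⁻¹ 1ℚ
  0≤recipFalling (suc m) = 0≤p*q (0≤recipFalling m) (inverse-nonneg (0<ι (n ℕ.∸ suc m)))

  0≤falling : ∀ a → a ℕ.+ a ℕ.≤ n → 0ℚ ≤ falling a
  0≤falling zero    _    = nonNegative⁻¹ 1ℚ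
  0≤falling (suc a) 2a≤n = 0≤p*q (0≤falling a 2a≤n′) (p≤q⇒0≤q-p (begin
    ι a                 ≡⟨ solve 1 (λ a → a := con ½ :* (a :+ a)) refl (ι a) ⟩
    ½ · (ι a + ι a)     ≡⟨ cong (½ ·_) (ι-+ a a) ⟨
    ½ · ι (a ℕ.+ a)     ≤⟨ *-monoˡ-≤-nonNeg ½ (ι-mono-≤ 2a≤n′) ⟩
    ½ · ι n             ∎))
    where
    open ≤-Reasoning
    2a≤n′ : a ℕ.+ a ℕ.≤ n
    2a≤n′ = ℕ.≤-trans (ℕ.+-mono-≤ (ℕ.n≤1+n a) (ℕ.n≤1+n a)) 2a≤n

  -- The difference is μ t t, a product of factors that are nonnegative in this range.
  moment-diff : ∀ t → t ℕ.+ t ℕ.≤ n → 0ℚ ≤ ∇ t (λ a → moment (t ℕ.+ a)) 0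
  moment-diff t 2t≤n = subst (0ℚ ≤_)
    (sym (trans (∇-moment t t 0 (subst (λ k → k ℕ.+ t ℕ.≤ n) (sym (ℕ.+-identityʳ t)) 2t≤n)) (cong (λ k → μ k t) (ℕ.+-identityʳ t))))
    (0≤p*q (0≤p*q (0≤falling t 2t≤n) (0≤falling t 2t≤n)) (0≤recipFalling (t ℕ.+ t)))

-- Polynomials as functions on {0,1}ⁿ

ev : ∀ {n} → Coeffs n → Subset n → ℚ
ev p []            = p []
ev p (outside ∷ x) = ev (lo p) x
ev p (inside ∷ x)  = ev (lo p) x + ev (hi p) x

-- L y f = Σ_I c_I y_∣I∣ for the multilinear polynomial Σ_I c_I x_I that agrees with f.
L : ∀ {n} → (ℕ → ℚ) → (Subset n → ℚ) → ℚ
L {zero}  y f = y 0 · f []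
-- The function equals (1 - x₁) times its restriction to x₁ = 0 plus x₁ times its restriction to x₁
-- = 1; the factor x₁ raises every degree by one, which shifts `y`.
L {suc n} y f = L (λ i → y i - y (suc i)) (lo f) + L (y ∘ suc) (hi f)

L-cong : ∀ {n} y {f g : Subset n → ℚ} → (∀ x → f x ≡ g x) → L y f ≡ L y g
L-cong {zero}  y f≡g = cong (y 0 ·_) (f≡g [])
L-cong {suc n} y f≡g = cong₂ _+_ (L-cong (λ i → y i - y (suc i)) (λ x → f≡g (outside ∷ x)))
                                 (L-cong (y ∘ suc) (λ x → f≡g (inside ∷ x)))

L-linear : ∀ {n} y a b (f g : Subset n → ℚ) → L y (λ x → a · f x + b · g x) ≡ a · L y f + b · L y g
L-linear {zero}  y a b f g = solve 5 (λ y a f b g → y :* (a :* f :+ b :* g) := a :* (y :* f) :+ b :* (y :* g)) refl (y 0) a (f []) b (g [])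
L-linear {suc n} y a b f g = trans
  (cong₂ _+_ (L-linear y₀ a b (lo f) (lo g)) (L-linear y₁ a b (hi f) (hi g)))
  (linear-interchange a b (L y₀ (lo f)) (L y₁ (hi f)) (L y₀ (lo g)) (L y₁ (hi g)))
  where
  y₀ = λ i → y i - y (suc i)
  y₁ = y ∘ suc

L-const1 : ∀ {n} y → L {n} y (λ _ → 1ℚ) ≡ y 0
L-const1 {zero}  y = *-identityʳ (y 0)
L-const1 {suc n} y = trans (cong₂ _+_ (L-const1 {n} (λ i → y i - y (suc i))) (L-const1 {n} (y ∘ suc)))
                           (solve 2 (λ a b → (a :- b) :+ b := a) refl (y 0) (y 1))

L-*ˡ : ∀ {n} y c (f : Subset n → ℚ) → L y (λ x → c · f x) ≡ c · L y f
L-*ˡ y c f = trans (L-cong y (λ x → solve 2 (λ c f → c :* f := c :* f :+ con 0ℚ :* f) refl c (f x)))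
  (trans (L-linear y c 0ℚ f f) (solve 2 (λ c f → c :* f :+ con 0ℚ :* f := c :* f) refl c (L y f)))

L-+ : ∀ {n} y (f g : Subset n → ℚ) → L y (λ x → f x + g x) ≡ L y f + L y g
L-+ y f g = trans (L-cong y (λ x → sym (unit-combination (f x) (g x))))
  (trans (L-linear y 1ℚ 1ℚ f g) (unit-combination (L y f) (L y g)))

L-∑ : ∀ {n} {A : Set} y (xs : List A) (f : A → Subset n → ℚ) → L y (λ x → ∑ xs (λ i → f i x)) ≡ ∑ xs (λ i → L y (f i))
L-∑ {n} y []       f = trans (L-*ˡ {n} y 0ℚ (λ _ → 0ℚ)) (*-zeroˡ (L {n} y (λ _ → 0ℚ)))
L-∑ {n} y (i ∷ xs) f = trans (L-+ y (f i) (λ x → ∑ xs (λ i → f i x))) (cong (L y (f i) +_) (L-∑ y xs f))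

ev-cong : ∀ {n} {p q : Coeffs n} → (∀ I → p I ≡ q I) → ∀ x → ev p x ≡ ev q x
ev-cong p≡q []            = p≡q []
ev-cong p≡q (outside ∷ x) = ev-cong (λ I → p≡q (outside ∷ I)) x
ev-cong p≡q (inside ∷ x)  = cong₂ _+_ (ev-cong (λ I → p≡q (outside ∷ I)) x) (ev-cong (λ I → p≡q (inside ∷ I)) x)

ev-linear : ∀ {n} a b (p q : Coeffs n) x → ev (λ I → a · p I + b · q I) x ≡ a · ev p x + b · ev q x
ev-linear a b p q []            = refl
ev-linear a b p q (outside ∷ x) = ev-linear a b (lo p) (lo q) x
ev-linear a b p q (inside ∷ x)  = trans
  (cong₂ _+_ (ev-linear a b (lo p) (lo q) x) (ev-linear a b (hi p) (hi q) x))
  (linear-interchange a b (ev (lo p) x) (ev (hi p) x) (ev (lo q) x) (ev (hi q) x))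

ev-+ : ∀ {n} (p q : Coeffs n) x → ev (λ I → p I + q I) x ≡ ev p x + ev q x
ev-+ p q x = trans (ev-cong (λ I → sym (unit-combination (p I) (q I))) x)
  (trans (ev-linear 1ℚ 1ℚ p q x) (unit-combination (ev p x) (ev q x)))

ev-zero : ∀ {n} (x : Subset n) → ev (λ _ → 0ℚ) x ≡ 0ℚ
ev-zero []            = refl
ev-zero (outside ∷ x) = ev-zero x
ev-zero (inside ∷ x)  = cong₂ _+_ (ev-zero x) (ev-zero x)

ev-X : ∀ {n} (p : Coeffs n) x → ev (X p) x ≡ ι ∣ x ∣ · ev p x
ev-X p []            = +-identityˡ (ι 0 · p [])
ev-X p (outside ∷ x) = ev-X (lo p) x
ev-X p (inside ∷ x)  = begin
  ev (X p₀) x + ev (hi (X p)) x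
    ≡⟨ cong (ev (X p₀) x +_) (ev-cong (λ I → trans (cong (λ m → (U p₁ I + p₀ I) + m · p₁ I) (ι-suc ∣ I ∣))
         (solve 4 (λ u q m p → (u :+ q) :+ (con 1ℚ :+ m) :* p := (u :+ m :* p) :+ (q :+ p)) refl (U p₁ I) (p₀ I) (ι ∣ I ∣) (p₁ I))) x) ⟩
  ev (X p₀) x + ev (λ I → X p₁ I + (p₀ I + p₁ I)) x
    ≡⟨ cong (ev (X p₀) x +_) (trans (ev-+ (X p₁) (λ I → p₀ I + p₁ I) x) (cong (ev (X p₁) x +_) (ev-+ p₀ p₁ x))) ⟩
  ev (X p₀) x + (ev (X p₁) x + (ev p₀ x + ev p₁ x))
    ≡⟨ cong₂ (λ a b → a + (b + (ev p₀ x + ev p₁ x))) (ev-X p₀ x) (ev-X p₁ x) ⟩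
  ι ∣ x ∣ · ev p₀ x + (ι ∣ x ∣ · ev p₁ x + (ev p₀ x + ev p₁ x))
    ≡⟨ solve 3 (λ m a b → m :* a :+ (m :* b :+ (a :+ b)) := (con 1ℚ :+ m) :* (a :+ b)) refl (ι ∣ x ∣) (ev p₀ x) (ev p₁ x) ⟩
  (1ℚ + ι ∣ x ∣) · (ev p₀ x + ev p₁ x)
    ≡⟨ cong (_· (ev p₀ x + ev p₁ x)) (ι-suc ∣ x ∣) ⟨
  ι (suc ∣ x ∣) · (ev p₀ x + ev p₁ x) ∎
  where
  open ≡-Reasoning
  p₀ = lo p
  p₁ = hi p

B-suc : ∀ {n} y (p q : Coeffs (suc n)) →
        B y p q ≡ (B y (lo p) (lo q) + B (y ∘ suc) (hi p) (lo q)) + (B (y ∘ suc) (lo p) (hi q) + B (y ∘ suc) (hi p) (hi q))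
B-suc {n} y p q = trans (∑ˢ-suc (λ J → q J · ∑ˢ (λ I → p I · y ∣ I ∪ J ∣)))
  (cong₂ _+_ (half (lo q) (outside ∷_)) (half (hi q) (inside ∷_)))
  where
  half : ∀ (r : Coeffs n) (c : Subset n → Subset (suc n)) →
         ∑ˢ (λ J → r J · ∑ˢ (λ I → p I · y ∣ I ∪ c J ∣))
         ≡ ∑ˢ (λ J → r J · ∑ˢ (λ I → lo p I · y ∣ (outside ∷ I) ∪ c J ∣)) + ∑ˢ (λ J → r J · ∑ˢ (λ I → hi p I · y ∣ (inside ∷ I) ∪ c J ∣))
  half r c = trans
    (∑-cong (allSubsets n) (λ J → trans (cong (r J ·_) (∑ˢ-suc (λ I → p I · y ∣ I ∪ c J ∣)))
       (*-distribˡ-+ (r J) (∑ˢ (λ I → lo p I · y ∣ (outside ∷ I) ∪ c J ∣)) (∑ˢ (λ I → hi p I · y ∣ (inside ∷ I) ∪ c J ∣)))))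
    (∑-+ (allSubsets n) (λ J → r J · ∑ˢ (λ I → lo p I · y ∣ (outside ∷ I) ∪ c J ∣)) (λ J → r J · ∑ˢ (λ I → hi p I · y ∣ (inside ∷ I) ∪ c J ∣)))

B-diff : ∀ {n} (y z : ℕ → ℚ) (p q : Coeffs n) → B (λ i → y i - z i) p q ≡ B y p q - B z p q
B-diff {n} y z p q = begin
  ∑ˢ (λ J → q J · ∑ˢ (λ I → p I · ((y ∣ I ∪ J ∣) - (z ∣ I ∪ J ∣))))
    ≡⟨ ∑-cong (allSubsets n) (λ J → begin
         q J · ∑ˢ (λ I → p I · ((y ∣ I ∪ J ∣) - (z ∣ I ∪ J ∣)))
           ≡⟨ cong (q J ·_) (trans
                (∑-cong (allSubsets n) (λ I → solve 3 (λ p y z → p :* (y :- z) := con 1ℚ :* (p :* y) :+ (:- con 1ℚ) :* (p :* z)) refl (p I) (y ∣ I ∪ J ∣) (z ∣ I ∪ J ∣)))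
                (∑-linear (allSubsets n) 1ℚ (- 1ℚ) (λ I → p I · y ∣ I ∪ J ∣) (λ I → p I · z ∣ I ∪ J ∣))) ⟩
         q J · (1ℚ · S y J + (- 1ℚ) · S z J)
           ≡⟨ solve 3 (λ q s t → q :* (con 1ℚ :* s :+ (:- con 1ℚ) :* t) := con 1ℚ :* (q :* s) :+ (:- con 1ℚ) :* (q :* t)) refl (q J) (S y J) (S z J) ⟩
         1ℚ · (q J · S y J) + (- 1ℚ) · (q J · S z J) ∎) ⟩
  ∑ˢ (λ J → 1ℚ · (q J · S y J) + (- 1ℚ) · (q J · S z J))
    ≡⟨ ∑-linear (allSubsets n) 1ℚ (- 1ℚ) (λ J → q J · S y J) (λ J → q J · S z J) ⟩
  1ℚ · B y p q + (- 1ℚ) · B z p q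
    ≡⟨ solve 2 (λ s t → con 1ℚ :* s :+ (:- con 1ℚ) :* t := s :- t) refl (B y p q) (B z p q) ⟩
  B y p q - B z p q ∎
  where
  open ≡-Reasoning
  S : (ℕ → ℚ) → Subset n → ℚ
  S y J = ∑ˢ (λ I → p I · y ∣ I ∪ J ∣)

-- Carries the positivity of coefficient vectors over to functions on the cube, where products are
-- pointwise and need no multilinear reduction. Expanding along the first variable, the subtracted
-- shifted term for x₁ = 0 cancels one of the terms for x₁ = 1.
L-ev : ∀ {n} y (p q : Coeffs n) → L y (λ x → ev p x · ev q x) ≡ B y p q
L-ev {zero}  y p q = solve 3 (λ y p q → y :* (p :* q) := q :* (p :* y :+ con 0ℚ) :+ con 0ℚ) refl (y 0) (p []) (q [])
L-ev {suc n} y p q = begin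
  L (λ i → y i - y (suc i)) (λ x → ev p₀ x · ev q₀ x) + L (y ∘ suc) (λ x → (ev p₀ x + ev p₁ x) · (ev q₀ x + ev q₁ x))
    ≡⟨ cong₂ _+_ (trans (L-ev (λ i → y i - y (suc i)) p₀ q₀) (B-diff y (y ∘ suc) p₀ q₀))
         (trans (L-cong (y ∘ suc) (λ x → cong₂ _·_ (sym (ev-+ p₀ p₁ x)) (sym (ev-+ q₀ q₁ x))))
                (L-ev (y ∘ suc) (λ I → p₀ I + p₁ I) (λ I → q₀ I + q₁ I))) ⟩
  (B y p₀ q₀ - B′ p₀ q₀) + B′ (λ I → p₀ I + p₁ I) (λ I → q₀ I + q₁ I)
    ≡⟨ cong ((B y p₀ q₀ - B′ p₀ q₀) +_) (trans (B-+ʳ (y ∘ suc) (λ I → p₀ I + p₁ I) q₀ q₁)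
         (cong₂ _+_ (B-+ˡ (y ∘ suc) p₀ p₁ q₀) (B-+ˡ (y ∘ suc) p₀ p₁ q₁))) ⟩
  (B y p₀ q₀ - B′ p₀ q₀) + ((B′ p₀ q₀ + B′ p₁ q₀) + (B′ p₀ q₁ + B′ p₁ q₁))
    ≡⟨ solve 4 (λ a b c d → (a :- b) :+ ((b :+ c) :+ d) := (a :+ c) :+ d) refl (B y p₀ q₀) (B′ p₀ q₀) (B′ p₁ q₀) (B′ p₀ q₁ + B′ p₁ q₁) ⟩
  (B y p₀ q₀ + B′ p₁ q₀) + (B′ p₀ q₁ + B′ p₁ q₁)
    ≡⟨ B-suc y p q ⟨
  B y p q ∎
  where
  open ≡-Reasoning
  B′ = B (y ∘ suc)
  p₀ = lo p
  p₁ = hi p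
  q₀ = lo q
  q₁ = hi q

Rep : ∀ {n} → ℕ → (Subset n → ℚ) → Set
Rep {n} d f = Σ (Coeffs n) λ p → Deg≤ d p × ∀ x → ev p x ≡ f x

Rep-weaken : ∀ {n d e} {f : Subset n → ℚ} → d ℕ.≤ e → Rep d f → Rep e f
Rep-weaken d≤e (p , deg , eq) = p , (λ I e<I → deg I (ℕ.≤-<-trans d≤e e<I)) , eq

Rep-cong : ∀ {n d} {f g : Subset n → ℚ} → (∀ x → f x ≡ g x) → Rep d f → Rep d g
Rep-cong f≡g (p , deg , eq) = p , deg , λ x → trans (eq x) (f≡g x)

Rep-zero : ∀ {n d} → Rep {n} d (λ _ → 0ℚ)
Rep-zero = (λ _ → 0ℚ) , (λ _ _ → refl) , ev-zero

Rep-one : ∀ {n d} → Rep {n} d (λ _ → 1ℚ)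
Rep-one = one , (λ I d<I → deg I (ℕ.≤-<-trans ℕ.z≤n d<I)) , ev-one
  where
  one : ∀ {n} → Coeffs n
  one []            = 1ℚ
  one (outside ∷ I) = one I
  one (inside ∷ I)  = 0ℚ
  deg : ∀ {n} (I : Subset n) → 0 ℕ.< ∣ I ∣ → one I ≡ 0ℚ
  deg (outside ∷ I) 0<I = deg I 0<I
  deg (inside ∷ I)  0<I = refl
  ev-one : ∀ {n} (x : Subset n) → ev one x ≡ 1ℚ
  ev-one []            = refl
  ev-one (outside ∷ x) = ev-one x
  ev-one (inside ∷ x)  = cong₂ _+_ (ev-one x) (ev-zero x)

Rep-linear : ∀ {n d} a b {f g : Subset n → ℚ} → Rep d f → Rep d g → Rep d (λ x → a · f x + b · g x)
Rep-linear a b (p , degp , evp) (q , degq , evq) =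
  (λ I → a · p I + b · q I) ,
  (λ I d<I → trans (cong₂ (λ x z → a · x + b · z) (degp I d<I) (degq I d<I)) (cong₂ _+_ (*-zeroʳ a) (*-zeroʳ b))) ,
  (λ x → trans (ev-linear a b p q x) (cong₂ (λ u v → a · u + b · v) (evp x) (evq x)))

Rep-∑ : ∀ {n d} {A : Set} (xs : List A) (w : A → ℚ) {f : A → Subset n → ℚ} →
        All (λ i → Rep d (f i)) xs → Rep d (λ x → ∑ xs (λ i → w i · f i x))
Rep-∑ []       w []           = Rep-zero
Rep-∑ (i ∷ xs) w (rep ∷ reps) =
  Rep-cong (λ x → cong (w i · _ +_) (*-identityˡ _)) (Rep-linear (w i) 1ℚ rep (Rep-∑ xs w reps))

bit : ∀ {n} → Fin n → Subset n → ℚ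
bit i x = if lookup x i then 1ℚ else 0ℚ

Rep-bit* : ∀ {n d} {f : Subset n → ℚ} i → Rep d f → Rep (suc d) (λ x → bit i x · f x)
Rep-bit* {d = d} i (p , deg , evp) = mul i p , deg-mul i p d deg , λ x → trans (ev-mul i p x) (cong (bit i x ·_) (evp x))
  where
  mul : ∀ {n} → Fin n → Coeffs n → Coeffs n
  mul zero    p (outside ∷ I) = 0ℚ
  -- By idempotence of x₁, the terms with and without x₁ both land here.
  mul zero    p (inside ∷ I)  = lo p I + hi p I
  mul (suc i) p (outside ∷ I) = mul i (lo p) I
  mul (suc i) p (inside ∷ I)  = mul i (hi p) I
  deg-mul : ∀ {n} (i : Fin n) p d → Deg≤ d p → Deg≤ (suc d) (mul i p)
  deg-mul zero    p d       deg (outside ∷ I) d<I         = refl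
  deg-mul zero    p d       deg (inside ∷ I)  (ℕ.s≤s d<I) = cong₂ _+_ (deg (outside ∷ I) d<I) (deg (inside ∷ I) (ℕ.m<n⇒m<1+n d<I))
  deg-mul (suc i) p d       deg (outside ∷ I) d<I         = deg-mul i (lo p) d (λ J → deg (outside ∷ J)) I d<I
  deg-mul (suc i) p (suc d) deg (inside ∷ I)  (ℕ.s≤s d<I) = deg-mul i (hi p) d (λ J d<J → deg (inside ∷ J) (ℕ.s≤s d<J)) I d<I
  -- Here induction would call for degree -1; instead, all terms of `p` containing the first
  -- variable vanish.
  deg-mul (suc i) p zero    deg (inside ∷ I)  _           = mul-zero i (λ J → deg (inside ∷ J) (ℕ.s≤s ℕ.z≤n)) I
    where
    mul-zero : ∀ {n} (i : Fin n) {p : Coeffs n} → (∀ J → p J ≡ 0ℚ) → ∀ I → mul i p I ≡ 0ℚ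
    mul-zero zero    p≡0 (outside ∷ I) = refl
    mul-zero zero    p≡0 (inside ∷ I)  = cong₂ _+_ (p≡0 (outside ∷ I)) (p≡0 (inside ∷ I))
    mul-zero (suc i) p≡0 (outside ∷ I) = mul-zero i (λ J → p≡0 (outside ∷ J)) I
    mul-zero (suc i) p≡0 (inside ∷ I)  = mul-zero i (λ J → p≡0 (inside ∷ J)) I
  ev-mul : ∀ {n} (i : Fin n) p x → ev (mul i p) x ≡ bit i x · ev p x
  ev-mul zero    p (outside ∷ x) = trans (ev-zero x) (sym (*-zeroˡ (ev (lo p) x)))
  ev-mul zero    p (inside ∷ x)  = trans (cong₂ _+_ (ev-zero x) (ev-+ (lo p) (hi p) x))
    (solve 2 (λ a b → con 0ℚ :+ (a :+ b) := con 1ℚ :* (a :+ b)) refl (ev (lo p) x) (ev (hi p) x))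
  ev-mul (suc i) p (outside ∷ x) = ev-mul i (lo p) x
  ev-mul (suc i) p (inside ∷ x)  = trans (cong₂ _+_ (ev-mul i (lo p) x) (ev-mul i (hi p) x))
    (sym (*-distribˡ-+ (bit i x) (ev (lo p) x) (ev (hi p) x)))

-- The pseudo-expectation on functions of n bits

module PseudoExpectation (n : ℕ) where
  open Moments n
  private
    module P = Positivity {n} {n} ℕ.≤-refl κ moment moment-step moment-diff

  𝔼 : (Subset n → ℚ) → ℚ
  𝔼 = L moment

  𝔼-one : 𝔼 (λ _ → 1ℚ) ≡ 1ℚ
  𝔼-one = L-const1 {n} moment

  𝔼-square : ∀ {d f} → d ℕ.+ d ℕ.≤ n → Rep d f → 0ℚ ≤ 𝔼 (λ x → f x · f x)
  𝔼-square {d} 2d≤n (p , deg , evp) =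
    subst (0ℚ ≤_) (trans (sym (L-ev moment p p)) (L-cong moment (λ x → cong₂ _·_ (evp x) (evp x))))
      (P.B-nonneg d 2d≤n p deg)

  -- On coefficients, multiplication by the weight is `X`, and the form replaces it by κ = n/2. The
  -- bound is strict because the product reaches degree 2d + 1.
  𝔼-weight : ∀ {d f} → d ℕ.+ d ℕ.< n → Rep d f → 𝔼 (λ x → (ι ∣ x ∣ + ι ∣ x ∣ - ι n) · (f x · f x)) ≡ 0ℚ
  𝔼-weight {d} {f} 2d<n (p , deg , evp) = begin
    𝔼 (λ x → (ι ∣ x ∣ + ι ∣ x ∣ - ι n) · (f x · f x))
      ≡⟨ L-cong moment (λ x → solve 3 (λ m n f → (m :+ m :- n) :* (f :* f) := (con 1ℚ :+ con 1ℚ) :* (f :* (m :* f)) :+ (:- n) :* (f :* f)) refl (ι ∣ x ∣) (ι n) (f x)) ⟩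
    𝔼 (λ x → (1ℚ + 1ℚ) · (f x · (ι ∣ x ∣ · f x)) + (- ι n) · (f x · f x))
      ≡⟨ L-linear moment (1ℚ + 1ℚ) (- ι n) (λ x → f x · (ι ∣ x ∣ · f x)) (λ x → f x · f x) ⟩
    (1ℚ + 1ℚ) · 𝔼 (λ x → f x · (ι ∣ x ∣ · f x)) + (- ι n) · 𝔼 (λ x → f x · f x)
      ≡⟨ cong₂ (λ a b → (1ℚ + 1ℚ) · a + (- ι n) · b)
           (trans (L-cong moment (λ x → cong₂ _·_ (sym (evp x)) (trans (cong (ι ∣ x ∣ ·_) (sym (evp x))) (sym (ev-X p x))))) (L-ev moment p (X p)))
           (trans (L-cong moment (λ x → cong₂ _·_ (sym (evp x)) (sym (evp x)))) (L-ev moment p p)) ⟩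
    (1ℚ + 1ℚ) · B moment p (X p) + (- ι n) · b
      ≡⟨ cong₂ (λ a m → (1ℚ + 1ℚ) · a + (- m) · b) (P.B-X 2d<n deg deg) (sym κ+κ≡n) ⟩
    (1ℚ + 1ℚ) · (κ · b) + (- (κ + κ)) · b
      ≡⟨ solve 2 (λ k b → (con 1ℚ :+ con 1ℚ) :* (k :* b) :+ (:- (k :+ k)) :* b := con 0ℚ) refl κ b ⟩
    0ℚ ∎
    where
    open ≡-Reasoning
    b = B moment p p

-- Real numbers

seq-sumOver : ∀ {A : Set} (xs : List A) (f : A → ℝ) m → seq (sumOver xs f) m ≡ ∑ xs (λ a → seq (f a) m)
seq-sumOver []       f m = refl
seq-sumOver (a ∷ xs) f m = cong (seq (f a) m +_) (seq-sumOver xs f m)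

seq-𝟙 : ∀ {A : Set} (A? : Dec A) m → seq 𝟙[ A? ] m ≡ ind A?
seq-𝟙 (yes _) m = refl
seq-𝟙 (no _)  m = refl

≈ℝ-refl : ∀ x → x ≈ℝ x
≈ℝ-refl x ε 0<ε = 0 , λ m _ → subst (λ q → ℚ.∣ q ∣ ≤ ε) (sym (+-inverseʳ (seq x m))) (<⇒≤ 0<ε)

≤-eventually : ∀ x y N → (∀ m → N ℕ.≤ m → seq x m ≤ seq y m) → x ≤ℝ y
≤-eventually x y N x≤y ε 0<ε = N , λ m N≤m → ≤-trans (x≤y m N≤m)
  (subst (_≤ seq y m + ε) (+-identityʳ (seq y m)) (+-monoʳ-≤ (seq y m) (<⇒≤ 0<ε)))

≤-pointwise : ∀ x y → (∀ m → seq x m ≤ seq y m) → x ≤ℝ y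
≤-pointwise x y x≤y = ≤-eventually x y 0 (λ m _ → x≤y m)

-- Sum-of-Squares solutions from substituting idempotent polynomials for the variables

module Substitution {n V : ℕ} (0<n : 0 ℕ.< n) (val : Fin V → Subset n → ℚ)
  (val-idem : ∀ v x → val v x · val v x ≡ val v x)
  (val-Rep : ∀ v {d f} → Rep d f → Rep (suc d) (λ x → val v x · f x))
  where
  open PseudoExpectation n

  monomial : ∀ {V} → (Fin V → Subset n → ℚ) → Subset V → Subset n → ℚ
  monomial val []            x = 1ℚ
  monomial val (outside ∷ S) x = monomial (val ∘ suc) S x
  monomial val (inside ∷ S)  x = val zero x · monomial (val ∘ suc) S x

  φ : Subset V → Subset n → ℚ
  φ = monomial val

  monomial-⊥ : ∀ {V} (val : Fin V → Subset n → ℚ) x → monomial val ⊥ x ≡ 1ℚ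
  monomial-⊥ {zero}  val x = refl
  monomial-⊥ {suc V} val x = monomial-⊥ (val ∘ suc) x

  monomial-⁅⁆ : ∀ {V} (val : Fin V → Subset n → ℚ) v x → monomial val ⁅ v ⁆ x ≡ val v x
  monomial-⁅⁆ val zero    x = trans (cong (val zero x ·_) (monomial-⊥ (val ∘ suc) x)) (*-identityʳ (val zero x))
  monomial-⁅⁆ val (suc v) x = monomial-⁅⁆ (val ∘ suc) v x

  monomial-∪ : ∀ {V} (val : Fin V → Subset n → ℚ) → (∀ v x → val v x · val v x ≡ val v x) →
               ∀ I J x → monomial val (I ∪ J) x ≡ monomial val I x · monomial val J x
  monomial-∪ val idem []            []            x = refl
  monomial-∪ val idem (outside ∷ I) (outside ∷ J) x = monomial-∪ (val ∘ suc) (idem ∘ suc) I J x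
  monomial-∪ val idem (outside ∷ I) (inside ∷ J)  x = trans (cong (val zero x ·_) (monomial-∪ (val ∘ suc) (idem ∘ suc) I J x))
    (solve 3 (λ v a b → v :* (a :* b) := a :* (v :* b)) refl (val zero x) (monomial (val ∘ suc) I x) (monomial (val ∘ suc) J x))
  monomial-∪ val idem (inside ∷ I)  (outside ∷ J) x = trans (cong (val zero x ·_) (monomial-∪ (val ∘ suc) (idem ∘ suc) I J x))
    (sym (*-assoc (val zero x) (monomial (val ∘ suc) I x) (monomial (val ∘ suc) J x)))
  monomial-∪ val idem (inside ∷ I)  (inside ∷ J)  x = trans (cong₂ _·_ (sym (idem zero x)) (monomial-∪ (val ∘ suc) (idem ∘ suc) I J x))
    (solve 3 (λ v a b → (v :* v) :* (a :* b) := (v :* a) :* (v :* b)) refl (val zero x) (monomial (val ∘ suc) I x) (monomial (val ∘ suc) J x))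

  monomial-Rep : ∀ {V} (val : Fin V → Subset n → ℚ) → (∀ v {d f} → Rep d f → Rep (suc d) (λ x → val v x · f x)) →
                 ∀ S → Rep ∣ S ∣ (monomial val S)
  monomial-Rep val rep []            = Rep-one
  monomial-Rep val rep (outside ∷ S) = monomial-Rep (val ∘ suc) (λ v → rep (suc v)) S
  monomial-Rep val rep (inside ∷ S)  = rep zero (monomial-Rep (val ∘ suc) (λ v → rep (suc v)) S)

  φ-∪ : ∀ I J x → φ (I ∪ J) x ≡ φ I x · φ J x
  φ-∪ = monomial-∪ val val-idem

  φ-Rep : ∀ {d} S → ∣ S ∣ ℕ.≤ d → Rep d (φ S)
  φ-Rep S S≤d = Rep-weaken S≤d (monomial-Rep val val-Rep S)

  Y : Subset V → ℚ
  Y S = 𝔼 (φ S)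

  combination : List (Subset V) → (Subset V → ℚ) → Subset n → ℚ
  combination T w x = ∑ T (λ I → w I · φ I x)

  -- Idempotence of the substituted values makes `φ` multiplicative over unions, so the double sum
  -- is the expansion of a square.
  quadratic-form : ∀ (T : List (Subset V)) (w : Subset V → ℚ) (ψ : Subset n → ℚ) →
    ∑ T (λ I → ∑ T (λ J → w I · 𝔼 (λ x → ψ x · φ (I ∪ J) x) · w J))
    ≡ 𝔼 (λ x → ψ x · (combination T w x · combination T w x))
  quadratic-form T w ψ = sym (begin
    𝔼 (λ x → ψ x · (P x · P x))
      ≡⟨ L-cong moment pointwise ⟩
    𝔼 (λ x → ∑ T (λ I → ∑ T (λ J → (w I · w J) · (ψ x · φ (I ∪ J) x))))
      ≡⟨ L-∑ moment T (λ I x → ∑ T (λ J → (w I · w J) · (ψ x · φ (I ∪ J) x))) ⟩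
    ∑ T (λ I → 𝔼 (λ x → ∑ T (λ J → (w I · w J) · (ψ x · φ (I ∪ J) x))))
      ≡⟨ ∑-cong T (λ I → trans (L-∑ moment T (λ J x → (w I · w J) · (ψ x · φ (I ∪ J) x))) (∑-cong T (λ J →
           trans (L-*ˡ moment (w I · w J) (λ x → ψ x · φ (I ∪ J) x))
                 (solve 3 (λ a b e → (a :* b) :* e := a :* e :* b) refl (w I) (w J) (𝔼 (λ x → ψ x · φ (I ∪ J) x)))))) ⟩
    ∑ T (λ I → ∑ T (λ J → w I · 𝔼 (λ x → ψ x · φ (I ∪ J) x) · w J)) ∎)
    where
    open ≡-Reasoning
    open Moments n using (moment)
    P = combination T w
    pointwise : ∀ x → ψ x · (P x · P x) ≡ ∑ T (λ I → ∑ T (λ J → (w I · w J) · (ψ x · φ (I ∪ J) x)))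
    pointwise x = begin
      ψ x · (P x · P x)
        ≡⟨ cong (ψ x ·_) (∑-*ʳ T (P x) (λ I → w I · φ I x)) ⟨
      ψ x · ∑ T (λ I → w I · φ I x · P x)
        ≡⟨ ∑-*ˡ T (ψ x) (λ I → w I · φ I x · P x) ⟨
      ∑ T (λ I → ψ x · (w I · φ I x · P x))
        ≡⟨ ∑-cong T (λ I → trans (sym (*-assoc (ψ x) (w I · φ I x) (P x))) (trans
             (sym (∑-*ˡ T (ψ x · (w I · φ I x)) (λ J → w J · φ J x)))
             (∑-cong T (λ J → trans
               (solve 5 (λ s a b c d → s :* (a :* b) :* (c :* d) := (a :* c) :* (s :* (b :* d))) refl (ψ x) (w I) (φ I x) (w J) (φ J x))
               (cong (λ z → (w I · w J) · (ψ x · z)) (sym (φ-∪ I J x))))))) ⟩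
      ∑ T (λ I → ∑ T (λ J → (w I · w J) · (ψ x · φ (I ∪ J) x))) ∎

  -- Real operations act index by index, so a real weight vector is handled as one rational weight
  -- vector for each index. The factor `ψ` is 1 for the moment matrix and the substituted constraint
  -- for a localizing matrix.
  PSD-criterion : ∀ (T : List (Subset V)) (F : Subset V → ℝ) (ψ : Subset n → ℚ) →
    All (λ I → All (λ J → ∀ m → seq (F (I ∪ J)) m ≡ 𝔼 (λ x → ψ x · φ (I ∪ J) x)) T) T →
    (∀ w → 0ℚ ≤ 𝔼 (λ x → ψ x · (combination T w x · combination T w x))) →
    PSD T (MomentMatrix F)
  PSD-criterion T F ψ F≡ nonneg =
    All.universal (λ I → All.universal (λ J → subst (λ K → F (I ∪ J) ≈ℝ F K) (∪-comm I J) (≈ℝ-refl (F (I ∪ J)))) T) T ,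
    λ w → ≤-pointwise 0ℝ (sumOver T λ I → sumOver T λ J → w I *ℝ MomentMatrix F I J *ℝ w J) (λ m → subst (0ℚ ≤_) (sym (eq w m)) (nonneg (λ I → seq (w I) m)))
    where
    open ≡-Reasoning
    eq : ∀ (w : Subset V → ℝ) m →
         seq (sumOver T λ I → sumOver T λ J → w I *ℝ MomentMatrix F I J *ℝ w J) m
         ≡ 𝔼 (λ x → ψ x · (combination T (λ I → seq (w I) m) x · combination T (λ I → seq (w I) m) x))
    eq w m = begin
      seq (sumOver T λ I → sumOver T λ J → w I *ℝ MomentMatrix F I J *ℝ w J) m
        ≡⟨ seq-sumOver T (λ I → sumOver T λ J → w I *ℝ MomentMatrix F I J *ℝ w J) m ⟩
      ∑ T (λ I → seq (sumOver T λ J → w I *ℝ MomentMatrix F I J *ℝ w J) m)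
        ≡⟨ ∑-congᴬ (All.map (λ {I} F≡ᴵ → trans (seq-sumOver T (λ J → w I *ℝ MomentMatrix F I J *ℝ w J) m)
             (∑-congᴬ (All.map (λ {J} e → cong (λ z → seq (w I) m · z · seq (w J) m) (e m)) F≡ᴵ))) F≡) ⟩
      ∑ T (λ I → ∑ T (λ J → seq (w I) m · 𝔼 (λ x → ψ x · φ (I ∪ J) x) · seq (w J) m))
        ≡⟨ quadratic-form T (λ I → seq (w I) m) ψ ⟩
      𝔼 (λ x → ψ x · (combination T (λ I → seq (w I) m) x · combination T (λ I → seq (w I) m) x)) ∎

  -- On {0,1}ⁿ the substitution turns the constraint g into σ · (2∣x∣ − n).
  Balanced : Affine V → Set
  Balanced g = ∃ λ σ → ∀ m x →
    seq (Affine.constant g) m + ∑ (allFin V) (λ v → seq (Affine.coeff g v) m · val v x) ≡ σ · (ι ∣ x ∣ + ι ∣ x ∣ - ι n)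

  module _ (t : ℕ) (4t≤n : (t ℕ.+ t) ℕ.+ (t ℕ.+ t) ℕ.≤ n) where
    open Moments n using (moment)

    private
      2t≡ : 2 ℕ.* t ≡ t ℕ.+ t
      2t≡ = cong (t ℕ.+_) (ℕ.+-identityʳ t)

      y : 𝒫 (2 ℕ.* t) V → ℝ
      y (S , _) = fromℚ (Y S)

      ŷ : Subset V → ℝ
      ŷ = extend (2 ℕ.* t) y

      ŷ≡ : ∀ S → ∣ S ∣ ℕ.≤ t ℕ.+ t → ∀ m → seq (ŷ S) m ≡ Y S
      ŷ≡ S S≤2t m with ∣ S ∣ ℕ.≤? 2 ℕ.* t
      ... | yes _   = refl
      ... | no S≰2t = ⊥-elim (S≰2t (subst (∣ S ∣ ℕ.≤_) (sym 2t≡) S≤2t))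

      -- Being idempotent, the substituted monomial is its own square. Its degree can be 2t, so the
      -- square is controlled when 4t ≤ n.
      Y-nonneg : ∀ S → ∣ S ∣ ℕ.≤ t ℕ.+ t → 0ℚ ≤ Y S
      Y-nonneg S S≤2t = subst (0ℚ ≤_) (L-cong moment (λ x → φ-idem x)) (𝔼-square 4t≤n (φ-Rep S S≤2t))
        where
        φ-idem : ∀ x → φ S x · φ S x ≡ φ S x
        φ-idem x = trans (sym (φ-∪ S S x)) (cong (λ K → φ K x) (∪-idem S))

      -- The complement of an idempotent is idempotent, so 1 - φ S is a square as well.
      Y≤1 : ∀ S → ∣ S ∣ ℕ.≤ t ℕ.+ t → Y S ≤ 1ℚ
      Y≤1 S S≤2t = subst₂ _≤_ (+-identityʳ (Y S)) (solve 2 (λ a b → a :+ (b :- a) := b) refl (Y S) 1ℚ) (+-monoʳ-≤ (Y S) 0≤1-Y)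
        where
        open ≡-Reasoning
        f : Subset n → ℚ
        f x = 1ℚ · 1ℚ + (- 1ℚ) · φ S x
        f² : ∀ x → f x · f x ≡ f x
        f² x = begin
          f x · f x                                  ≡⟨ solve 1 (λ a → (con 1ℚ :* con 1ℚ :+ (:- con 1ℚ) :* a) :* (con 1ℚ :* con 1ℚ :+ (:- con 1ℚ) :* a)
                                                          := con 1ℚ :- a :- a :+ a :* a) refl (φ S x) ⟩
          1ℚ - φ S x - φ S x + φ S x · φ S x         ≡⟨ cong (1ℚ - φ S x - φ S x +_) (trans (sym (φ-∪ S S x)) (cong (λ K → φ K x) (∪-idem S))) ⟩
          1ℚ - φ S x - φ S x + φ S x                 ≡⟨ solve 1 (λ a → con 1ℚ :- a :- a :+ a := con 1ℚ :* con 1ℚ :+ (:- con 1ℚ) :* a) refl (φ S x) ⟩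
          f x                                        ∎
        0≤1-Y : 0ℚ ≤ 1ℚ - Y S
        0≤1-Y = subst (0ℚ ≤_) (begin
          𝔼 (λ x → f x · f x)                        ≡⟨ L-cong moment f² ⟩
          𝔼 f                                        ≡⟨ L-linear moment 1ℚ (- 1ℚ) (λ _ → 1ℚ) (φ S) ⟩
          1ℚ · 𝔼 (λ _ → 1ℚ) + (- 1ℚ) · Y S           ≡⟨ cong (λ e → 1ℚ · e + (- 1ℚ) · Y S) 𝔼-one ⟩
          1ℚ · 1ℚ + (- 1ℚ) · Y S                     ≡⟨ solve 1 (λ a → con 1ℚ :* con 1ℚ :+ (:- con 1ℚ) :* a := con 1ℚ :- a) refl (Y S) ⟩
          1ℚ - Y S                                   ∎)
          (𝔼-square 4t≤n (Rep-linear 1ℚ (- 1ℚ) Rep-one (φ-Rep S S≤2t)))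

      moment-PSD : PSD (subsets≤ t) (MomentMatrix ŷ)
      moment-PSD = PSD-criterion (subsets≤ t) ŷ (λ _ → 1ℚ)
        (All.map (λ {I} I≤t → All.map (λ {J} J≤t m → trans
          (ŷ≡ (I ∪ J) (ℕ.≤-trans (∣I∪J∣≤∣I∣+∣J∣ I J) (ℕ.+-mono-≤ I≤t J≤t)) m)
          (L-cong moment (λ x → sym (*-identityˡ (φ (I ∪ J) x))))) sizes) sizes)
        (λ w → subst (0ℚ ≤_) (L-cong moment (λ x → sym (*-identityˡ (combination (subsets≤ t) w x · combination (subsets≤ t) w x))))
          (𝔼-square (ℕ.≤-trans (ℕ.m≤m+n (t ℕ.+ t) (t ℕ.+ t)) 4t≤n)
            (Rep-∑ (subsets≤ t) w (All.map (λ {I} I≤t → φ-Rep I I≤t) sizes))))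
        where
        sizes : All (λ S → ∣ S ∣ ℕ.≤ t) (subsets≤ t)
        sizes = all-filter (λ S → ∣ S ∣ ℕ.≤? t) (allSubsets V)

      -- The coefficients of an affine form sit on the empty set and the singletons, so only unions
      -- of `K` with at most one more element occur. The size bound keeps these where `extend` does
      -- not cut off.
      ⋆≡ : ∀ g K m → suc ∣ K ∣ ℕ.≤ t ℕ.+ t → seq ((toPoly g ⋆ ŷ) K) m
           ≡ 𝔼 (λ x → (seq (Affine.constant g) m + ∑ (allFin V) (λ v → seq (Affine.coeff g v) m · val v x)) · φ K x)
      ⋆≡ (affine c a) K m 1+K≤2t = begin
        seq ((toPoly (affine c a) ⋆ ŷ) K) m
          ≡⟨ seq-sumOver (allSubsets V) (λ J → toPoly (affine c a) J *ℝ ŷ (K ∪ J)) m ⟩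
        ∑ˢ (λ J → (seq 𝟙[ J ≟ˢ ⊥ ] m · c′ + seq (sumOver (allFin V) (λ i → 𝟙[ J ≟ˢ ⁅ i ⁆ ] *ℝ a i)) m) · Z J)
          ≡⟨ ∑-cong (allSubsets V) (λ J → begin
               (seq 𝟙[ J ≟ˢ ⊥ ] m · c′ + seq (sumOver (allFin V) (λ i → 𝟙[ J ≟ˢ ⁅ i ⁆ ] *ℝ a i)) m) · Z J
                 ≡⟨ cong₂ (λ u v → (u · c′ + v) · Z J) (seq-𝟙 (J ≟ˢ ⊥) m)
                      (trans (seq-sumOver (allFin V) (λ i → 𝟙[ J ≟ˢ ⁅ i ⁆ ] *ℝ a i) m) (∑-cong (allFin V) (λ i → cong (_· a′ i) (seq-𝟙 (J ≟ˢ ⁅ i ⁆) m)))) ⟩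
               (ind (J ≟ˢ ⊥) · c′ + ∑ (allFin V) (λ i → ind (J ≟ˢ ⁅ i ⁆) · a′ i)) · Z J
                 ≡⟨ *-distribʳ-+ (Z J) (ind (J ≟ˢ ⊥) · c′) (∑ (allFin V) (λ i → ind (J ≟ˢ ⁅ i ⁆) · a′ i)) ⟩
               ind (J ≟ˢ ⊥) · c′ · Z J + ∑ (allFin V) (λ i → ind (J ≟ˢ ⁅ i ⁆) · a′ i) · Z J
                 ≡⟨ cong₂ _+_ (*-assoc (ind (J ≟ˢ ⊥)) c′ (Z J))
                      (trans (sym (∑-*ʳ (allFin V) (Z J) (λ i → ind (J ≟ˢ ⁅ i ⁆) · a′ i)))
                             (∑-cong (allFin V) (λ i → *-assoc (ind (J ≟ˢ ⁅ i ⁆)) (a′ i) (Z J)))) ⟩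
               ind (J ≟ˢ ⊥) · (c′ · Z J) + ∑ (allFin V) (λ i → ind (J ≟ˢ ⁅ i ⁆) · (a′ i · Z J)) ∎) ⟩
        ∑ˢ (λ J → ind (J ≟ˢ ⊥) · (c′ · Z J) + ∑ (allFin V) (λ i → ind (J ≟ˢ ⁅ i ⁆) · (a′ i · Z J)))
          ≡⟨ ∑-+ (allSubsets V) (λ J → ind (J ≟ˢ ⊥) · (c′ · Z J)) (λ J → ∑ (allFin V) (λ i → ind (J ≟ˢ ⁅ i ⁆) · (a′ i · Z J))) ⟩
        ∑ˢ (λ J → ind (J ≟ˢ ⊥) · (c′ · Z J)) + ∑ˢ (λ J → ∑ (allFin V) (λ i → ind (J ≟ˢ ⁅ i ⁆) · (a′ i · Z J)))
          ≡⟨ cong₂ _+_ (∑ˢ-δ ⊥ (λ J → c′ · Z J))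
               (trans (∑-swap (allSubsets V) (allFin V) (λ J i → ind (J ≟ˢ ⁅ i ⁆) · (a′ i · Z J)))
                      (∑-cong (allFin V) (λ i → ∑ˢ-δ ⁅ i ⁆ (λ J → a′ i · Z J)))) ⟩
        c′ · Z ⊥ + ∑ (allFin V) (λ i → a′ i · Z ⁅ i ⁆)
          ≡⟨ cong₂ _+_
               (cong (c′ ·_) (trans (ŷ≡ (K ∪ ⊥) (size ⊥ (subst (ℕ._≤ 1) (sym (∣⊥∣≡0 V)) ℕ.z≤n)) m)
                 (L-cong moment (λ x → trans (φ-∪ K ⊥ x) (trans (cong (φ K x ·_) (monomial-⊥ val x)) (*-identityʳ (φ K x)))))))
               (∑-cong (allFin V) (λ i → cong (a′ i ·_) (trans (ŷ≡ (K ∪ ⁅ i ⁆) (size ⁅ i ⁆ (ℕ.≤-reflexive (∣⁅x⁆∣≡1 i))) m)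
                 (L-cong moment (λ x → trans (φ-∪ K ⁅ i ⁆ x) (trans (cong (φ K x ·_) (monomial-⁅⁆ val i x)) (*-comm (φ K x) (val i x)))))))) ⟩
        c′ · 𝔼 (φ K) + ∑ (allFin V) (λ i → a′ i · 𝔼 (λ x → val i x · φ K x))
          ≡⟨ cong₂ _+_ (L-*ˡ moment c′ (φ K)) (trans (L-∑ moment (allFin V) (λ i x → a′ i · (val i x · φ K x)))
               (∑-cong (allFin V) (λ i → L-*ˡ moment (a′ i) (λ x → val i x · φ K x)))) ⟨
        𝔼 (λ x → c′ · φ K x) + 𝔼 (λ x → ∑ (allFin V) (λ i → a′ i · (val i x · φ K x)))
          ≡⟨ L-+ moment (λ x → c′ · φ K x) (λ x → ∑ (allFin V) (λ i → a′ i · (val i x · φ K x))) ⟨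
        𝔼 (λ x → c′ · φ K x + ∑ (allFin V) (λ i → a′ i · (val i x · φ K x)))
          ≡⟨ L-cong moment (λ x → trans (cong (c′ · φ K x +_) (trans (∑-cong (allFin V) (λ i → sym (*-assoc (a′ i) (val i x) (φ K x))))
               (∑-*ʳ (allFin V) (φ K x) (λ i → a′ i · val i x))))
               (sym (*-distribʳ-+ (φ K x) c′ (∑ (allFin V) (λ i → a′ i · val i x))))) ⟩
        𝔼 (λ x → (c′ + ∑ (allFin V) (λ i → a′ i · val i x)) · φ K x) ∎
        where
        open ≡-Reasoning
        c′ : ℚ
        c′ = seq c m
        a′ : Fin V → ℚ
        a′ i = seq (a i) m
        Z : Subset V → ℚ
        Z J = seq (ŷ (K ∪ J)) m
        size : ∀ J → ∣ J ∣ ℕ.≤ 1 → ∣ K ∪ J ∣ ℕ.≤ t ℕ.+ t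
        size J J≤1 = ℕ.≤-trans (∣I∪J∣≤∣I∣+∣J∣ K J)
          (ℕ.≤-trans (ℕ.+-monoʳ-≤ ∣ K ∣ J≤1) (subst (ℕ._≤ t ℕ.+ t) (sym (ℕ.+-comm ∣ K ∣ 1)) 1+K≤2t))

      -- The quadratic form is identically 0: it is σ times the pseudo-expectation of 2∣x∣ - n
      -- against a square.
      constraint-PSD : ∀ {g} → Balanced g → PSD (subsets< t) (MomentMatrix (toPoly g ⋆ ŷ))
      constraint-PSD {g} (σ , bal) = PSD-criterion (subsets< t) (toPoly g ⋆ ŷ) (λ x → σ · W x)
        (All.map (λ {I} I<t → All.map (λ {J} J<t m → trans
          (⋆≡ g (I ∪ J) m (ℕ.≤-trans (ℕ.s≤s (∣I∪J∣≤∣I∣+∣J∣ I J)) (ℕ.+-mono-≤ I<t (ℕ.<⇒≤ J<t))))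
          (L-cong moment (λ x → cong (_· φ (I ∪ J) x) (bal m x)))) sizes) sizes)
        (λ w → ≤-reflexive (sym (trans
          (L-cong moment (λ x → *-assoc σ (W x) (combination (subsets< t) w x · combination (subsets< t) w x)))
          (trans (L-*ˡ moment σ (λ x → W x · (combination (subsets< t) w x · combination (subsets< t) w x)))
            (trans (cong (σ ·_) (𝔼-weight (low t 4t≤n)
              (Rep-∑ (subsets< t) w (All.map (λ {I} I<t → φ-Rep I (ℕ.<⇒≤pred I<t)) sizes))))
              (*-zeroʳ σ))))))
        where
        W : Subset n → ℚ
        W x = ι ∣ x ∣ + ι ∣ x ∣ - ι n
        sizes : All (λ S → ∣ S ∣ ℕ.< t) (subsets< t)
        sizes = all-filter (λ S → ∣ S ∣ ℕ.<? t) (allSubsets V)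
        low : ∀ t → (t ℕ.+ t) ℕ.+ (t ℕ.+ t) ℕ.≤ n → ℕ.pred t ℕ.+ ℕ.pred t ℕ.< n
        -- For t = 0 the truncated degree bound t - 1 is 0, so the strict inequality comes from n >
        -- 0.
        low zero    _    = 0<n
        low (suc s) 4t≤n = ℕ.<-≤-trans (ℕ.+-mono-< (ℕ.n<1+n s) (ℕ.n<1+n s)) (ℕ.≤-trans (ℕ.m≤m+n (suc s ℕ.+ suc s) (suc s ℕ.+ suc s)) 4t≤n)

    SoS-feasible : ∀ {K : Polytope V} → All Balanced K → SoSNonempty t K
    SoS-feasible balanced = y ,
      (λ { (S , S≤2t) → ≤-pointwise 0ℝ (fromℚ (Y S)) (λ _ → Y-nonneg S (subst (∣ S ∣ ℕ.≤_) 2t≡ S≤2t)) ,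
                        ≤-pointwise (fromℚ (Y S)) 1ℝ (λ _ → Y≤1 S (subst (∣ S ∣ ℕ.≤_) 2t≡ S≤2t)) }) ,
      (λ ε 0<ε → 0 , λ m _ → subst (λ q → ℚ.∣ q - 1ℚ ∣ ≤ ε) (sym (ŷ⊥≡1 m)) (<⇒≤ 0<ε)) ,
      moment-PSD ,
      All.map constraint-PSD balanced
      where
      ŷ⊥≡1 : ∀ m → seq (ŷ ⊥) m ≡ 1ℚ
      ŷ⊥≡1 m = trans (ŷ≡ ⊥ (subst (ℕ._≤ t ℕ.+ t) (sym (∣⊥∣≡0 V)) ℕ.z≤n) m)
                     (trans (L-cong moment (λ x → monomial-⊥ val x)) 𝔼-one)

module ℚΣ = Algebra.Properties.Semiring.Sum (Ring.semiring +-*-ring)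
module ℕΣ = Algebra.Properties.Semiring.Sum ℕ.+-*-semiring
open ℚΣ using () renaming (sum to sumℚ)
open ℕΣ using () renaming (sum to sumℕ)

-- Sums over Fin

module Splitting (M : CommutativeMonoid 0ℓ 0ℓ) where
  private module M = CommutativeMonoid M
  open Algebra.Properties.CommutativeMonoid.Sum M using (sum)

  sum-++ : ∀ m {k} (f : Fin (m ℕ.+ k) → M.Carrier) →
           sum f M.≈ (sum (λ i → f (i ↑ˡ k)) M.∙ sum (λ j → f (m ↑ʳ j)))
  sum-++ zero    f = M.sym (M.identityˡ (sum f))
  sum-++ (suc m) f = M.trans (M.∙-congˡ (sum-++ m (f ∘ suc))) (M.sym (M.assoc _ _ _))

  sum-combine : ∀ m k (f : Fin (m ℕ.* k) → M.Carrier) →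
                sum f M.≈ sum (λ a → sum (λ i → f (combine {m} a i)))
  sum-combine zero    k f = M.refl
  sum-combine (suc m) k f = M.trans (sum-++ k f) (M.∙-congˡ (sum-combine m k (λ j → f (k ↑ʳ j))))

open Splitting +-0-commutativeMonoid using () renaming (sum-++ to sumℚ-++; sum-combine to sumℚ-combine)
open Splitting ℕ.+-0-commutativeMonoid using () renaming (sum-combine to sumℕ-combine)

∑-allFin : ∀ {V} (f : Fin V → ℚ) → ∑ (allFin V) f ≡ sumℚ f
∑-allFin {V} f = trans (cong (List.foldr _+_ 0ℚ) (map-tabulate id f)) (go f)
  where
  go : ∀ {V} (f : Fin V → ℚ) → List.foldr _+_ 0ℚ (List.tabulate f) ≡ sumℚ f
  go {zero}  f = refl
  go {suc V} f = cong (f zero +_) (go (f ∘ suc))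

sumℚ-δ : ∀ {V} (j : Fin V) (f : Fin V → ℚ) → sumℚ (λ i → ind (i Fin.≟ j) · f i) ≡ f j
sumℚ-δ {suc V} zero f = trans (cong₂ _+_ (*-identityˡ (f zero))
  (trans (ℚΣ.sum-cong-≗ (λ i → *-zeroˡ (f (suc i)))) (ℚΣ.sum-replicate-zero V))) (+-identityʳ (f zero))
sumℚ-δ {suc V} (suc j) f = trans (cong₂ _+_ (*-zeroˡ (f zero))
  (trans (ℚΣ.sum-cong-≗ (λ i → cong (_· f (suc i)) (ind-cong (suc i Fin.≟ suc j) (i Fin.≟ j) Fin.suc-injective (cong suc))))
         (sumℚ-δ j (f ∘ suc)))) (+-identityˡ (f (suc j)))

sumℕ-mono : ∀ {N} {f g : Fin N → ℕ} → (∀ i → f i ℕ.≤ g i) → sumℕ f ℕ.≤ sumℕ g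
sumℕ-mono {zero}  f≤g = ℕ.z≤n
sumℕ-mono {suc N} f≤g = ℕ.+-mono-≤ (f≤g zero) (sumℕ-mono (f≤g ∘ suc))

term≤sumℕ : ∀ {N} (f : Fin N → ℕ) i → f i ℕ.≤ sumℕ f
term≤sumℕ f zero    = ℕ.m≤m+n (f zero) (sumℕ (f ∘ suc))
term≤sumℕ f (suc i) = ℕ.m≤n⇒m≤o+n (f zero) (term≤sumℕ (f ∘ suc) i)

sumℕ-const : ∀ n c → sumℕ {n} (λ _ → c) ≡ n ℕ.* c
sumℕ-const zero    c = refl
sumℕ-const (suc n) c = cong (c ℕ.+_) (sumℕ-const n c)

boolℕ : Bool → ℕ
boolℕ b = if b then 1 else 0

boolℚ : Bool → ℚ
boolℚ b = if b then 1ℚ else 0ℚ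

∣S∣≡sum : ∀ {N} (S : Subset N) → ∣ S ∣ ≡ sumℕ (λ p → boolℕ (lookup S p))
∣S∣≡sum []            = refl
∣S∣≡sum (outside ∷ S) = ∣S∣≡sum S
∣S∣≡sum (inside ∷ S)  = cong suc (∣S∣≡sum S)

ind-∈ : ∀ {N} p (S : Subset N) → ind (p ∈? S) ≡ boolℚ (lookup S p)
ind-∈ p S with lookup S p in eq
... | true  = ind-yes (p ∈? S) (lookup⇒[]= p S eq)
... | false = ind-no (p ∈? S) (λ p∈S → Bool.not-¬ (trans (sym ([]=⇒lookup p∈S)) eq) refl)

-- The eight points of a gadget: two clusters of four points, with three, respectively one, red points,
-- and one possible center each.

isA isRed isCenter : Fin 8 → Bool
isA 0F = true
isA 1F = true
isA 2F = true
isA 3F = true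
isA _  = false
isRed 0F = true
isRed 1F = true
isRed 2F = true
isRed 4F = true
isRed _  = false
isCenter 0F = true
isCenter 4F = true
isCenter _  = false

-- Clusters and the counting of covered points

module Gadgets (n : ℕ) where

  part : Fin (8 ℕ.* n) → Fin 8
  part p = proj₁ (remQuot {8} n p)

  index : Fin (8 ℕ.* n) → Fin n
  index p = proj₂ (remQuot {8} n p)

  cluster : Fin (8 ℕ.* n) → Bool × Fin n
  cluster p = isA (part p) , index p

  cluster? : ∀ p q → Dec (cluster p ≡ cluster q)
  cluster? p q = Product.≡-dec Bool._≟_ Fin._≟_ (cluster p) (cluster q)

  point : Fin 8 → Fin n → Fin (8 ℕ.* n)
  point = combine {8} {n}

  part-point : ∀ a i → part (point a i) ≡ a
  part-point a i = cong proj₁ (Fin.remQuot-combine {8} {n} a i)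

  index-point : ∀ a i → index (point a i) ≡ i
  index-point a i = cong proj₂ (Fin.remQuot-combine {8} {n} a i)

  point-part-index : ∀ p → point (part p) (index p) ≡ p
  point-part-index = Fin.combine-remQuot {8} n

  Red : Subset (8 ℕ.* n)
  Red = Vec.tabulate (isRed ∘ part)

  lookup-Red : ∀ p → lookup Red p ≡ isRed (part p)
  lookup-Red = lookup∘tabulate (isRed ∘ part)

  lookup-∁Red : ∀ p → lookup (∁ Red) p ≡ not (isRed (part p))
  lookup-∁Red p = trans (lookup-map p not Red) (cong not (lookup-Red p))

  mass : Subset (8 ℕ.* n) → Bool → Fin n → ℕ
  mass C b i = sumℕ (λ a → boolℕ (does (isA a Bool.≟ b)) ℕ.* boolℕ (lookup C (point a i)))

  total : Subset (8 ℕ.* n) → Bool → ℕ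
  total C b = sumℕ (mass C b)

  total≡∣C∣ : ∀ C → total C true ℕ.+ total C false ≡ ∣ C ∣
  total≡∣C∣ C = begin
    total C true ℕ.+ total C false                              ≡⟨ ℕΣ.∑-distrib-+ (mass C true) (mass C false) ⟨
    sumℕ (λ i → mass C true i ℕ.+ mass C false i)               ≡⟨ ℕΣ.sum-cong-≗ (λ i → trans
      (sym (ℕΣ.∑-distrib-+ (λ a → boolℕ (does (isA a Bool.≟ true)) ℕ.* χ a i) (λ a → boolℕ (does (isA a Bool.≟ false)) ℕ.* χ a i)))
      (ℕΣ.sum-cong-≗ (λ a → each (isA a) (χ a i)))) ⟩
    sumℕ (λ i → sumℕ (λ a → χ a i))                             ≡⟨ ℕΣ.∑-comm (λ i a → χ a i) ⟩
    sumℕ (λ a → sumℕ (λ i → χ a i))                             ≡⟨ sumℕ-combine 8 n (λ p → boolℕ (lookup C p)) ⟨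
    sumℕ (λ p → boolℕ (lookup C p))                             ≡⟨ ∣S∣≡sum C ⟨
    ∣ C ∣                                                       ∎
    where
    open ≡-Reasoning
    χ : Fin 8 → Fin n → ℕ
    χ a i = boolℕ (lookup C (point a i))
    each : ∀ b k → boolℕ (does (b Bool.≟ true)) ℕ.* k ℕ.+ boolℕ (does (b Bool.≟ false)) ℕ.* k ≡ k
    each true  k = trans (ℕ.+-identityʳ (k ℕ.+ 0)) (ℕ.+-identityʳ k)
    each false k = ℕ.+-identityʳ k

  -- A covered point needs a point of `C` in its own cluster, so the 0-1 indicator of being covered
  -- is at most the number of points of `C` there; the sum over gadgets then depends only on the
  -- cluster type.
  coverage-bound : ∀ (S C : Subset (8 ℕ.* n)) (color : Fin 8 → Bool) →
    (∀ p → p ∈ S → color (part p) ≡ true × ∃ λ c → c ∈ C × cluster c ≡ cluster p) →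
    ∣ S ∣ ℕ.≤ sumℕ (λ a → boolℕ (color a) ℕ.* total C (isA a))
  coverage-bound S C color cov = begin
    ∣ S ∣                                                               ≡⟨ ∣S∣≡sum S ⟩
    sumℕ (λ p → boolℕ (lookup S p))                                     ≡⟨ sumℕ-combine 8 n (λ p → boolℕ (lookup S p)) ⟩
    sumℕ (λ a → sumℕ (λ i → boolℕ (lookup S (point a i))))              ≤⟨ sumℕ-mono (λ a → sumℕ-mono (λ i → bound a i (lookup S (point a i)) refl)) ⟩
    sumℕ (λ a → sumℕ (λ i → boolℕ (color a) ℕ.* mass C (isA a) i))      ≡⟨ ℕΣ.sum-cong-≗ (λ a → sym (ℕΣ.*-distribˡ-sum (boolℕ (color a)) (mass C (isA a)))) ⟩
    sumℕ (λ a → boolℕ (color a) ℕ.* total C (isA a))                    ∎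
    where
    open ℕ.≤-Reasoning
    bound : ∀ a i s → lookup S (point a i) ≡ s → boolℕ s ℕ.≤ boolℕ (color a) ℕ.* mass C (isA a) i
    bound a i false _  = ℕ.z≤n
    bound a i true  eq = hit (cov (point a i) (lookup⇒[]= (point a i) S eq))
      where
      does-true : ∀ {P : Set} (P? : Dec P) → P → does P? ≡ true
      does-true (yes _) _ = refl
      does-true (no ¬p) p = ⊥-elim (¬p p)
      hit : color (part (point a i)) ≡ true × (∃ λ c → c ∈ C × cluster c ≡ cluster (point a i)) →
            1 ℕ.≤ boolℕ (color a) ℕ.* mass C (isA a) i
      hit (colored , c , c∈C , same) = begin
        1                                          ≡⟨ cong boolℕ (trans (cong (lookup C) c≡) ([]=⇒lookup c∈C)) ⟨
        χ                                          ≡⟨ ℕ.+-identityʳ χ ⟨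
        1 ℕ.* χ                                    ≡⟨ cong (λ b → boolℕ b ℕ.* χ) (does-true (isA (part c) Bool.≟ isA a) A≡) ⟨
        boolℕ (does (isA (part c) Bool.≟ isA a)) ℕ.* χ
          ≤⟨ term≤sumℕ (λ a′ → boolℕ (does (isA a′ Bool.≟ isA a)) ℕ.* boolℕ (lookup C (point a′ i))) (part c) ⟩
        mass C (isA a) i                           ≡⟨ ℕ.+-identityʳ _ ⟨
        1 ℕ.* mass C (isA a) i                     ≡⟨ cong (λ b → boolℕ b ℕ.* mass C (isA a) i) (trans (cong color (sym (part-point a i))) colored) ⟨
        boolℕ (color a) ℕ.* mass C (isA a) i       ∎
        where
        χ : ℕ
        χ = boolℕ (lookup C (point (part c) i))
        A≡ : isA (part c) ≡ isA a
        A≡ = trans (cong proj₁ same) (cong isA (part-point a i))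
        c≡ : point (part c) i ≡ c
        c≡ = trans (cong (point (part c)) (sym (trans (cong proj₂ same) (index-point a i)))) (point-part-index c)

  Clustered : Subset (8 ℕ.* n) → Subset (8 ℕ.* n) → Set
  Clustered C S = ∀ p → p ∈ S → ∃ λ c → c ∈ C × cluster c ≡ cluster p

  -- The constraints 3a + b ≥ 2n, a + 3b ≥ 2n and a + b ≤ n force 2a = n.
  no-clustered-solution : ¬ (2 ∣ n) → ∀ C S T → ∣ C ∣ ℕ.≤ n → 2 ℕ.* n ℕ.≤ ∣ S ∣ → 2 ℕ.* n ℕ.≤ ∣ T ∣ →
    (∀ p → p ∈ S → p ∈ Red) → (∀ p → p ∈ T → p ∈ ∁ Red) → ¬ (Clustered C S × Clustered C T)
  no-clustered-solution odd C S T C≤n 2n≤S 2n≤T S⊆R T⊆B (clS , clT) = odd (divides a (trans (ℕ.≤-antisym n≤2a 2a≤n) (ℕ.*-comm 2 a)))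
    where
    open ℕ.≤-Reasoning
    open Data.Nat.Solver.+-*-Solver using () renaming (solve to solveℕ; _:=_ to _≔_; _:+_ to _⊕_; _:*_ to _⊛_; con to conℕ)
    a b : ℕ
    a = total C true
    b = total C false
    a+b≤n : a ℕ.+ b ℕ.≤ n
    a+b≤n = subst (ℕ._≤ n) (sym (total≡∣C∣ C)) C≤n
    red-count : 2 ℕ.* n ℕ.≤ (a ℕ.+ b) ℕ.+ 2 ℕ.* a
    red-count = begin
      2 ℕ.* n                   ≤⟨ 2n≤S ⟩
      ∣ S ∣                     ≤⟨ coverage-bound S C isRed (λ p p∈S → trans (sym (lookup-Red p)) ([]=⇒lookup (S⊆R p p∈S)) , clS p p∈S) ⟩
      -- The eight summands are the unfolded sum over the parts of a gadget. Splitting off a + b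
      -- lets the bound on the number of centers cancel one n.
      _                         ≡⟨ solveℕ 2 (λ a b → conℕ 1 ⊛ a ⊕ (conℕ 1 ⊛ a ⊕ (conℕ 1 ⊛ a ⊕ (conℕ 0 ⊛ a ⊕ (conℕ 1 ⊛ b ⊕ (conℕ 0 ⊛ b ⊕ (conℕ 0 ⊛ b ⊕ (conℕ 0 ⊛ b ⊕ conℕ 0)))))))
                                     ≔ (a ⊕ b) ⊕ conℕ 2 ⊛ a) refl a b ⟩
      (a ℕ.+ b) ℕ.+ 2 ℕ.* a     ∎
    blue-count : 2 ℕ.* n ℕ.≤ (a ℕ.+ b) ℕ.+ 2 ℕ.* b
    blue-count = begin
      2 ℕ.* n                   ≤⟨ 2n≤T ⟩
      ∣ T ∣                     ≤⟨ coverage-bound T C (not ∘ isRed) (λ p p∈T → trans (sym (lookup-∁Red p)) ([]=⇒lookup (T⊆B p p∈T)) , clT p p∈T) ⟩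
      _                         ≡⟨ solveℕ 2 (λ a b → conℕ 0 ⊛ a ⊕ (conℕ 0 ⊛ a ⊕ (conℕ 0 ⊛ a ⊕ (conℕ 1 ⊛ a ⊕ (conℕ 0 ⊛ b ⊕ (conℕ 1 ⊛ b ⊕ (conℕ 1 ⊛ b ⊕ (conℕ 1 ⊛ b ⊕ conℕ 0)))))))
                                     ≔ (a ⊕ b) ⊕ conℕ 2 ⊛ b) refl a b ⟩
      (a ℕ.+ b) ℕ.+ 2 ℕ.* b     ∎
    half : ∀ c → 2 ℕ.* n ℕ.≤ (a ℕ.+ b) ℕ.+ c → n ℕ.≤ c
    half c le = ℕ.+-cancelˡ-≤ n n c (begin
      n ℕ.+ n                   ≡⟨ cong (n ℕ.+_) (ℕ.+-identityʳ n) ⟨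
      2 ℕ.* n                   ≤⟨ le ⟩
      (a ℕ.+ b) ℕ.+ c           ≤⟨ ℕ.+-monoˡ-≤ c a+b≤n ⟩
      n ℕ.+ c                   ∎)
    n≤2a : n ℕ.≤ 2 ℕ.* a
    n≤2a = half (2 ℕ.* a) red-count
    2a≤n : 2 ℕ.* a ℕ.≤ n
    2a≤n = ℕ.+-cancelʳ-≤ n (2 ℕ.* a) n (begin
      2 ℕ.* a ℕ.+ n             ≤⟨ ℕ.+-monoʳ-≤ (2 ℕ.* a) (half (2 ℕ.* b) blue-count) ⟩
      2 ℕ.* a ℕ.+ 2 ℕ.* b       ≡⟨ ℕ.*-distribˡ-+ 2 a b ⟨
      2 ℕ.* (a ℕ.+ b)           ≤⟨ ℕ.*-monoʳ-≤ 2 a+b≤n ⟩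
      2 ℕ.* n                   ≡⟨ cong (n ℕ.+_) (ℕ.+-identityʳ n) ⟩
      n ℕ.+ n                   ∎)

  color-count : ∀ (S : Subset (8 ℕ.* n)) (color : Fin 8 → Bool) → (∀ p → lookup S p ≡ color (part p)) →
                ∣ S ∣ ≡ n ℕ.* sumℕ (boolℕ ∘ color)
  color-count S color S≡ = begin
    ∣ S ∣                                                     ≡⟨ ∣S∣≡sum S ⟩
    sumℕ (λ p → boolℕ (lookup S p))                           ≡⟨ sumℕ-combine 8 n (λ p → boolℕ (lookup S p)) ⟩
    sumℕ (λ a → sumℕ (λ i → boolℕ (lookup S (point a i))))    ≡⟨ ℕΣ.sum-cong-≗ (λ a → trans
      (ℕΣ.sum-cong-≗ (λ i → cong boolℕ (trans (S≡ (point a i)) (cong color (part-point a i)))))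
      (sumℕ-const n (boolℕ (color a)))) ⟩
    sumℕ (λ a → n ℕ.* boolℕ (color a))                        ≡⟨ ℕΣ.*-distribˡ-sum n (boolℕ ∘ color) ⟨
    n ℕ.* sumℕ (boolℕ ∘ color)                                ∎
    where open ≡-Reasoning

  2n≤∣Red∣ : 2 ℕ.* n ℕ.≤ ∣ Red ∣
  2n≤∣Red∣ = subst₂ ℕ._≤_ (ℕ.*-comm n 2) (sym (color-count Red isRed lookup-Red)) (ℕ.*-monoʳ-≤ n (ℕ.s≤s (ℕ.s≤s ℕ.z≤n)))

  2n≤∣∁Red∣ : 2 ℕ.* n ℕ.≤ ∣ ∁ Red ∣
  2n≤∣∁Red∣ = subst₂ ℕ._≤_ (ℕ.*-comm n 2) (sym (color-count (∁ Red) (not ∘ isRed) lookup-∁Red)) (ℕ.*-monoʳ-≤ n (ℕ.s≤s (ℕ.s≤s ℕ.z≤n)))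

-- The radius cannot be compared with the distance bound by case distinction on reals. A finite
-- search replaces it, with Q the desired inequality.
all-or : ∀ {N} {P : Fin N → Set} {Q : Set} → (∀ i → P i ⊎ Q) → (∀ i → P i) ⊎ Q
all-or {zero}  f = inj₁ (λ ())
all-or {suc N} f with f zero | all-or (f ∘ suc)
... | inj₂ q | _      = inj₂ q
... | _      | inj₂ q = inj₂ q
... | inj₁ p | inj₁ g = inj₁ (λ { zero → p ; (suc i) → g i })

-- The bit string x selects cluster A of gadget i when bit i is set, and cluster B otherwise

lit : ∀ {n} → Bool → Fin n → Subset n → ℚ
lit b i x = if b then bit i x else 1ℚ - bit i x

lit-idem : ∀ {n} b (i : Fin n) x → lit b i x · lit b i x ≡ lit b i x
lit-idem true  i x with lookup x i
... | true  = refl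
... | false = refl
lit-idem false i x with lookup x i
... | true  = refl
... | false = refl

lit-Rep : ∀ {n d} {f : Subset n → ℚ} b i → Rep d f → Rep (suc d) (λ x → lit b i x · f x)
lit-Rep         true  i rep = Rep-bit* i rep
lit-Rep {f = f} false i rep = Rep-cong
  (λ x → solve 2 (λ b f → con 1ℚ :* f :+ (:- con 1ℚ) :* (b :* f) := (con 1ℚ :- b) :* f) refl (bit i x) (f x))
  (Rep-linear 1ℚ (- 1ℚ) (Rep-weaken (ℕ.n≤1+n _) rep) (Rep-bit* i rep))

litSum : ∀ {n} → Bool → Subset n → ℚ
litSum {n} b x = if b then ι ∣ x ∣ else ι n - ι ∣ x ∣

sum-lit : ∀ {n} b (x : Subset n) → sumℚ (λ i → lit b i x) ≡ litSum b x
sum-lit true  []            = refl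
sum-lit true  (outside ∷ x) = trans (+-identityˡ _) (sum-lit true x)
sum-lit true  (inside ∷ x)  = trans (cong (1ℚ +_) (sum-lit true x)) (sym (ι-suc ∣ x ∣))
sum-lit false []            = refl
sum-lit {suc n} false (outside ∷ x) = trans (cong (1ℚ - 0ℚ +_) (sum-lit false x))
  (trans (solve 2 (λ n w → con 1ℚ :- con 0ℚ :+ (n :- w) := (con 1ℚ :+ n) :- w) refl (ι n) (ι ∣ x ∣)) (cong (_- ι ∣ x ∣) (sym (ι-suc n))))
sum-lit {suc n} false (inside ∷ x)  = trans (cong (1ℚ - 1ℚ +_) (sum-lit false x))
  (trans (solve 2 (λ n w → con 1ℚ :- con 1ℚ :+ (n :- w) := (con 1ℚ :+ n) :- (con 1ℚ :+ w)) refl (ι n) (ι ∣ x ∣))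
         (cong₂ _-_ (sym (ι-suc n)) (sym (ι-suc ∣ x ∣))))

sum-litSum : ∀ {n} (u : Fin 8 → ℚ) (x : Subset n) → sumℚ (λ a → u a · litSum (isA a) x)
             ≡ (u 0F + u 1F + u 2F + u 3F) · ι ∣ x ∣ + (u 4F + u 5F + u 6F + u 7F) · (ι n - ι ∣ x ∣)
sum-litSum {n} u x = solve 10
  (λ a b c d e f g h w v → a :* w :+ (b :* w :+ (c :* w :+ (d :* w :+ (e :* v :+ (f :* v :+ (g :* v :+ (h :* v :+ con 0ℚ)))))))
     := (a :+ b :+ c :+ d) :* w :+ (e :+ f :+ g :+ h) :* v)
  refl (u 0F) (u 1F) (u 2F) (u 3F) (u 4F) (u 5F) (u 6F) (u 7F) (ι ∣ x ∣) (ι n - ι ∣ x ∣)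

-- The metric, the instance and the feasibility of its relaxation

module Construction (n : ℕ) (D : ℝ) (1<D : 1ℝ <ℝ D) where
  open Gadgets n

  private
    N : ℕ
    N = 8 ℕ.* n

    -- From this index on the approximations of `D` are at least 1, so every metric inequality can
    -- be checked on rationals, index by index.
    N₀ : ℕ
    N₀ = proj₁ (proj₂ (proj₂ 1<D))

    1≤D : ∀ m → N₀ ℕ.≤ m → 1ℚ ≤ seq D m
    1≤D m N₀≤m = ≤-trans (subst (_≤ 1ℚ + ε) (+-identityʳ 1ℚ) (+-monoʳ-≤ 1ℚ (<⇒≤ (proj₁ (proj₂ 1<D)))))
                         (proj₂ (proj₂ (proj₂ 1<D)) m N₀≤m)
      where ε = proj₁ 1<D

    0≤1 : 0ℚ ≤ 1ℚ
    0≤1 = nonNegative⁻¹ 1ℚ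

  dist : ∀ {P Q : Set} → Dec P → Dec Q → ℝ
  dist (yes _) _       = 0ℝ
  dist (no _)  (yes _) = 1ℝ
  dist (no _)  (no _)  = D

  d : Fin N → Fin N → ℝ
  d p q = dist (p Fin.≟ q) (cluster? p q)

  -- Gives the distance by propositional equality with one of three fixed reals, so that its
  -- approximations can be rewritten at any index.
  data View (p q : Fin N) : Set where
    equal : p ≡ q → d p q ≡ 0ℝ → View p q
    near  : p ≢ q → cluster p ≡ cluster q → d p q ≡ 1ℝ → View p q
    far   : p ≢ q → cluster p ≢ cluster q → d p q ≡ D → View p q

  view : ∀ p q → View p q
  view p q = go (p Fin.≟ q) (cluster? p q) refl
    where
    go : (P? : Dec (p ≡ q)) (Q? : Dec (cluster p ≡ cluster q)) → d p q ≡ dist P? Q? → View p q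
    go (yes p≡q) _        eq = equal p≡q eq
    go (no p≢q)  (yes cl) eq = near p≢q cl eq
    go (no p≢q)  (no ¬cl) eq = far p≢q ¬cl eq

  d-refl : ∀ p → d p p ≡ 0ℝ
  d-refl p = go (view p p)
    where
    go : View p p → d p p ≡ 0ℝ
    go (equal _ eq)   = eq
    go (near p≢p _ _) = ⊥-elim (p≢p refl)
    go (far p≢p _ _)  = ⊥-elim (p≢p refl)

  d-far : ∀ p q → cluster p ≢ cluster q → d p q ≡ D
  d-far p q ¬cl = go (view p q)
    where
    go : View p q → d p q ≡ D
    go (equal p≡q _) = ⊥-elim (¬cl (cong cluster p≡q))
    go (near _ cl _) = ⊥-elim (¬cl cl)
    go (far _ _ eq)  = eq

  private
    at : ∀ {x y : ℝ} m → x ≡ y → seq x m ≡ seq y m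
    at m = cong (λ x → seq x m)

  d-nonneg-at : ∀ p q m → N₀ ℕ.≤ m → 0ℚ ≤ seq (d p q) m
  d-nonneg-at p q m N₀≤m = go (view p q)
    where
    go : View p q → 0ℚ ≤ seq (d p q) m
    go (equal _ eq)  = ≤-reflexive (sym (at m eq))
    go (near _ _ eq) = subst (0ℚ ≤_) (sym (at m eq)) 0≤1
    go (far _ _ eq)  = subst (0ℚ ≤_) (sym (at m eq)) (≤-trans 0≤1 (1≤D m N₀≤m))

  1≤d-at : ∀ p q m → N₀ ℕ.≤ m → p ≢ q → 1ℚ ≤ seq (d p q) m
  1≤d-at p q m N₀≤m p≢q = go (view p q)
    where
    go : View p q → 1ℚ ≤ seq (d p q) m
    go (equal p≡q _) = ⊥-elim (p≢q p≡q)
    go (near _ _ eq) = ≤-reflexive (sym (at m eq))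
    go (far _ _ eq)  = subst (1ℚ ≤_) (sym (at m eq)) (1≤D m N₀≤m)

  d≤D-at : ∀ p q m → N₀ ℕ.≤ m → seq (d p q) m ≤ seq D m
  d≤D-at p q m N₀≤m = go (view p q)
    where
    go : View p q → seq (d p q) m ≤ seq D m
    go (equal _ eq)  = subst (_≤ seq D m) (sym (at m eq)) (≤-trans 0≤1 (1≤D m N₀≤m))
    go (near _ _ eq) = subst (_≤ seq D m) (sym (at m eq)) (1≤D m N₀≤m)
    go (far _ _ eq)  = ≤-reflexive (at m eq)

  d-sym-≡ : ∀ p q → d p q ≡ d q p
  d-sym-≡ p q = go (view p q) (view q p)
    where
    go : View p q → View q p → d p q ≡ d q p
    go (equal _ e)    (equal _ f)    = trans e (sym f)
    go (near _ _ e)   (near _ _ f)   = trans e (sym f)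
    go (far _ _ e)    (far _ _ f)    = trans e (sym f)
    go (equal p≡q _)  (near q≢p _ _) = ⊥-elim (q≢p (sym p≡q))
    go (equal p≡q _)  (far q≢p _ _)  = ⊥-elim (q≢p (sym p≡q))
    go (near p≢q _ _) (equal q≡p _)  = ⊥-elim (p≢q (sym q≡p))
    go (near _ cl _)  (far _ ¬cl _)  = ⊥-elim (¬cl (sym cl))
    go (far p≢q _ _)  (equal q≡p _)  = ⊥-elim (p≢q (sym q≡p))
    go (far _ ¬cl _)  (near _ cl _)  = ⊥-elim (¬cl (sym cl))

  d-triangle-at : ∀ p q s m → N₀ ℕ.≤ m → seq (d p s) m ≤ seq (d p q) m + seq (d q s) m
  d-triangle-at p q s m N₀≤m = go (view p q) (view p s)
    where
    go : View p q → View p s → seq (d p s) m ≤ seq (d p q) m + seq (d q s) m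
    go _ (equal _ e) = subst (_≤ seq (d p q) m + seq (d q s) m) (sym (at m e))
                         (0≤p+q (d-nonneg-at p q m N₀≤m) (d-nonneg-at q s m N₀≤m))
    go (equal refl _) _ = p≤q+p (seq (d p s) m) (d-nonneg-at p p m N₀≤m)
    go (near p≢q _ _) (near _ _ e) = subst (_≤ seq (d p q) m + seq (d q s) m) (sym (at m e))
                         (≤-trans (1≤d-at p q m N₀≤m p≢q) (p≤p+q (seq (d p q) m) (d-nonneg-at q s m N₀≤m)))
    go (far p≢q _ e′) _  = ≤-trans (subst (seq (d p s) m ≤_) (sym (at m e′)) (d≤D-at p s m N₀≤m))
                         (p≤p+q (seq (d p q) m) (d-nonneg-at q s m N₀≤m))
    -- Here `q` shares the cluster of `p` and `s` does not, so the second leg already has length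
    -- `D`.
    go (near _ cl _) (far _ ¬cl e) = ≤-trans (≤-reflexive (trans (at m e) (sym (at m (d-far q s (λ cl′ → ¬cl (trans cl cl′)))))))
                         (p≤q+p (seq (d q s) m) (d-nonneg-at p q m N₀≤m))

  d≈0⇒≡ : ∀ p q → d p q ≈ℝ 0ℝ → p ≡ q
  d≈0⇒≡ p q d≈0 = decidable-stable (p Fin.≟ q) (λ p≢q → <-irrefl refl (<-≤-trans ½<1 (begin
      1ℚ                                    ≤⟨ 1≤d-at p q m (ℕ.m≤n⊔m M N₀) p≢q ⟩
      seq (d p q) m                         ≡⟨ +-identityʳ (seq (d p q) m) ⟨
      seq (d p q) m - 0ℚ                    ≡⟨ 0≤p⇒∣p∣≡p (subst (0ℚ ≤_) (sym (+-identityʳ (seq (d p q) m))) (d-nonneg-at p q m (ℕ.m≤n⊔m M N₀))) ⟨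
      ℚ.∣ seq (d p q) m - 0ℚ ∣  ≤⟨ proj₂ (d≈0 ½ 0<½) m (ℕ.m≤m⊔n M N₀) ⟩
      ½                                     ∎)))
    where
    open ≤-Reasoning
    M m : ℕ
    M = proj₁ (d≈0 ½ 0<½)
    m = M ℕ.⊔ N₀

  metric : Metric N
  metric = record
    { d          = d
    ; d-nonneg   = λ p q → ≤-eventually 0ℝ (d p q) N₀ (d-nonneg-at p q)
    ; d-definite = λ p q → mk⇔ (d≈0⇒≡ p q) (λ { refl → subst (_≈ℝ 0ℝ) (sym (d-refl p)) (≈ℝ-refl 0ℝ) })
    ; d-sym      = λ p q → subst (d p q ≈ℝ_) (d-sym-≡ p q) (≈ℝ-refl (d p q))
    ; d-triangle = λ p q s → ≤-eventually (d p s) (d p q +ℝ d q s) N₀ (d-triangle-at p q s)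
    }

  -- Half of the gap witnessing 1 < D serves as the tolerance. This keeps different clusters out of
  -- each other's unit balls.
  D≰1 : ¬ (D ≤ℝ 1ℝ)
  D≰1 D≤1 = <-irrefl refl (begin-strict
    1ℚ + ½ · ε    <⟨ +-monoʳ-< 1ℚ ½ε<ε ⟩
    1ℚ + ε        ≤⟨ proj₂ (proj₂ (proj₂ 1<D)) m (ℕ.m≤n⊔m M N₀) ⟩
    seq D m       ≤⟨ proj₂ (D≤1 (½ · ε) 0<½ε) m (ℕ.m≤m⊔n M N₀) ⟩
    1ℚ + ½ · ε    ∎)
    where
    open ≤-Reasoning
    ε = proj₁ 1<D
    0<ε : 0ℚ < ε
    0<ε = proj₁ (proj₂ 1<D)
    0<½ε : 0ℚ < ½ · ε
    0<½ε = subst (_< ½ · ε) (*-zeroʳ ½) (*-monoʳ-<-pos ½ 0<ε)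
    ½ε<ε : ½ · ε < ε
    ½ε<ε = subst (½ · ε <_) (*-identityˡ ε) (*-monoˡ-<-pos ε {{positive 0<ε}} ½<1)
    M m : ℕ
    M = proj₁ (D≤1 (½ · ε) 0<½ε)
    m = M ℕ.⊔ N₀

  same⇒unitBall : ∀ p q → cluster p ≡ cluster q → d p q ≤ℝ 1ℝ
  same⇒unitBall p q cl = go (view p q)
    where
    go : View p q → d p q ≤ℝ 1ℝ
    go (equal _ e)   = subst (_≤ℝ 1ℝ) (sym e) (≤-pointwise 0ℝ 1ℝ (λ _ → 0≤1))
    go (near _ _ e)  = subst (_≤ℝ 1ℝ) (sym e) (≤-pointwise 1ℝ 1ℝ (λ _ → ≤-refl))
    go (far _ ¬cl _) = ⊥-elim (¬cl cl)

  unitBall⇒same : ∀ p q → d p q ≤ℝ 1ℝ → cluster p ≡ cluster q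
  unitBall⇒same p q d≤1 =
    decidable-stable (cluster? p q) (λ ¬cl → D≰1 (subst (_≤ℝ 1ℝ) (d-far p q ¬cl) d≤1))

  instance-I : Instance N n (2 ℕ.* n) (2 ℕ.* n)
  instance-I = record
    { metric    = metric
    ; R         = Red
    -- Unit balls are exactly clusters, so the decision is made on finite data instead of on reals.
    ; unitBall? = λ p q → map′ (same⇒unitBall p q) (unitBall⇒same p q) (cluster? p q)
    }

  open Instance instance-I using (EverySolutionHasRadius≥; IsSolution; Covered; unitBall?)

  -- If some point is covered from another cluster, the radius bounds a distance equal to `D`.
  -- Otherwise every point is served within its cluster, which the counting excludes.
  radius≥D : ¬ (2 ∣ n) → EverySolutionHasRadius≥ D
  radius≥D odd ρ C (C≤n , (S , 2n≤S , hS) , (T , 2n≤T , hT)) =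
    go (clustered S (λ p p∈S → proj₂ (hS p p∈S))) (clustered T (λ p p∈T → proj₂ (hT p p∈T)))
    where
    at-point : ∀ {S p} → Dec (p ∈ S) → (p ∈ S → Covered C ρ p) →
               (p ∈ S → ∃ λ c → c ∈ C × cluster c ≡ cluster p) ⊎ D ≤ℝ ρ
    at-point         (no p∉S)  _   = inj₁ (λ p∈S → ⊥-elim (p∉S p∈S))
    at-point {p = p} (yes p∈S) cov = near-center (cov p∈S)
      where
      near-center : Covered C ρ p → (p ∈ _ → ∃ λ c → c ∈ C × cluster c ≡ cluster p) ⊎ D ≤ℝ ρ
      near-center (c , c∈C , d≤ρ) = decide (cluster? c p)
        where
        decide : Dec (cluster c ≡ cluster p) → (p ∈ _ → ∃ λ c → c ∈ C × cluster c ≡ cluster p) ⊎ D ≤ℝ ρ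
        decide (yes cl) = inj₁ (λ _ → c , c∈C , cl)
        decide (no ¬cl) = inj₂ (subst (_≤ℝ ρ) (d-far c p ¬cl) d≤ρ)
    clustered : ∀ S → (∀ p → p ∈ S → Covered C ρ p) → Clustered C S ⊎ D ≤ℝ ρ
    clustered S cov = all-or (λ p → at-point (p ∈? S) (cov p))
    go : Clustered C S ⊎ D ≤ℝ ρ → Clustered C T ⊎ D ≤ℝ ρ → D ≤ℝ ρ
    go (inj₂ D≤ρ) _          = D≤ρ
    go (inj₁ _)   (inj₂ D≤ρ) = D≤ρ
    go (inj₁ clS) (inj₁ clT) = ⊥-elim (no-clustered-solution odd C S T C≤n 2n≤S 2n≤T
      (λ p p∈S → proj₁ (hS p p∈S)) (λ p p∈T → proj₁ (hT p p∈T)) (clS , clT))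

  -- All distances are at most `D`, so a single center covers everything at radius `D`; the argument
  -- supplies a gadget to put it in.
  solvable : Fin n → ∃ λ ρ → ∃ λ C → IsSolution ρ C
  solvable i = D , ⁅ c ⁆ , subst (ℕ._≤ n) (sym (∣⁅x⁆∣≡1 c)) (ℕ.≤-trans (ℕ.s≤s ℕ.z≤n) (Fin.toℕ<n i)) ,
    (Red , 2n≤∣Red∣ , λ p p∈R → p∈R , covered p) ,
    (∁ Red , 2n≤∣∁Red∣ , λ p p∈B → p∈B , covered p)
    where
    c : Fin N
    c = point 0F i
    covered : ∀ p → Covered ⁅ c ⁆ D p
    covered p = c , x∈⁅x⁆ c , ≤-eventually (d c p) D N₀ (d≤D-at c p)

  -- The integral assignment for a choice of one cluster per gadget: the chosen clusters are fully
  -- covered, and each has its designated center open.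
  xval zval : Fin N → Subset n → ℚ
  zval p x = lit (isA (part p)) (index p) x
  xval p x = boolℚ (isCenter (part p)) · zval p x

  val : Fin (N ℕ.+ N) → Subset n → ℚ
  val v = [ xval , zval ]′ (splitAt N v)

  val-idem : ∀ v x → val v x · val v x ≡ val v x
  val-idem v x = go (splitAt N v)
    where
    center : ∀ b l → l · l ≡ l → boolℚ b · l · (boolℚ b · l) ≡ boolℚ b · l
    center true  l idem = trans (solve 1 (λ l → con 1ℚ :* l :* (con 1ℚ :* l) := con 1ℚ :* (l :* l)) refl l) (cong (1ℚ ·_) idem)
    center false l _    = solve 1 (λ l → con 0ℚ :* l :* (con 0ℚ :* l) := con 0ℚ :* l) refl l
    go : ∀ s → [ xval , zval ]′ s x · [ xval , zval ]′ s x ≡ [ xval , zval ]′ s x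
    go (inj₁ p) = center (isCenter (part p)) (zval p x) (lit-idem (isA (part p)) (index p) x)
    go (inj₂ p) = lit-idem (isA (part p)) (index p) x

  val-Rep : ∀ v {e f} → Rep e f → Rep (suc e) (λ x → val v x · f x)
  val-Rep v {e} {f} rep = go (splitAt N v)
    where
    center : ∀ b p → Rep (suc e) (λ x → boolℚ b · zval p x · f x)
    center true  p = Rep-cong (λ x → cong (_· f x) (sym (*-identityˡ (zval p x)))) (lit-Rep (isA (part p)) (index p) rep)
    center false p = Rep-cong (λ x → solve 2 (λ l f → con 0ℚ := con 0ℚ :* l :* f) refl (zval p x) (f x)) Rep-zero
    go : ∀ s → Rep (suc e) (λ x → [ xval , zval ]′ s x · f x)
    go (inj₁ p) = center (isCenter (part p)) p
    go (inj₂ p) = lit-Rep (isA (part p)) (index p) rep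

  sum-xz : ∀ (α β : Fin N → ℝ) m x →
    ∑ (allFin (N ℕ.+ N)) (λ v → seq (([ α , β ]′ ∘ splitAt N) v) m · val v x)
    ≡ sumℚ (λ p → seq (α p) m · xval p x) + sumℚ (λ p → seq (β p) m · zval p x)
  sum-xz α β m x = trans (∑-allFin (λ v → F (splitAt N v))) (trans (sumℚ-++ N (λ v → F (splitAt N v)))
    (cong₂ _+_ (ℚΣ.sum-cong-≗ (λ p → cong F (Fin.splitAt-↑ˡ N p N)))
               (ℚΣ.sum-cong-≗ (λ p → cong F (Fin.splitAt-↑ʳ N N p)))))
    where
    F : Fin N ⊎ Fin N → ℚ
    F s = seq ([ α , β ]′ s) m · [ xval , zval ]′ s x

  -- The weights depend only on the position within the gadget, so the sum sees `x` only through the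
  -- numbers ∣x∣ and n - ∣x∣ of chosen clusters of the two types.
  sum-weighted : ∀ (u : Fin 8 → ℚ) (f : Fin N → ℚ) x → (∀ p → f p ≡ u (part p) · zval p x) →
    sumℚ f ≡ (u 0F + u 1F + u 2F + u 3F) · ι ∣ x ∣ + (u 4F + u 5F + u 6F + u 7F) · (ι n - ι ∣ x ∣)
  sum-weighted u f x f≡ = begin
    sumℚ f                                                ≡⟨ sumℚ-combine 8 n f ⟩
    sumℚ (λ a → sumℚ (λ i → f (point a i)))               ≡⟨ ℚΣ.sum-cong-≗ (λ a → begin
      sumℚ (λ i → f (point a i))                            ≡⟨ ℚΣ.sum-cong-≗ (λ i → trans (f≡ (point a i))
                                                                 (cong₂ (λ a i → u a · lit (isA a) i x) (part-point a i) (index-point a i))) ⟩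
      sumℚ (λ i → u a · lit (isA a) i x)                    ≡⟨ ℚΣ.*-distribˡ-sum (u a) (λ i → lit (isA a) i x) ⟨
      u a · sumℚ (λ i → lit (isA a) i x)                    ≡⟨ cong (u a ·_) (sum-lit (isA a) x) ⟩
      u a · litSum (isA a) x                                ∎) ⟩
    sumℚ (λ a → u a · litSum (isA a) x)                   ≡⟨ sum-litSum u x ⟩
    _                                                     ∎
    where open ≡-Reasoning

  sum-zero : ∀ (f : Fin N → ℚ) → sumℚ (λ p → 0ℚ · f p) ≡ 0ℚ
  sum-zero f = trans (ℚΣ.sum-cong-≗ (λ p → *-zeroˡ (f p))) (ℚΣ.sum-replicate-zero N)

  module _ (0<n : 0 ℕ.< n) where
    open Substitution {n} {N ℕ.+ N} 0<n val val-idem val-Rep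

    -- Each gadget opens exactly one center, so the budget n is met with equality and σ is 0.
    centers-balanced : Balanced (centers instance-I)
    centers-balanced = 0ℚ , λ m x → trans
      (cong (ι n +_) (trans (sum-xz (λ _ → -ℝ 1ℝ) (λ _ → 0ℝ) m x) (cong₂ _+_
        (sum-weighted (λ a → (- 1ℚ) · boolℚ (isCenter a)) _ x (λ p → sym (*-assoc (- 1ℚ) (boolℚ (isCenter (part p))) (zval p x))))
        (sum-zero (λ p → zval p x)))))
      (solve 2 (λ n w → n :+ ((con (- 1ℚ + 0ℚ + 0ℚ + 0ℚ) :* w :+ con (- 1ℚ + 0ℚ + 0ℚ + 0ℚ) :* (n :- w)) :+ con 0ℚ)
                := con 0ℚ :* (w :+ w :- n)) refl (ι n) (ι ∣ x ∣))

    ι-2n : ι (2 ℕ.* n) ≡ ι n + ι n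
    ι-2n = trans (ι-+ n (n ℕ.+ 0)) (cong (λ k → ι n + ι k) (ℕ.+-identityʳ n))

    -- The red points covered are 3∣x∣ + (n - ∣x∣), which exceeds 2n by 2∣x∣ - n.
    red-balanced : Balanced (red instance-I)
    red-balanced = 1ℚ , λ m x → trans
      (cong₂ (λ c s → - c + s) ι-2n (trans (sum-xz (λ _ → 0ℝ) (λ j → 𝟙[ j ∈? Red ]) m x) (cong₂ _+_
        (sum-zero (λ p → xval p x))
        (sum-weighted (boolℚ ∘ isRed) _ x (λ p → cong (_· zval p x)
          (trans (seq-𝟙 (p ∈? Red) m) (trans (ind-∈ p Red) (cong boolℚ (lookup-Red p)))))))))
      (solve 2 (λ n w → :- (n :+ n) :+ (con 0ℚ :+ (con (1ℚ + 1ℚ + 1ℚ + 0ℚ) :* w :+ con (1ℚ + 0ℚ + 0ℚ + 0ℚ) :* (n :- w)))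
                := con 1ℚ :* (w :+ w :- n)) refl (ι n) (ι ∣ x ∣))

    -- The blue points covered are ∣x∣ + 3(n - ∣x∣), so the slack is the negative of the red one;
    -- both can be nonnegative only at ∣x∣ = n/2.
    blue-balanced : Balanced (blue instance-I)
    blue-balanced = - 1ℚ , λ m x → trans
      (cong₂ (λ c s → - c + s) ι-2n (trans (sum-xz (λ _ → 0ℝ) (λ j → 𝟙[ j ∈? ∁ Red ]) m x) (cong₂ _+_
        (sum-zero (λ p → xval p x))
        (sum-weighted (boolℚ ∘ not ∘ isRed) _ x (λ p → cong (_· zval p x)
          (trans (seq-𝟙 (p ∈? ∁ Red) m) (trans (ind-∈ p (∁ Red)) (cong boolℚ (lookup-∁Red p)))))))))
      (solve 2 (λ n w → :- (n :+ n) :+ (con 0ℚ :+ (con (0ℚ + 0ℚ + 0ℚ + 1ℚ) :* w :+ con (0ℚ + 1ℚ + 1ℚ + 1ℚ) :* (n :- w)))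
                := con (- 1ℚ) :* (w :+ w :- n)) refl (ι n) (ι ∣ x ∣))

    -- The unit ball around `j` is its cluster, which contains exactly one possible center, and that
    -- center is open exactly when the cluster is chosen.
    ball-sum : ∀ j m x → sumℚ (λ p → seq 𝟙[ unitBall? j p ] m · xval p x) ≡ zval j x
    ball-sum j m x = begin
      sumℚ (λ p → seq 𝟙[ unitBall? j p ] m · xval p x)
        ≡⟨ sumℚ-combine 8 n (λ p → seq 𝟙[ unitBall? j p ] m · xval p x) ⟩
      sumℚ (λ a → sumℚ (λ i → seq 𝟙[ unitBall? j (point a i) ] m · xval (point a i) x))
        ≡⟨ ℚΣ.sum-cong-≗ (λ a → begin
             sumℚ (λ i → seq 𝟙[ unitBall? j (point a i) ] m · xval (point a i) x)
               ≡⟨ ℚΣ.sum-cong-≗ (term a) ⟩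
             sumℚ (λ i → e b a · (ind (i Fin.≟ k) · lit b i x))
               ≡⟨ ℚΣ.*-distribˡ-sum (e b a) (λ i → ind (i Fin.≟ k) · lit b i x) ⟨
             e b a · sumℚ (λ i → ind (i Fin.≟ k) · lit b i x)
               ≡⟨ cong (e b a ·_) (sumℚ-δ k (λ i → lit b i x)) ⟩
             e b a · lit b k x ∎) ⟩
      sumℚ (λ a → e b a · lit b k x)
        ≡⟨ ℚΣ.*-distribʳ-sum (lit b k x) (e b) ⟨
      sumℚ (e b) · lit b k x
        ≡⟨ cong (_· lit b k x) (sum-e b) ⟩
      1ℚ · lit b k x
        ≡⟨ *-identityˡ (lit b k x) ⟩
      lit b k x ∎
      where
      open ≡-Reasoning
      b : Bool
      b = isA (part j)
      k : Fin n
      k = index j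
      e : Bool → Fin 8 → ℚ
      e b a = ind (isA a Bool.≟ b) · boolℚ (isCenter a)
      sum-e : ∀ b → sumℚ (e b) ≡ 1ℚ
      sum-e true  = refl
      sum-e false = refl
      term : ∀ a i → seq 𝟙[ unitBall? j (point a i) ] m · xval (point a i) x ≡ e b a · (ind (i Fin.≟ k) · lit b i x)
      term a i = begin
        seq 𝟙[ unitBall? j (point a i) ] m · xval (point a i) x
          ≡⟨ cong₂ _·_ (trans (seq-𝟙 (unitBall? j (point a i)) m)
               (ind-cong (unitBall? j (point a i)) (Product.≡-dec Bool._≟_ Fin._≟_ (isA a , i) (b , k))
                 (λ le → trans (sym cl≡) (sym (unitBall⇒same j (point a i) le)))
                 (λ eq → same⇒unitBall j (point a i) (sym (trans cl≡ eq)))))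
               (cong₂ (λ a i → boolℚ (isCenter a) · lit (isA a) i x) (part-point a i) (index-point a i)) ⟩
        ind (Product.≡-dec Bool._≟_ Fin._≟_ (isA a , i) (b , k)) · (boolℚ (isCenter a) · lit (isA a) i x)
          ≡⟨ split (isA a) ⟩
        ind (isA a Bool.≟ b) · boolℚ (isCenter a) · (ind (i Fin.≟ k) · lit b i x) ∎
        where
        cl≡ : cluster (point a i) ≡ (isA a , i)
        cl≡ = cong₂ (λ a i → isA a , i) (part-point a i) (index-point a i)
        c : ℚ
        c = boolℚ (isCenter a)
        split : ∀ b′ → ind (Product.≡-dec Bool._≟_ Fin._≟_ (b′ , i) (b , k)) · (c · lit b′ i x)
                     ≡ ind (b′ Bool.≟ b) · c · (ind (i Fin.≟ k) · lit b i x)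
        split b′ = go (b′ Bool.≟ b)
          where
          go : Dec (b′ ≡ b) → ind (Product.≡-dec Bool._≟_ Fin._≟_ (b′ , i) (b , k)) · (c · lit b′ i x)
                            ≡ ind (b′ Bool.≟ b) · c · (ind (i Fin.≟ k) · lit b i x)
          go (yes b′≡b) = begin
            ind (Product.≡-dec Bool._≟_ Fin._≟_ (b′ , i) (b , k)) · (c · lit b′ i x)
              ≡⟨ cong₂ (λ q β → q · (c · lit β i x))
                   (ind-cong (Product.≡-dec Bool._≟_ Fin._≟_ (b′ , i) (b , k)) (i Fin.≟ k) (cong proj₂) (cong₂ _,_ b′≡b)) b′≡b ⟩
            ind (i Fin.≟ k) · (c · lit b i x)
              ≡⟨ solve 3 (λ d c l → d :* (c :* l) := con 1ℚ :* c :* (d :* l)) refl (ind (i Fin.≟ k)) c (lit b i x) ⟩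
            1ℚ · c · (ind (i Fin.≟ k) · lit b i x)
              ≡⟨ cong (λ q → q · c · (ind (i Fin.≟ k) · lit b i x)) (ind-yes (b′ Bool.≟ b) b′≡b) ⟨
            ind (b′ Bool.≟ b) · c · (ind (i Fin.≟ k) · lit b i x) ∎
          go (no b′≢b) = begin
            ind (Product.≡-dec Bool._≟_ Fin._≟_ (b′ , i) (b , k)) · (c · lit b′ i x)
              ≡⟨ cong (_· (c · lit b′ i x)) (ind-no (Product.≡-dec Bool._≟_ Fin._≟_ (b′ , i) (b , k)) (λ eq → b′≢b (cong proj₁ eq))) ⟩
            0ℚ · (c · lit b′ i x)
              ≡⟨ solve 4 (λ c l d l′ → con 0ℚ :* (c :* l) := con 0ℚ :* c :* (d :* l′)) refl c (lit b′ i x) (ind (i Fin.≟ k)) (lit b i x) ⟩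
            0ℚ · c · (ind (i Fin.≟ k) · lit b i x)
              ≡⟨ cong (λ q → q · c · (ind (i Fin.≟ k) · lit b i x)) (ind-no (b′ Bool.≟ b) b′≢b) ⟨
            ind (b′ Bool.≟ b) · c · (ind (i Fin.≟ k) · lit b i x) ∎

    coverage-balanced : ∀ j → Balanced (coverage instance-I j)
    coverage-balanced j = 0ℚ , λ m x → trans
      (cong (0ℚ +_) (trans (sum-xz (λ i → 𝟙[ unitBall? j i ]) (λ i → -ℝ 𝟙[ i Fin.≟ j ]) m x) (cong₂ _+_
        (ball-sum j m x)
        (begin
          sumℚ (λ p → (- seq 𝟙[ p Fin.≟ j ] m) · zval p x)           ≡⟨ ℚΣ.sum-cong-≗ (λ p → trans (cong (λ q → (- q) · zval p x) (seq-𝟙 (p Fin.≟ j) m))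
            (solve 2 (λ d z → (:- d) :* z := (:- con 1ℚ) :* (d :* z)) refl (ind (p Fin.≟ j)) (zval p x))) ⟩
          sumℚ (λ p → (- 1ℚ) · (ind (p Fin.≟ j) · zval p x))         ≡⟨ ℚΣ.*-distribˡ-sum (- 1ℚ) (λ p → ind (p Fin.≟ j) · zval p x) ⟨
          (- 1ℚ) · sumℚ (λ p → ind (p Fin.≟ j) · zval p x)           ≡⟨ cong ((- 1ℚ) ·_) (sumℚ-δ j (λ p → zval p x)) ⟩
          (- 1ℚ) · zval j x                                          ∎))))
      (solve 3 (λ z w n → con 0ℚ :+ (z :+ (:- con 1ℚ) :* z) := con 0ℚ :* (w :+ w :- n)) refl (zval j x) (ι ∣ x ∣) (ι n))
      where open ≡-Reasoning

    LP1-feasible : ∀ t → (t ℕ.+ t) ℕ.+ (t ℕ.+ t) ℕ.≤ n → SoSNonempty t (LP1 instance-I)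
    LP1-feasible t 4t≤n = SoS-feasible t 4t≤n
      (centers-balanced ∷ red-balanced ∷ blue-balanced ∷ tabulate⁺ coverage-balanced)

-- The constant 1/4 and the conclusion

quarter : ℚ
quarter = ½ · ½

-- The real inequality holds only up to a tolerance, but both sides of 4t ≤ n are integers, so an
-- error below 1 is enough.
quarter-bound : ∀ n t → fromℕ t ≤ℝ fromℚ quarter *ℝ fromℕ n → (t ℕ.+ t) ℕ.+ (t ℕ.+ t) ℕ.≤ n
quarter-bound n t t≤n/4 = ℕ.≮⇒≥ λ n<4t → <-irrefl refl (begin-strict
  ι n + ½                                   <⟨ +-monoʳ-< (ι n) ½<1 ⟩
  ι n + 1ℚ                                  ≡⟨ trans (+-comm (ι n) 1ℚ) (sym (ι-suc n)) ⟩
  ι (suc n)                                 ≤⟨ ι-mono-≤ n<4t ⟩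
  ι ((t ℕ.+ t) ℕ.+ (t ℕ.+ t))               ≡⟨ trans (ι-+ (t ℕ.+ t) (t ℕ.+ t)) (cong (λ s → s + s) (ι-+ t t)) ⟩
  (ι t + ι t) + (ι t + ι t)                 ≤⟨ +-mono-≤ (+-mono-≤ le le) (+-mono-≤ le le) ⟩
  (b + b) + (b + b)                         ≡⟨ solve 1 (λ n → ((con quarter :* n :+ con ε) :+ (con quarter :* n :+ con ε))
                                                 :+ ((con quarter :* n :+ con ε) :+ (con quarter :* n :+ con ε)) := n :+ con ½) refl (ι n) ⟩
  ι n + ½                                   ∎)
  where
  open ≤-Reasoning
  ε b : ℚ
  -- The tolerance 1/8 grows to 1/2 when multiplied by 4.
  ε = ½ · quarter
  b = quarter · ι n + ε
  0<ε : 0ℚ < ε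
  0<ε = positive⁻¹ ε
  le : ι t ≤ b
  le = proj₂ (t≤n/4 ε 0<ε) (proj₁ (t≤n/4 ε 0<ε)) ℕ.≤-refl

odd⇒0<n : ∀ {n} → ¬ (2 ∣ n) → 0 ℕ.< n
odd⇒0<n {zero}  odd = ⊥-elim (odd (2 ∣0))
odd⇒0<n {suc n} odd = ℕ.s≤s ℕ.z≤n

p≤∣p∣ : ∀ p → p ≤ ℚ.∣ p ∣
p≤∣p∣ p with ≤-total 0ℚ p
... | inj₁ 0≤p = ≤-reflexive (sym (0≤p⇒∣p∣≡p 0≤p))
... | inj₂ p≤0 = ≤-trans p≤0 (0≤∣p∣ p)

-- An unbounded gap is claimed for every real, including those not above 1, while the metric needs a
-- distance above 1. A larger rational serves: one summand 1 absorbs the Cauchy error, the other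
-- helps keep the result strictly above 1.
rational-bound : ∀ D → ∃ λ q → 1ℝ <ℝ fromℚ q × ∃ λ N → ∀ m → N ℕ.≤ m → seq D m ≤ q
rational-bound D = q , (1ℚ , 0<1 , 0 , λ _ _ → +-monoˡ-≤ 1ℚ (p≤q+p 1ℚ (0≤∣p∣ (seq D N)))) , N , bound
  where
  open ≤-Reasoning
  0<1 : 0ℚ < 1ℚ
  0<1 = positive⁻¹ 1ℚ
  N : ℕ
  N = proj₁ (cauchy D 1ℚ 0<1)
  q : ℚ
  q = ℚ.∣ seq D N ∣ + 1ℚ + 1ℚ
  bound : ∀ m → N ℕ.≤ m → seq D m ≤ q
  bound m N≤m = begin
    seq D m                                      ≡⟨ solve 2 (λ a b → a := b :+ (a :- b)) refl (seq D m) (seq D N) ⟩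
    seq D N + (seq D m - seq D N)                ≤⟨ +-mono-≤ (p≤∣p∣ (seq D N)) (p≤∣p∣ (seq D m - seq D N)) ⟩
    ℚ.∣ seq D N ∣ + ℚ.∣ seq D m - seq D N ∣      ≤⟨ +-monoʳ-≤ ℚ.∣ seq D N ∣ (proj₂ (cauchy D 1ℚ 0<1) m N N≤m ℕ.≤-refl) ⟩
    ℚ.∣ seq D N ∣ + 1ℚ                           ≤⟨ p≤p+q (ℚ.∣ seq D N ∣ + 1ℚ) (<⇒≤ 0<1) ⟩
    q                                            ∎

≤ℝ-trans-bound : ∀ x y q → (∃ λ N → ∀ m → N ℕ.≤ m → seq x m ≤ q) → fromℚ q ≤ℝ y → x ≤ℝ y
≤ℝ-trans-bound x y q (N , x≤q) q≤y ε 0<ε = N ℕ.⊔ M , λ m le →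
  ≤-trans (x≤q m (ℕ.m⊔n≤o⇒m≤o N M le)) (proj₂ (q≤y ε 0<ε) m (ℕ.m⊔n≤o⇒n≤o N M le))
  where
  M : ℕ
  M = proj₁ (q≤y ε 0<ε)

theorem5 : ∃ λ (c : ℝ) → 0ℝ <ℝ c ×
    (∀ (n : ℕ) → ¬ (2 ∣ n) → ∀ (D : ℝ) → 1ℝ <ℝ D →
      Σ (Instance (8 * n) n (2 * n) (2 * n)) λ I →
        Instance.EverySolutionHasRadius≥ I D ×
        (∀ (t : ℕ) → fromℕ t ≤ℝ c *ℝ fromℕ n → SoSNonempty t (LP1 I))) ×
    (∀ (n : ℕ) → ¬ (2 ∣ n) → ∀ (t : ℕ) → fromℕ t ≤ℝ c *ℝ fromℕ n →
      UnboundedIntegralityGap (8 * n) t)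
theorem5 = fromℚ quarter ,
  (quarter , positive⁻¹ quarter , 0 , λ _ _ → ≤-reflexive (+-identityˡ quarter)) ,
  gap , unbounded
  where
  gap : ∀ (n : ℕ) → ¬ (2 ∣ n) → ∀ (D : ℝ) → 1ℝ <ℝ D →
    Σ (Instance (8 * n) n (2 * n) (2 * n)) λ I →
      Instance.EverySolutionHasRadius≥ I D ×
      (∀ (t : ℕ) → fromℕ t ≤ℝ fromℚ quarter *ℝ fromℕ n → SoSNonempty t (LP1 I))
  gap n odd D 1<D = instance-I , radius≥D odd , λ t t≤n/4 → LP1-feasible (odd⇒0<n odd) t (quarter-bound n t t≤n/4)
    where open Construction n D 1<D
  unbounded : ∀ (n : ℕ) → ¬ (2 ∣ n) → ∀ (t : ℕ) → fromℕ t ≤ℝ fromℚ quarter *ℝ fromℕ n →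
    UnboundedIntegralityGap (8 * n) t
  -- The instance is built for the rational bound `q`; a radius of at least `q` is also at least
  -- `D`.
  unbounded n odd t t≤n/4 D = n , 2 * n , 2 * n , instance-I ,
    solvable (fromℕ< (odd⇒0<n odd)) ,
    (λ ρ C sol → ≤ℝ-trans-bound D ρ q (proj₂ (proj₂ (rational-bound D))) (radius≥D odd ρ C sol)) ,
    LP1-feasible (odd⇒0<n odd) t (quarter-bound n t t≤n/4)
    where
    q : ℚ
    q = proj₁ (rational-bound D)
    open Construction n (fromℚ q) (proj₁ (proj₂ (rational-bound D)))
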